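{- There exists a parallel algorithm that constructs a Huffman tree for $n$ input objects in $O(n\log n)$ work and $O(H\log n)$ span, where $H$ is the height of the Huffman tree.
   Context: Huffman tree: given $n\geq 2$ objects $S_i$ with positive frequencies $f_i$, the construction repeatedly extracts two objects $S_i,S_j$ with the smallest frequencies in the current object set, removes them, and inserts a new object $S_k$ of frequency $f_k=f_i+f_j$, with $S_k$ the parent of $S_i$ and $S_j$, until only one object (the root) remains. $H$ is the height of the resulting tree. Model: work-span binary-forking model. Threads share memory and run standard RAM instructions and a fork instruction that creates two child threads (the parent is suspended until both terminate), together with the atomic test-and-set. Work is the total number of instructions; span is the length of the longest chain of dependent instructions. -}

module Defs where

open import Algebra.Structures using (IsCommutativeMonoid)
open import Data.Bool.Base using (if_then_else_)
open import Data.Fin.Base using (Fin; toℕ; fromℕ<)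
open import Data.List.Base using (List; _∷_; [_]; map; allFin; head; drop)
open import Data.List.Relation.Binary.Permutation.Propositional using (_↭_)
open import Data.List.Relation.Unary.All using (All)
open import Data.Maybe.Base using (fromMaybe)
open import Data.Nat.Base using (ℕ; suc; _+_; _∸_; _⊔_; _≤_; _≡ᵇ_; _≤ᵇ_; ⌊_/2⌋)
open import Data.Nat.Properties using (_<?_)
open import Data.Product.Base using (Σ-syntax; ∃; _×_; _,_)
open import Level using (0ℓ)
open import Relation.Binary.Construct.Closure.ReflexiveTransitive using (Star)
import Relation.Binary.Construct.NonStrictToStrict as ToStrict
open import Relation.Binary.Core using (Rel)
open import Relation.Binary.PropositionalEquality.Core using (_≡_)
open import Relation.Binary.Structures using (IsDecTotalOrder)
open import Relation.Nullary.Decidable.Core using (does; yes; no)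

-- The frequencies range over an arbitrary totally ordered, cancellative
-- commutative monoid, e.g. the naturals, the rationals, or the reals of a
-- real RAM (where comparison is a primitive operation).
record FrequencyDomain : Set₁ where
  infix  4 _≈ᶠ_ _≤ᶠ_ _<ᶠ_
  infixl 6 _+ᶠ_
  field
    Freq                : Set
    _≈ᶠ_                : Rel Freq 0ℓ
    _≤ᶠ_                : Rel Freq 0ℓ
    _+ᶠ_                : Freq → Freq → Freq
    0ᶠ                  : Freq
    isDecTotalOrder     : IsDecTotalOrder _≈ᶠ_ _≤ᶠ_
    isCommutativeMonoid : IsCommutativeMonoid _≈ᶠ_ _+ᶠ_ 0ᶠ
    +ᶠ-monoˡ-≤          : ∀ x {y z} → y ≤ᶠ z → y +ᶠ x ≤ᶠ z +ᶠ x
    +ᶠ-cancelʳ-≤        : ∀ x {y z} → y +ᶠ x ≤ᶠ z +ᶠ x → y ≤ᶠ z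

  open IsDecTotalOrder isDecTotalOrder public using () renaming (_≤?_ to _≤ᶠ?_)

  _<ᶠ_ : Rel Freq 0ℓ
  _<ᶠ_ = ToStrict._<_ _≈ᶠ_ _≤ᶠ_

------------------------------------------------------------------------
-- Huffman trees

data Tree (n : ℕ) : Set where
  leaf : Fin n → Tree n
  node : Tree n → Tree n → Tree n

height : ∀ {n} → Tree n → ℕ
height (leaf _)   = 0
height (node l r) = suc (height l ⊔ height r)

module Huffman (𝓕 : FrequencyDomain) {n : ℕ}
               (f : Fin n → FrequencyDomain.Freq 𝓕) where
  open FrequencyDomain 𝓕

  freq : Tree n → Freq
  freq (leaf i)   = f i
  freq (node l r) = freq l +ᶠ freq r

  -- An object is identified with the subtree below it.  Ties are broken
  -- arbitrarily, and so is the left-to-right order of the two children.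
  data _⇝_ : Rel (List (Tree n)) 0ℓ where
    merge : ∀ {objects a b rest} →
            objects ↭ a ∷ b ∷ rest →
            All (λ t → freq a ≤ᶠ freq t × freq b ≤ᶠ freq t) rest →
            objects ⇝ (node a b ∷ rest)

  IsHuffmanTree : Tree n → Set
  IsHuffmanTree T = Star _⇝_ (map leaf (allFin n)) [ T ]

------------------------------------------------------------------------
-- The binary-forking machine

Register Label Address : Set
Register = ℕ
Label    = ℕ
Address  = ℕ

-- Every thread has word registers and frequency registers, and the shared
-- memory has a word part and a frequency part.  Words are natural numbers
-- and serve as data, indices and addresses; the only operations on
-- frequencies are copying, addition and comparison.  The instruction set is
-- deliberately lean (no unit-cost multiplication of words, no conversion
-- between words and frequencies); a program may mention only finitely many
-- registers.
data Instr : Set where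
  const : Register → ℕ → Instr
  move  : Register → Register → Instr
  add   : Register → Register → Register → Instr
  sub   : Register → Register → Register → Instr  -- truncated at zero
  half  : Register → Register → Instr
  load  : Register → Register → Instr             -- destination, address
  store : Register → Register → Instr             -- address, source
  tas   : Register → Register → Instr             -- destination, address
  fmove  : Register → Register → Instr
  fadd   : Register → Register → Register → Instr
  fload  : Register → Register → Instr            -- destination, address
  fstore : Register → Register → Instr            -- address, source
  jump : Label → Instr
  jle  : Register → Register → Label → Instr
  fjle : Register → Register → Label → Instr
  fork : Label → Label → Instr
  halt : Instr

Program : Set
Program = List Instr

fetch : Program → Label → Instr
fetch P pc = fromMaybe halt (head (drop pc P))

infixl 9 _[_≔_]
_[_≔_] : {A : Set} → (ℕ → A) → ℕ → A → (ℕ → A)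
(g [ i ≔ x ]) j = if j ≡ᵇ i then x else g j

module Machine (𝓕 : FrequencyDomain) where
  open FrequencyDomain 𝓕

  -- Used both for the register file of a thread and for the shared memory.
  record Store : Set where
    constructor ⟨_,_⟩
    field
      words : ℕ → ℕ
      freqs : ℕ → Freq
  open Store public

  -- The nested structure of the currently existing threads.  The number
  -- carried by a thread that is not suspended is the length of the longest
  -- chain of dependent instructions ending at its most recent instruction.
  data Threads : Set where
    running   : Label → Store → ℕ → Threads
    suspended : Label → Store → Threads → Threads → Threads
    finished  : Store → ℕ → Threads

  -- The effect of one instruction of a thread with program counter pc,
  -- registers ⟨ r , q ⟩ and span s on shared memory ⟨ m , d ⟩.
  execute : Instr → Label → Store → ℕ → Store → Threads × Store
  execute instr pc ⟨ r , q ⟩ s ⟨ m , d ⟩ = go instr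
    where
    next : (ℕ → ℕ) → (ℕ → Freq) → (ℕ → ℕ) → (ℕ → Freq) → Threads × Store
    next r′ q′ m′ d′ = running (suc pc) ⟨ r′ , q′ ⟩ (suc s) , ⟨ m′ , d′ ⟩

    goto : Label → Threads × Store
    goto l = running l ⟨ r , q ⟩ (suc s) , ⟨ m , d ⟩

    go : Instr → Threads × Store
    go (const x k)  = next (r [ x ≔ k ]) q m d
    go (move x y)   = next (r [ x ≔ r y ]) q m d
    go (add x y z)  = next (r [ x ≔ r y + r z ]) q m d
    go (sub x y z)  = next (r [ x ≔ r y ∸ r z ]) q m d
    go (half x y)   = next (r [ x ≔ ⌊ r y /2⌋ ]) q m d
    go (load x a)   = next (r [ x ≔ m (r a) ]) q m d
    go (store a x)  = next r q (m [ r a ≔ r x ]) d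
    go (tas x a)    = next (r [ x ≔ m (r a) ]) q (m [ r a ≔ 1 ]) d
    go (fmove x y)  = next r (q [ x ≔ q y ]) m d
    go (fadd x y z) = next r (q [ x ≔ q y +ᶠ q z ]) m d
    go (fload x a)  = next r (q [ x ≔ d (r a) ]) m d
    go (fstore a x) = next r q m (d [ r a ≔ q x ])
    go (jump l)     = goto l
    go (jle x y l)  = goto (if r x ≤ᵇ r y then l else suc pc)
    go (fjle x y l) = goto (if does (q x ≤ᶠ? q y) then l else suc pc)
    go (fork l₁ l₂) =
      suspended (suc pc) ⟨ r , q ⟩
        (running l₁ ⟨ r , q ⟩ (suc s)) (running l₂ ⟨ r , q ⟩ (suc s))
      , ⟨ m , d ⟩
    go halt         = finished ⟨ r , q ⟩ (suc s) , ⟨ m , d ⟩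

  -- The index is the number of instructions executed by the transition.
  -- Any running thread may be scheduled next.  Resuming a parent is not an
  -- instruction; the parent then depends on both of its children.  Span is thus
  -- the longest path in the series-parallel dag of the fork-join computation.
  infix 4 _⊢_—[_]→_
  data _⊢_—[_]→_ (P : Program) : Threads × Store → ℕ → Threads × Store → Set where
    step  : ∀ {pc ρ s μ} →
            P ⊢ (running pc ρ s , μ) —[ 1 ]→ execute (fetch P pc) pc ρ s μ
    left  : ∀ {pc ρ t₁ t₁′ t₂ μ μ′ k} →
            P ⊢ (t₁ , μ) —[ k ]→ (t₁′ , μ′) →
            P ⊢ (suspended pc ρ t₁ t₂ , μ) —[ k ]→ (suspended pc ρ t₁′ t₂ , μ′)
    right : ∀ {pc ρ t₁ t₂ t₂′ μ μ′ k} →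
            P ⊢ (t₂ , μ) —[ k ]→ (t₂′ , μ′) →
            P ⊢ (suspended pc ρ t₁ t₂ , μ) —[ k ]→ (suspended pc ρ t₁ t₂′ , μ′)
    join  : ∀ {pc ρ ρ₁ ρ₂ s₁ s₂ μ} →
            P ⊢ (suspended pc ρ (finished ρ₁ s₁) (finished ρ₂ s₂) , μ)
              —[ 0 ]→ (running pc ρ (s₁ ⊔ s₂) , μ)

  -- AllRuns P Q c w: after w instructions have led to c, every way of
  -- scheduling the threads terminates, and the final registers of the root
  -- thread, shared memory, total work and span satisfy Q.
  data AllRuns (P : Program) (Q : Store → Store → ℕ → ℕ → Set) :
               Threads × Store → ℕ → Set where
    ended : ∀ {ρ μ w s} → Q ρ μ w s → AllRuns P Q (finished ρ s , μ) w
    steps : ∀ {c w} →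
            (∃ λ k → ∃ λ c′ → P ⊢ c —[ k ]→ c′) →
            (∀ {k c′} → P ⊢ c —[ k ]→ c′ → AllRuns P Q c′ (w + k)) →
            AllRuns P Q c w

  -- Input: n in word register 0 and the frequencies in the first n cells of
  -- the frequency memory; everything else is zero.
  initial : ∀ {n} → (Fin n → Freq) → Threads × Store
  initial {n} f = running 0 ⟨ (λ _ → 0) [ 0 ≔ n ] , (λ _ → 0ᶠ) ⟩ 0
                , ⟨ (λ _ → 0) , input ⟩
    where
    input : Address → Freq
    input i with i <? n
    ... | yes i<n = f (fromℕ< i<n)
    ... | no  _   = 0ᶠ

-- m ⊨ p ↦ T: the pointer p represents T in word memory m.  A pointer below n
-- is an input object; any other is the address of two consecutive cells
-- containing the pointers to the two children.
infix 4 _⊨_↦_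
data _⊨_↦_ {n : ℕ} (m : Address → ℕ) : ℕ → Tree n → Set where
  leaf : ∀ i → m ⊨ toℕ i ↦ leaf i
  node : ∀ {p l r} → n ≤ p → m ⊨ m p ↦ l → m ⊨ m (suc p) ↦ r → m ⊨ p ↦ node l r

-- P constructs a Huffman tree for the frequencies f, leaving a pointer to
-- its root in word register 0, with the given bounds (in terms of the
-- height of the tree it has constructed) on work and span.
ConstructsHuffmanTree :
  (𝓕 : FrequencyDomain) (P : Program) {n : ℕ} (f : Fin n → FrequencyDomain.Freq 𝓕)
  (workBound : ℕ) (spanBound : ℕ → ℕ) → Set
ConstructsHuffmanTree 𝓕 P {n} f workBound spanBound = AllRuns P Correct (initial f) 0
  where
  open Machine 𝓕
  open Huffman 𝓕 f
  Correct : Store → Store → ℕ → ℕ → Set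
  Correct ρ μ work span =
    Σ[ T ∈ Tree n ] IsHuffmanTree T
                  × words μ ⊨ words ρ 0 ↦ T
                  × work ≤ workBound
                  × span ≤ spanBound (height T)

{-# OPTIONS --safe #-}
-- The algorithm sorts the leaves by a parallel merge sort and then works in
-- rounds.  Between rounds the objects form two sorted lists: the remaining
-- leaves xs and a queue ys of internal nodes, none of which exceeds the sum x
-- of the two smallest objects.  Sequentially, every merge up to the moment when
-- an object greater than x is needed combines two consecutive elements of the
-- list F of all objects that are at most x, since each new node is at least x.
-- So a round merges ys with the leaves that are at most x and pairs up F in
-- parallel; an odd last element is left over.  The new node of frequency x is
-- then preceded by at most that leftover, so it is one of the two smallest
-- objects and becomes a child of the corresponding node of the next round:
-- there are at most H rounds.
--
-- Two lists are merged with linear work and logarithmic span by cutting the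
-- output into blocks of length log n; a binary search along the merge path
-- finds where a block starts, and the block is then produced sequentially.
--
-- Programs are verified in a logic of weakest preconditions with budgets for
-- work and span.  All forks are free of races, and the soundness theorem
-- turns a proof about threads with disjoint footprints into one about all
-- schedules.
module Submission where

open import Defs
open import Data.Bool.Base using (true; false; if_then_else_)
open import Data.Empty using (⊥)
open import Data.Fin.Base using (Fin; toℕ)
import Data.Fin.Base as Fin
open import Data.Fin.Properties using (toℕ<n; fromℕ<-toℕ)
open import Data.List.Base using (List; []; _∷_; _++_; length; take; drop; map; allFin; tabulate; replicate)
import Data.List.Base as List
open import Data.Maybe.Base using (Maybe; just; nothing; _>>=_)
open import Data.Nat.Base
open import Data.Nat.ListAction using (sum)
open import Data.Nat.ListAction.Properties using (sum-↭)
open import Data.Nat.Logarithm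
  using (⌈log₂_⌉; ⌈log₂⌉-mono-≤; ⌈log₂⌈n/2⌉⌉≡⌈log₂n⌉∸1; ⌈log₂2^n⌉≡n)
open import Data.Nat.Properties
open import Data.Nat.Tactic.RingSolver using (solve; solve-∀)
open import Data.Product.Base using (Σ-syntax; ∃; _×_; _,_; proj₁; proj₂)
open import Data.Sum.Base using (_⊎_; inj₁; inj₂; [_,_]′; swap)
open import Data.Unit.Base using (⊤; tt)
open import Function.Base using (_∘_; case_of_)
open import Level using (0ℓ)
open import Relation.Binary.PropositionalEquality hiding ([_])
open import Relation.Nullary using (¬_; yes; no; does; contradiction)

-- The span bound refers to the height of a tree that is known only at the end. The verification
-- therefore grants span for n rounds in advance, and the postcondition says how much is left: r
-- rounds leave the shares of n - r rounds, and r is at most the final height. Work is charged to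
-- merges instead: a round that makes k nodes costs O(k + log n) work, and k is positive. The merge
-- sort has span O(log n) per level, O(log² n) in total. This fits into O(H log n) because a tree
-- with n leaves has height at least ⌈log₂ n⌉. A merge of few elements must not cost log n work, or
-- the charge per element in the sort would be lost. A block is therefore charged for a binary
-- search only if it holds at least half of log n elements; an output too short to be cut starts at
-- the origin of the merge path, where there is nothing to search. All constants are counts of
-- instructions; with n and log n at least 1 they add up to 718.

infixl 6 _⊕_
_⊕_ : ∀ {a b c d} → a ≤ b → c ≤ d → a + c ≤ b + d
_⊕_ = +-mono-≤

infixl 7 _⊛_
_⊛_ : ∀ k {a b} → a ≤ b → k * a ≤ k * b
_⊛_ = *-monoʳ-≤

-- The inequality a ≤ b entails x ≤ y because y − x exceeds b − a by c.
lin : ∀ {a b x y} c → a ≤ b → y + a ≡ x + b + c → x ≤ y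
lin {a} {b} {x} {y} c a≤b eq = +-cancelʳ-≤ b x y (begin
  x + b      ≤⟨ m≤m+n (x + b) c ⟩
  x + b + c  ≡⟨ eq ⟨
  y + a      ≤⟨ +-monoʳ-≤ y a≤b ⟩
  y + b      ∎)
  where open ≤-Reasoning

-- Halving intervals and accounting for costs

half-lower : ∀ n → ⌊ n /2⌋ + ⌊ n /2⌋ ≤ n
half-lower zero          = z≤n
half-lower (suc zero)    = z≤n
half-lower (suc (suc n)) =
  s≤s (≤-trans (≤-reflexive (+-suc ⌊ n /2⌋ ⌊ n /2⌋)) (s≤s (half-lower n)))

half-upper : ∀ n → n ≤ suc (⌊ n /2⌋ + ⌊ n /2⌋)
half-upper zero          = z≤n
half-upper (suc zero)    = s≤s z≤n
half-upper (suc (suc n)) =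
  s≤s (s≤s (≤-trans (half-upper n) (≤-reflexive (sym (+-suc ⌊ n /2⌋ ⌊ n /2⌋)))))

-- The spare `suc` absorbs the rounding of a halving, in either direction.
double-cancel-≤ : ∀ {m n} → m + m ≤ suc (n + n) → m ≤ n
double-cancel-≤ {m} {n} p with m ≤? n
... | yes m≤n = m≤n
... | no m≰n  = contradiction
  (lin 0 (p ⊕ ≰⇒> m≰n ⊕ ≰⇒> m≰n) (solve (m ∷ n ∷ []))) (n≮n 0)

module _ {lo hi m : ℕ} (lower : m + m ≤ lo + hi) (upper : lo + hi ≤ suc (m + m)) where

  middle-≥ : lo ≤ hi → lo ≤ m
  middle-≥ lo≤hi = double-cancel-≤ (lin 0 (lo≤hi ⊕ upper) (solve (lo ∷ hi ∷ m ∷ [])))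

  middle-< : lo < hi → m < hi
  middle-< lo<hi = double-cancel-≤ (lin 0 (lo<hi ⊕ lower) (solve (lo ∷ hi ∷ m ∷ [])))

  -- `p + (p + 0)` is what `2 * p`, and hence `2 ^ suc h`, unfolds to. Together with `middle-upper`
  -- this says that a binary search halves the width of its interval whichever half it keeps.
  middle-lower : ∀ {p} → hi < lo + (p + (p + 0)) → m < lo + p
  middle-lower {p} hi< = double-cancel-≤ (lin 0 (hi< ⊕ lower) (solve (lo ∷ hi ∷ m ∷ p ∷ [])))

  middle-upper : ∀ {p} → hi < lo + (p + (p + 0)) → hi < suc m + p
  middle-upper {p} hi< = double-cancel-≤ (lin 1 (hi< ⊕ upper) (solve (lo ∷ hi ∷ m ∷ p ∷ [])))

-- The program computes a midpoint as half of the sum of the end points `s` and `s + m`.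
half-+ : ∀ s m → ⌊ s + (s + m) /2⌋ ≡ s + ⌊ m /2⌋
half-+ zero    m = refl
half-+ (suc s) m rewrite +-suc s (s + m) = cong suc (half-+ s m)

-- An interval of length `suc l` at `s`, cut where the machine cuts it. Lengths have the form `suc`
-- so that no piece is empty. `big₁` and `big₂` keep both pieces at half of the block length `b` or
-- more; `small₁` and `small₂` bound the depth of the recursion.
record Halves (s l b : ℕ) : Set where
  field
    {l₁ l₂} : ℕ
    middle  : ⌊ s + (s + suc l) /2⌋ ≡ s + suc l₁
    split   : l ≡ suc (l₁ + l₂)
    big₁    : b ≤ suc l₁ + suc l₁
    big₂    : b ≤ suc l₂ + suc l₂
    small₁  : ∀ h → suc l ≤ 2 ^ suc h → suc l₁ ≤ 2 ^ h
    small₂  : ∀ h → suc l ≤ 2 ^ suc h → suc l₂ ≤ 2 ^ h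

halves : ∀ s l {b} → 1 ≤ b → b < suc l → Halves s l b
halves s zero    1≤b (s≤s b≤0) = contradiction (≤-trans 1≤b b≤0) (n≮n 0)
halves s (suc l) {b} 1≤b (s≤s b≤l) = record
  { l₁ = x ; l₂ = y
  ; middle = half-+ s (2 + l)
  ; split  = cong suc (sym (⌊n/2⌋+⌈n/2⌉≡n l))
  ; big₁   = big₁ b≤l (half-upper l)
  ; big₂   = ≤-trans (big₁ b≤l (half-upper l)) (s≤s x≤y ⊕ s≤s x≤y)
  ; small₁ = λ h p → double-cancel-≤ (small₁ (2 ^ h) p)
  ; small₂ = λ h p → double-cancel-≤ (small₂ (2 ^ h) p)
  }
  where
  x y : ℕ
  x = ⌊ l /2⌋
  y = ⌈ l /2⌉
  x≤y : x ≤ y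
  x≤y = ⌊n/2⌋≤⌈n/2⌉ l
  big₁ : ∀ {b l x} → b ≤ suc l → l ≤ suc (x + x) → b ≤ suc x + suc x
  big₁ {b} {l} {x} p q = lin 0 (p ⊕ q) (solve (b ∷ l ∷ x ∷ []))
  small : ∀ {l x y p} → l ≡ x + y → x ≤ y → 2 + l ≤ p + (p + 0) → suc x + suc x ≤ suc (p + p)
  small {l} {x} {y} {p} refl q r = lin 1 (q ⊕ r) (solve (x ∷ y ∷ p ∷ []))
  small₁ : ∀ p → 2 + l ≤ p + (p + 0) → suc x + suc x ≤ suc (p + p)
  small₁ p = small {p = p} (sym (⌊n/2⌋+⌈n/2⌉≡n l)) x≤y
  small′ : ∀ {l x y p} → l ≡ x + y → y ≤ suc x → 2 + l ≤ p + (p + 0) → suc y + suc y ≤ suc (p + p)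
  small′ {l} {x} {y} {p} refl q r = lin 0 (q ⊕ r) (solve (x ∷ y ∷ p ∷ []))
  small₂ : ∀ p → 2 + l ≤ p + (p + 0) → suc y + suc y ≤ suc (p + p)
  small₂ p = small′ {p = p} (sym (⌊n/2⌋+⌈n/2⌉≡n l)) (⌈⌉≤1+⌊⌋ l)
    where
    ⌈⌉≤1+⌊⌋ : ∀ l → ⌈ l /2⌉ ≤ suc ⌊ l /2⌋
    ⌈⌉≤1+⌊⌋ zero          = z≤n
    ⌈⌉≤1+⌊⌋ (suc zero)    = s≤s z≤n
    ⌈⌉≤1+⌊⌋ (suc (suc l)) = s≤s (⌈⌉≤1+⌊⌋ l)

-- The budget of an interval of `suc l` elements is `suc l * (2 + k) + l * 10`: every element brings
-- `k` and the two instructions that recognise a leaf of the recursion, and each of at most `l`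
-- forks costs 10. Here the two instructions have already been spent.
tree-leaf-work : ∀ l k → suc l * k ≤ k + l * (2 + k) + l * 10
tree-leaf-work l k = lin (l * 12) (z≤n {0}) (solve (l ∷ k ∷ []))

tree-node-work : ∀ l₁ l₂ k →
  5 + ((suc l₁ * (2 + k) + l₁ * 10) + (2 + (suc l₂ * (2 + k) + l₂ * 10)) + 1) ≤
  k + suc (l₁ + l₂) * (2 + k) + suc (l₁ + l₂) * 10
tree-node-work l₁ l₂ k = lin 0 (z≤n {0}) (solve (l₁ ∷ l₂ ∷ k ∷ []))

tree-node-span : ∀ s h → 5 + (2 + s + h * 8 + 1) ≤ s + suc h * 8
tree-node-span s h = lin 0 (z≤n {0}) (solve (s ∷ h ∷ []))

merge-leaf-first : ∀ l → 22 + suc l * 14 ≤ suc l * 72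
merge-leaf-first l = lin (36 + l * 58) (z≤n {0}) (solve (l ∷ []))

-- A block that is at least half full pays for its own search: `L` is at most twice its length, and
-- 22 + 12 + 24 + 14 = 72.
merge-leaf-other : ∀ l {L} → L ≤ suc l + suc l → 22 + (suc L * 12 + suc l * 14) ≤ suc l * 72
merge-leaf-other l {L} p = lin (l * 34) (12 ⊛ p) (solve (l ∷ L ∷ []))

merge-leaf-span : ∀ l {L} → suc l ≤ L → 22 + (suc L * 12 + suc l * 14) ≤ L * 60
merge-leaf-span l {L} p = lin (l * 34) (48 ⊛ p) (solve (l ∷ L ∷ []))

merge-work : ∀ l → suc l * (2 + 72) + l * 10 ≤ suc l * 84
merge-work l = lin 10 (z≤n {0}) (solve (l ∷ []))

merge-span : ∀ {L} → 1 ≤ L → 2 + L * 60 + L * 8 ≤ L * 70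
merge-span {L} p = lin 0 (2 ⊛ p) (solve (L ∷ []))

pair-work : ∀ l → suc l * (2 + 17) + l * 10 ≤ suc l * 29
pair-work l = lin 10 (z≤n {0}) (solve (l ∷ []))

pair-span : ∀ {L} → 1 ≤ L → 2 + 17 + L * 8 ≤ L * 27
pair-span {L} p = lin 0 (19 ⊛ p) (solve (L ∷ []))

-- Bounds the width of a search interval with lower end `m`; the additional factor of 2 makes the
-- inequality strict.
n<2^[1+L]+m : ∀ {n m} L → n ≤ 2 ^ L → n < m + 2 ^ suc L
n<2^[1+L]+m {n} {m} L n≤ = ≤-trans (s≤s n≤)
  (≤-trans (^-monoʳ-< 2 (s≤s (s≤s z≤n)) (n<1+n L)) (m≤n+m (2 ^ suc L) m))

sort-base-work : ∀ h → 5 ≤ suc h * (1 * 106)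
sort-base-work h = lin (101 + h * 106) (z≤n {0}) (solve (h ∷ []))

sort-base-span : ∀ h {L} → 1 ≤ L → 5 ≤ suc h * (L * 90)
sort-base-span h {L} p = ≤-trans (≤-trans (m≤n+m 5 85) (90 ⊛ p))
  (≤-trans (≤-reflexive (*-comm 90 L)) (m≤m+n (L * 90) (h * (L * 90))))

sort-node-work : ∀ h l₁ l₂ →
  8 + (2 + suc h * (suc l₁ * 106) + (2 + suc h * (suc l₂ * 106)) +
    (9 + (suc (suc (l₁ + l₂)) * 84 + 1))) ≤ suc (suc h) * (suc (suc (l₁ + l₂)) * 106)
sort-node-work h l₁ l₂ = lin (22 + (l₁ + l₂) * 22) (z≤n {0}) (solve (h ∷ l₁ ∷ l₂ ∷ []))

sort-node-span : ∀ h {L} → 1 ≤ L → 8 + (2 + suc h * (L * 90) + (9 + (L * 70 + 1))) ≤ suc (suc h) * (L * 90)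
sort-node-span h {L} p = lin 0 (20 ⊛ p) (solve (h ∷ L ∷ []))

-- The cost of a round is split where the number suc k of new nodes becomes known.
round-work₁ : ∀ m {L} → 1 ≤ L →
  8 + (2 + (2 * 84 + (13 + (2 + (3 + suc L * 12 + (L * 260 + (5 + m * (L * 480)))))))) ≤ 5 + suc m * (L * 480)
round-work₁ m {L} p = lin 0 (208 ⊛ p) (solve (m ∷ L ∷ []))

-- The first new node pays with `L * 260`, the remainder of its share after the first phase. Each of
-- the other `k` brings a full `L * 480`, more than the 2 * 84 + 29 that it adds to the merge and
-- the pairing.
round-work₂ : ∀ k m {L} → 1 ≤ L →
  4 + (2 + (suc (k + suc k) * 84 + (2 + (2 + (9 + suc L * 12 + (10 + (2 + (suc k * 29 + (6 + (5 + m * (L * 480))))))))))) ≤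
  L * 260 + (5 + (m + k) * (L * 480))
round-work₂ k m {L} p =
  lin (k * 283 + L * 2) ((246 ⊛ p) ⊕ (k ⊛ big p)) (solve (k ∷ m ∷ L ∷ []))
  where
  big : ∀ {L} → 1 ≤ L → 480 ≤ L * 480
  big {L} p = ≤-trans (480 ⊛ p) (≤-reflexive (*-comm 480 L))

round-span₁ : ∀ m {L} → 1 ≤ L →
  8 + (2 + (L * 70 + (13 + (2 + (3 + suc L * 12 + (L * 158 + (5 + m * (L * 280)))))))) ≤ 5 + suc m * (L * 280)
round-span₁ m {L} p = lin 0 (40 ⊛ p) (solve (m ∷ L ∷ []))

round-span₂ : ∀ m {L} → 1 ≤ L →
  4 + (2 + (L * 70 + (2 + (2 + (9 + suc L * 12 + (10 + (2 + (L * 27 + (6 + (5 + m * (L * 280))))))))))) ≤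
  L * 158 + (5 + m * (L * 280))
round-span₂ m {L} p = lin 0 (49 ⊛ p) (solve (m ∷ L ∷ []))

-- As `n` and `L` are at least 1, it is enough to add the coefficients: 21 + 5 + 2 * 106 + 480 =
-- 718.
total-work : ∀ {n L} → 1 ≤ n → 1 ≤ L →
  3 + (1 + L * 5 + (6 + (2 + (suc L * (n * 106) + (4 + (5 + n * (L * 480))))))) ≤ 718 * (n * L)
total-work {suc n} {suc L} _ _ =
  lin (n * 26 + L * 127 + n * L * 132) (z≤n {0}) (solve (n ∷ L ∷ []))

-- `sₑ` is the unspent part of the budget. The shares of rounds that never took place cancel against
-- it, and `L ≤ H` absorbs the quadratic term of the sort.
total-span : ∀ {n L H s sₑ} → 1 ≤ L → L ≤ H →
  s + sₑ ≤ 3 + (1 + L * 5 + (6 + (2 + (suc L * (L * 90) + (4 + (5 + n * (L * 280))))))) →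
  n * (L * 280) ≤ sₑ + H * (L * 280) → s ≤ 718 * (H * L)
total-span {n} {suc L} {H} {s} {sₑ} _ L≤H p q =
  lin (H * suc L * 232 + L * 137 + L * L * 116) (p ⊕ q ⊕ (206 * suc L) ⊛ L≤H)
    (solve (n ∷ L ∷ H ∷ s ∷ sₑ ∷ []))

-- Binary logarithms

log₂≡0 : ∀ {x} → x ≤ 1 → ⌈log₂ x ⌉ ≡ 0
log₂≡0 {zero}        _         = refl
log₂≡0 {suc zero}    _         = refl
log₂≡0 {suc (suc _)} (s≤s ())

log₂≥1 : ∀ {x} → 2 ≤ x → 1 ≤ ⌈log₂ x ⌉
log₂≥1 2≤x = ⌈log₂⌉-mono-≤ 2≤x

-- One iteration of the loop at `LOG`, which replaces `x` by `⌈ x /2⌉`.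
log₂-half : ∀ {x j} → ⌈log₂ x ⌉ ≡ suc j → ⌈log₂ ⌈ x /2⌉ ⌉ ≡ j
log₂-half {x} eq = trans (⌈log₂⌈n/2⌉⌉≡⌈log₂n⌉∸1 x) (cong (_∸ 1) eq)

n≤2^log₂n : ∀ j {x} → ⌈log₂ x ⌉ ≡ j → x ≤ 2 ^ j
n≤2^log₂n zero {x} eq with x ≤? 1
... | yes x≤1 = x≤1
... | no x≰1  = contradiction (subst (1 ≤_) eq (log₂≥1 (≰⇒> x≰1))) (n≮n 0)
n≤2^log₂n (suc j) {x} eq = ≤-trans (≤-reflexive (sym (⌊n/2⌋+⌈n/2⌉≡n x)))
  (≤-trans (+-monoˡ-≤ ⌈ x /2⌉ (⌊n/2⌋≤⌈n/2⌉ x))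
    (half≤ ⊕ ≤-trans half≤ (≤-reflexive (sym (+-identityʳ (2 ^ j))))))
  where
  half≤ : ⌈ x /2⌉ ≤ 2 ^ j
  half≤ = n≤2^log₂n j (log₂-half {x} eq)

-- A logic for programs of the binary-forking machine

infixl 9 _‼_
_‼_ : {V : Set} → List V → ℕ → Maybe V
[]       ‼ _     = nothing
(v ∷ _)  ‼ zero  = just v
(_ ∷ vs) ‼ suc i = vs ‼ i

-- A write beyond the recorded registers leaves the list as it is. This is sound because the list
-- makes no claim about those registers.
update : {V : Set} → ℕ → V → List V → List V
update _       _ []       = []
update zero    v (_ ∷ vs) = v ∷ vs
update (suc i) v (u ∷ vs) = u ∷ update i v vs

-- The list records the contents of an initial segment of the registers.
infix 4 _∼_
data _∼_ {V : Set} (g : ℕ → V) : List V → Set where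
  []  : g ∼ []
  _∷_ : ∀ {v vs} → g 0 ≡ v → g ∘ suc ∼ vs → g ∼ v ∷ vs

∼-lookup : ∀ {V : Set} {g : ℕ → V} {vs i v} → g ∼ vs → vs ‼ i ≡ just v → g i ≡ v
∼-lookup {i = zero}  (eq ∷ _) refl = eq
∼-lookup {i = suc i} (_ ∷ g∼) eq   = ∼-lookup g∼ eq

∼-update : ∀ {V : Set} {g : ℕ → V} {vs} i v → g ∼ vs → g [ i ≔ v ] ∼ update i v vs
∼-update i       v []        = []
∼-update zero    v (_ ∷ g∼)  = refl ∷ g∼
∼-update (suc i) v (eq ∷ g∼) = eq ∷ ∼-update i v g∼

∼-take : ∀ {V : Set} {g : ℕ → V} {vs} k → g ∼ vs → g ∼ take k vs
∼-take zero    _         = []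
∼-take (suc k) []        = []
∼-take (suc k) (eq ∷ g∼) = eq ∷ ∼-take k g∼

≔-same : ∀ {V : Set} (g : ℕ → V) i {v} → (g [ i ≔ v ]) i ≡ v
≔-same g i with i ≡ᵇ i | ≡⇒≡ᵇ i i refl
... | true | _ = refl

≔-other : ∀ {V : Set} (g : ℕ → V) {i j v} → j ≢ i → (g [ i ≔ v ]) j ≡ g j
≔-other g {i} {j} j≢i with j ≡ᵇ i | ≡ᵇ⇒≡ j i
... | true  | eq = contradiction (eq tt) j≢i
... | false | _  = refl

-- Memory cells and regions

data Cell : Set where
  wordAt freqAt : Address → Cell

wordAt-injective : ∀ {x y} → wordAt x ≡ wordAt y → x ≡ y
wordAt-injective refl = refl

Region : Set₁
Region = Cell → Set

infix 4 _⊆_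
_⊆_ : Region → Region → Set
A ⊆ B = ∀ {c} → A c → B c

infixr 6 _∪_
_∪_ : Region → Region → Region
(A ∪ B) c = A c ⊎ B c

∅ everything : Region
∅ _ = ⊥
everything _ = ⊤

infixl 7 _∖_
_∖_ : Region → Region → Region
(A ∖ B) c = A c × ¬ B c

∁ : Region → Region
∁ A c = ¬ A c

Disjoint : Region → Region → Set
Disjoint A B = ∀ {c} → A c → ¬ B c

module ProgramLogic (𝓕 : FrequencyDomain) (P : Program) where
  open FrequencyDomain 𝓕
  open Machine 𝓕

  infix 4 _≋[_]_
  record _≋[_]_ (μ : Store) (A : Region) (μ′ : Store) : Set where
    constructor agree
    field
      onWords : ∀ {a} → A (wordAt a) → words μ a ≡ words μ′ a
      onFreqs : ∀ {a} → A (freqAt a) → freqs μ a ≡ freqs μ′ a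
  open _≋[_]_ public

  ≋-refl : ∀ {μ A} → μ ≋[ A ] μ
  ≋-refl = agree (λ _ → refl) (λ _ → refl)

  ≋-trans : ∀ {μ μ′ μ″ A} → μ ≋[ A ] μ′ → μ′ ≋[ A ] μ″ → μ ≋[ A ] μ″
  ≋-trans (agree ws fs) (agree ws′ fs′) =
    agree (λ a → trans (ws a) (ws′ a)) (λ a → trans (fs a) (fs′ a))

  ≋-⊆ : ∀ {μ μ′ A B} → B ⊆ A → μ ≋[ A ] μ′ → μ ≋[ B ] μ′
  ≋-⊆ B⊆A (agree ws fs) = agree (ws ∘ B⊆A) (fs ∘ B⊆A)

  store-word : ∀ {A} μ i v → ¬ A (wordAt i) → ⟨ words μ [ i ≔ v ] , freqs μ ⟩ ≋[ A ] μ
  store-word μ i v i∉A =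
    agree (λ a∈A → ≔-other (words μ) (λ { refl → i∉A a∈A })) (λ _ → refl)

  store-freq : ∀ {A} μ i v → ¬ A (freqAt i) → ⟨ words μ , freqs μ [ i ≔ v ] ⟩ ≋[ A ] μ
  store-freq μ i v i∉A =
    agree (λ _ → refl) (λ a∈A → ≔-other (freqs μ) (λ { refl → i∉A a∈A }))

  store-word-cong : ∀ {A μ μ′} i v → μ ≋[ A ] μ′ →
    ⟨ words μ [ i ≔ v ] , freqs μ ⟩ ≋[ A ] ⟨ words μ′ [ i ≔ v ] , freqs μ′ ⟩
  store-word-cong {A} {μ} {μ′} i v (agree ws fs) = agree ws′ fs
    where
    ws′ : ∀ {a} → A (wordAt a) → (words μ [ i ≔ v ]) a ≡ (words μ′ [ i ≔ v ]) a
    ws′ {a} a∈A with a ≡ᵇ i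
    ... | true  = refl
    ... | false = ws a∈A

  store-freq-cong : ∀ {A μ μ′} i v → μ ≋[ A ] μ′ →
    ⟨ words μ , freqs μ [ i ≔ v ] ⟩ ≋[ A ] ⟨ words μ′ , freqs μ′ [ i ≔ v ] ⟩
  store-freq-cong {A} {μ} {μ′} i v (agree ws fs) = agree ws fs′
    where
    fs′ : ∀ {a} → A (freqAt a) → (freqs μ [ i ≔ v ]) a ≡ (freqs μ′ [ i ≔ v ]) a
    fs′ {a} a∈A with a ≡ᵇ i
    ... | true  = refl
    ... | false = fs a∈A

  -- Termination of all schedules of a thread that may write only to W, while
  -- its environment may at any moment change every cell outside A.
  data Safe (A W : Region) (K : Store → Store → ℕ → ℕ → Set) :
            Threads → Store → ℕ → Set where
    ended : ∀ {ρ s μ w} → (∀ {μ′} → μ′ ≋[ A ] μ → K ρ μ′ w s) →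
            Safe A W K (finished ρ s) μ w
    steps : ∀ {t μ w} →
            (∀ μ′ → ∃ λ k → ∃ λ c → P ⊢ (t , μ′) —[ k ]→ c) →
            (∀ {μ′} → μ′ ≋[ A ] μ → ∀ {k t″ μ″} → P ⊢ (t , μ′) —[ k ]→ (t″ , μ″) →
             μ″ ≋[ ∁ W ] μ′) →
            (∀ {μ′} → μ′ ≋[ A ] μ → ∀ {k t″ μ″} → P ⊢ (t , μ′) —[ k ]→ (t″ , μ″) →
             Safe A W K t″ μ″ (w + k)) →
            Safe A W K t μ w

  safe⇒allRuns : ∀ {W Q t μ w} → Safe everything W Q t μ w → AllRuns P Q (t , μ) w
  safe⇒allRuns (ended q)        = ended (q ≋-refl)
  safe⇒allRuns (steps pr _ pre) = steps (pr _) (λ st → safe⇒allRuns (pre ≋-refl st))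

  module _ {A W A₁ W₁ A₂ W₂ : Region} {K K₁ K₂ : Store → Store → ℕ → ℕ → Set}
           (A₁⊆A : A₁ ⊆ A) (A₂⊆A : A₂ ⊆ A) (W₁⊆W : W₁ ⊆ W) (W₂⊆W : W₂ ⊆ W)
           (A₁#W₂ : Disjoint A₁ W₂) (A₂#W₁ : Disjoint A₂ W₁)
           {pc : Label} {ρ : Store} {w : ℕ} {μ₀ : Store}
           (continue : ∀ {ρ₁ ρ₂ μ w₁ w₂ s₁ s₂} → K₁ ρ₁ μ w₁ s₁ → K₂ ρ₂ μ w₂ s₂ →
                       μ ≋[ A ∖ W₁ ∖ W₂ ] μ₀ →
                       Safe A W K (running pc ρ (s₁ ⊔ s₂)) μ (w + (w₁ + w₂)))
    where

    private
      frame : Region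
      frame = A ∖ W₁ ∖ W₂

      frame⊆A : frame ⊆ A
      frame⊆A = proj₁ ∘ proj₁

      progress : ∀ {t₁ t₂ μ₁ μ₂ w₁ w₂} →
                 Safe A₁ W₁ K₁ t₁ μ₁ w₁ → Safe A₂ W₂ K₂ t₂ μ₂ w₂ →
                 ∀ μ → ∃ λ k → ∃ λ c → P ⊢ (suspended pc ρ t₁ t₂ , μ) —[ k ]→ c
      progress (steps pr₁ _ _) _              μ = let k , _ , st = pr₁ μ in k , _ , left st
      progress (ended _)       (steps pr₂ _ _) μ = let k , _ , st = pr₂ μ in k , _ , right st
      progress (ended _)       (ended _)       μ = 0 , _ , join

      unchanged : ∀ {t₁ t₂ μ₁ μ₂ w₁ w₂ μ k t μ′} →
                  Safe A₁ W₁ K₁ t₁ μ₁ w₁ → Safe A₂ W₂ K₂ t₂ μ₂ w₂ →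
                  μ ≋[ A₁ ] μ₁ → μ ≋[ A₂ ] μ₂ →
                  P ⊢ (suspended pc ρ t₁ t₂ , μ) —[ k ]→ (t , μ′) → μ′ ≋[ ∁ W ] μ
      unchanged (steps _ fr₁ _) _ μ~₁ _ (left st)  = ≋-⊆ (_∘ W₁⊆W) (fr₁ μ~₁ st)
      unchanged (ended _) _ _ _ (left ())
      unchanged _ (steps _ fr₂ _) _ μ~₂ (right st) = ≋-⊆ (_∘ W₂⊆W) (fr₂ μ~₂ st)
      unchanged _ (ended _) _ _ (right ())
      unchanged _ _ _ _ join                       = ≋-refl

    -- Each child is safe relative to its own view of the memory, `μ₁` or `μ₂`, and the actual
    -- memory agrees with the views on `A₁` and `A₂`. A step of one child renews its view and,
    -- writing outside the region of the other child, leaves the other view valid. All interleavings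
    -- are thus covered by one induction on the two derivations.
    parallel : ∀ {t₁ t₂ μ₁ μ₂ w₁ w₂ μ u} →
               Safe A₁ W₁ K₁ t₁ μ₁ w₁ → Safe A₂ W₂ K₂ t₂ μ₂ w₂ →
               μ ≋[ A₁ ] μ₁ → μ ≋[ A₂ ] μ₂ → μ ≋[ frame ] μ₀ → u ≡ w + (w₁ + w₂) →
               Safe A W K (suspended pc ρ t₁ t₂) μ u

    parallel-step : ∀ {t₁ t₂ μ₁ μ₂ w₁ w₂ μ u k t μ′} →
               Safe A₁ W₁ K₁ t₁ μ₁ w₁ → Safe A₂ W₂ K₂ t₂ μ₂ w₂ →
               μ ≋[ A₁ ] μ₁ → μ ≋[ A₂ ] μ₂ → μ ≋[ frame ] μ₀ → u ≡ w + (w₁ + w₂) →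
               P ⊢ (suspended pc ρ t₁ t₂ , μ) —[ k ]→ (t , μ′) → Safe A W K t μ′ (u + k)

    parallel S₁ S₂ μ~₁ μ~₂ μ~₀ eq =
      steps (progress S₁ S₂)
        (λ μ′~μ → unchanged S₁ S₂ (≋-trans (≋-⊆ A₁⊆A μ′~μ) μ~₁) (≋-trans (≋-⊆ A₂⊆A μ′~μ) μ~₂))
        (λ μ′~μ → parallel-step S₁ S₂ (≋-trans (≋-⊆ A₁⊆A μ′~μ) μ~₁)
                    (≋-trans (≋-⊆ A₂⊆A μ′~μ) μ~₂) (≋-trans (≋-⊆ frame⊆A μ′~μ) μ~₀) eq)

    parallel-step {w₁ = w₁} {w₂} {k = k} (steps _ fr₁ pre₁) S₂ μ~₁ μ~₂ μ~₀ refl (left st) =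
      parallel (pre₁ μ~₁ st) S₂ ≋-refl
        (≋-trans (≋-⊆ A₂#W₁ (fr₁ μ~₁ st)) μ~₂)
        (≋-trans (≋-⊆ (proj₂ ∘ proj₁) (fr₁ μ~₁ st)) μ~₀)
        (solve (w ∷ w₁ ∷ w₂ ∷ k ∷ []))
    parallel-step (ended _) _ _ _ _ _ (left ())
    parallel-step {w₁ = w₁} {w₂} {k = k} S₁ (steps _ fr₂ pre₂) μ~₁ μ~₂ μ~₀ refl (right st) =
      parallel S₁ (pre₂ μ~₂ st)
        (≋-trans (≋-⊆ A₁#W₂ (fr₂ μ~₂ st)) μ~₁) ≋-refl
        (≋-trans (≋-⊆ proj₂ (fr₂ μ~₂ st)) μ~₀)
        (solve (w ∷ w₁ ∷ w₂ ∷ k ∷ []))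
    parallel-step _ (ended _) _ _ _ _ (right ())
    parallel-step {u = u} (ended q₁) (ended q₂) μ~₁ μ~₂ μ~₀ eq join =
      subst (Safe A W K _ _) (sym (trans (+-identityʳ u) eq)) (continue (q₁ μ~₁) (q₂ μ~₂) μ~₀)
    -- A finished thread has no transition, so at a join neither derivation can be `steps`.
    parallel-step {μ = μ} (steps pr₁ _ _) _ _ _ _ _ join = case pr₁ μ of λ ()
    parallel-step {μ = μ} (ended _) (steps pr₂ _ _) _ _ _ _ join = case pr₂ μ of λ ()

  -- Instructions that affect registers only, as a function that computes on symbolic register
  -- contents: `ops k refl` makes the type checker execute `k` of them. Reading an unrecorded
  -- register fails.
  alu : Instr → List ℕ → List Freq → Maybe (List ℕ × List Freq)
  alu (const x k)  vs qs = just (update x k vs , qs)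
  alu (move x y)   vs qs = vs ‼ y >>= λ a → just (update x a vs , qs)
  alu (add x y z)  vs qs = vs ‼ y >>= λ a → vs ‼ z >>= λ b → just (update x (a + b) vs , qs)
  alu (sub x y z)  vs qs = vs ‼ y >>= λ a → vs ‼ z >>= λ b → just (update x (a ∸ b) vs , qs)
  alu (half x y)   vs qs = vs ‼ y >>= λ a → just (update x ⌊ a /2⌋ vs , qs)
  alu (fadd x y z) vs qs = qs ‼ y >>= λ a → qs ‼ z >>= λ b → just (vs , update x (a +ᶠ b) qs)
  alu _            _  _  = nothing

  run : ℕ → Label → List ℕ → List Freq → Maybe (List ℕ × List Freq)
  run zero    pc vs qs = just (vs , qs)
  run (suc k) pc vs qs = alu (fetch P pc) vs qs >>= λ { (vs′ , qs′) → run k (suc pc) vs′ qs′ }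

  -- WP A W Q pc vs qs μ w s: a thread at pc, with registers as recorded by vs
  -- and qs and with the memory equal to μ on A, writes only to W, and ends in
  -- a state satisfying Q whatever the environment does outside A.  It spends
  -- at most w work and s span; Q is told how much of this budget is left.
  -- At a fork, the continuation knows only what the children's postconditions
  -- say and that no cell outside their write sets W₁ and W₂ has changed.
  data WP (A W : Region) (Q : List ℕ → Store → ℕ → ℕ → Set) :
          Label → List ℕ → List Freq → Store → ℕ → ℕ → Set₁ where
    relax : ∀ {pc vs qs μ w w′ s s′} → w ≤ w′ → s ≤ s′ →
            WP A W Q pc vs qs μ w s → WP A W Q pc vs qs μ w′ s′
    op    : ∀ {pc vs qs vs′ qs′ μ w s} → alu (fetch P pc) vs qs ≡ just (vs′ , qs′) →
            WP A W Q (suc pc) vs′ qs′ μ w s → WP A W Q pc vs qs μ (suc w) (suc s)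
    load  : ∀ {pc vs qs μ w s x a i v} → fetch P pc ≡ load x a → vs ‼ a ≡ just i →
            A (wordAt i) → words μ i ≡ v →
            WP A W Q (suc pc) (update x v vs) qs μ w s → WP A W Q pc vs qs μ (suc w) (suc s)
    fload : ∀ {pc vs qs μ w s x a i v} → fetch P pc ≡ fload x a → vs ‼ a ≡ just i →
            A (freqAt i) → freqs μ i ≡ v →
            WP A W Q (suc pc) vs (update x v qs) μ w s → WP A W Q pc vs qs μ (suc w) (suc s)
    store : ∀ {pc vs qs μ w s a x i v} → fetch P pc ≡ store a x → vs ‼ a ≡ just i →
            vs ‼ x ≡ just v → W (wordAt i) →
            WP A W Q (suc pc) vs qs ⟨ words μ [ i ≔ v ] , freqs μ ⟩ w s →
            WP A W Q pc vs qs μ (suc w) (suc s)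
    fstore : ∀ {pc vs qs μ w s a x i v} → fetch P pc ≡ fstore a x → vs ‼ a ≡ just i →
            qs ‼ x ≡ just v → W (freqAt i) →
            WP A W Q (suc pc) vs qs ⟨ words μ , freqs μ [ i ≔ v ] ⟩ w s →
            WP A W Q pc vs qs μ (suc w) (suc s)
    jump  : ∀ {pc vs qs μ w s l} → fetch P pc ≡ jump l →
            WP A W Q l vs qs μ w s → WP A W Q pc vs qs μ (suc w) (suc s)
    jle   : ∀ {pc vs qs μ w s x y l i j} → fetch P pc ≡ jle x y l →
            vs ‼ x ≡ just i → vs ‼ y ≡ just j →
            (i ≤ j → WP A W Q l vs qs μ w s) → (i ≰ j → WP A W Q (suc pc) vs qs μ w s) →
            WP A W Q pc vs qs μ (suc w) (suc s)
    fjle  : ∀ {pc vs qs μ w s x y l i j} → fetch P pc ≡ fjle x y l →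
            qs ‼ x ≡ just i → qs ‼ y ≡ just j →
            (i ≤ᶠ j → WP A W Q l vs qs μ w s) → (¬ i ≤ᶠ j → WP A W Q (suc pc) vs qs μ w s) →
            WP A W Q pc vs qs μ (suc w) (suc s)
    fork  : ∀ {pc vs qs μ w w₁ w₂ s s₁ l₁ l₂} → fetch P pc ≡ fork l₁ l₂ →
            (k : ℕ) (A₁ W₁ A₂ W₂ : Region) (Q₁ Q₂ : Store → Set) →
            A₁ ⊆ A → A₂ ⊆ A → W₁ ⊆ W → W₂ ⊆ W → Disjoint A₁ W₂ → Disjoint A₂ W₁ →
            WP A₁ W₁ (λ _ μ′ _ _ → Q₁ μ′) l₁ (take k vs) qs μ w₁ s₁ →
            WP A₂ W₂ (λ _ μ′ _ _ → Q₂ μ′) l₂ (take k vs) qs μ w₂ s₁ →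
            (∀ μ′ → Q₁ μ′ → Q₂ μ′ → μ′ ≋[ A ∖ W₁ ∖ W₂ ] μ →
             WP A W Q (suc pc) vs qs μ′ w s) →
            WP A W Q pc vs qs μ (suc (w₁ + w₂ + w)) (suc (s₁ + s))
    halt  : ∀ {pc vs qs μ w s} → fetch P pc ≡ halt →
            (∀ {μ′} → μ′ ≋[ A ] μ → Q vs μ′ w s) → WP A W Q pc vs qs μ (suc w) (suc s)

  ops : ∀ {A W Q} k {pc vs qs vs′ qs′ μ w s} → run k pc vs qs ≡ just (vs′ , qs′) →
        WP A W Q (k + pc) vs′ qs′ μ w s → WP A W Q pc vs qs μ (k + w) (k + s)
  ops zero    refl wp = wp
  ops {A} {W} {Q} (suc k) {pc} {vs} {qs} {vs′} {qs′} {μ} {w} {s} eq wp with alu (fetch P pc) vs qs in eq₁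
  ... | just (vs₁ , qs₁) =
    op eq₁ (ops k eq (subst (λ l → WP A W Q l vs′ qs′ μ w s) (sym (+-suc k pc)) wp))

  -- Soundness of the weakest preconditions

  alu-sound : ∀ i {vs qs vs′ qs′ pc ρ s μ} → alu i vs qs ≡ just (vs′ , qs′) →
    words ρ ∼ vs → freqs ρ ∼ qs →
    Σ[ ρ′ ∈ Store ] execute i pc ρ s μ ≡ (running (suc pc) ρ′ (suc s) , μ)
                  × words ρ′ ∼ vs′ × freqs ρ′ ∼ qs′
  alu-sound (const x k) refl r q = _ , refl , ∼-update x k r , q
  alu-sound (move x y) {vs} eq r q with vs ‼ y in p | eq
  ... | just _ | refl rewrite ∼-lookup r p = _ , refl , ∼-update x _ r , q
  alu-sound (add x y z) {vs} eq r q with vs ‼ y in p | vs ‼ z in p′ | eq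
  ... | just _ | just _ | refl rewrite ∼-lookup r p | ∼-lookup r p′ =
    _ , refl , ∼-update x _ r , q
  alu-sound (sub x y z) {vs} eq r q with vs ‼ y in p | vs ‼ z in p′ | eq
  ... | just _ | just _ | refl rewrite ∼-lookup r p | ∼-lookup r p′ =
    _ , refl , ∼-update x _ r , q
  alu-sound (half x y) {vs} eq r q with vs ‼ y in p | eq
  ... | just _ | refl rewrite ∼-lookup r p = _ , refl , ∼-update x _ r , q
  alu-sound (fadd x y z) {qs = qs} eq r q with qs ‼ y in p | qs ‼ z in p′ | eq
  ... | just _ | just _ | refl rewrite ∼-lookup q p | ∼-lookup q p′ =
    _ , refl , r , ∼-update x _ q

  private
    Executes : Region → Region → (Store → Store → ℕ → ℕ → Set) → Instr →
               Label → Store → ℕ → ℕ → Store → Set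
    Executes A W K i pc ρ s w μ =
      proj₂ (execute i pc ρ s μ) ≋[ ∁ W ] μ ×
      Safe A W K (proj₁ (execute i pc ρ s μ)) (proj₂ (execute i pc ρ s μ)) (w + 1)

    running-safe : ∀ {A W K pc ρ s μ w} →
      (∀ {μ′} → μ′ ≋[ A ] μ → Executes A W K (fetch P pc) pc ρ s w μ′) →
      Safe A W K (running pc ρ s) μ w
    running-safe h =
      steps (λ _ → 1 , _ , step) (λ { μ~ step → proj₁ (h μ~) }) (λ { μ~ step → proj₂ (h μ~) })

    branch : ∀ {i j l l′} (X : Label → Set) → (i ≤ j → X l) → (i ≰ j → X l′) →
             X (if i ≤ᵇ j then l else l′)
    branch {i} {j} X yes′ no′ with i ≤ᵇ j | ≤ᵇ⇒≤ i j | ≤⇒≤ᵇ {i} {j}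
    ... | true  | i≤j | _   = yes′ (i≤j tt)
    ... | false | _   | i≰j = no′ i≰j

    fbranch : ∀ {i j l l′} (X : Label → Set) → (i ≤ᶠ j → X l) → (¬ i ≤ᶠ j → X l′) →
              X (if does (i ≤ᶠ? j) then l else l′)
    fbranch {i} {j} X yes′ no′ with i ≤ᶠ? j
    ... | yes i≤j = yes′ i≤j
    ... | no i≰j  = no′ i≰j

    tick : ∀ {a} w {b} → a ≤ w + 1 + b → a ≤ w + suc b
    tick {a} w {b} = subst (a ≤_) (+-assoc w 1 b)

    tick′ : ∀ {a} s {b} → a ≤ suc s + b → a ≤ s + suc b
    tick′ {a} s {b} = subst (a ≤_) (sym (+-suc s b))

    fork-work : ∀ {a} w {u₁ u₂ w₁ w₂} w₃ → u₁ ≤ w₁ → u₂ ≤ w₂ →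
                a ≤ w + 1 + (u₁ + u₂) + w₃ → a ≤ w + suc (w₁ + w₂ + w₃)
    fork-work {a} w {u₁} {u₂} {w₁} {w₂} w₃ p₁ p₂ p =
      lin 0 (p ⊕ p₁ ⊕ p₂) (solve (a ∷ w ∷ u₁ ∷ u₂ ∷ w₁ ∷ w₂ ∷ w₃ ∷ []))

    fork-span : ∀ {a} s s₁ s₃ → a ≤ suc s + s₁ + s₃ → a ≤ s + suc (s₁ + s₃)
    fork-span {a} s s₁ s₃ p = lin 0 p (solve (a ∷ s ∷ s₁ ∷ s₃ ∷ []))

  -- Turns the leftovers `wₑ` and `sₑ` reported by `Q` into bounds on the actual costs `w′` and
  -- `s′`: what was spent and what is left together do not exceed the budget.
  Closes : (List ℕ → Store → ℕ → ℕ → Set) → (Store → Store → ℕ → ℕ → Set) → ℕ → ℕ → Set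
  Closes Q K w s = ∀ {ρ vs μ wₑ sₑ w′ s′} → words ρ ∼ vs → Q vs μ wₑ sₑ →
                   w′ + wₑ ≤ w → s′ + sₑ ≤ s → K ρ μ w′ s′

  sound : ∀ {A W Q K pc vs qs μ μ₀ w w₀ s s₀ ρ} → WP A W Q pc vs qs μ₀ w₀ s₀ →
          words ρ ∼ vs → freqs ρ ∼ qs → μ ≋[ A ] μ₀ → Closes Q K (w + w₀) (s + s₀) →
          Safe A W K (running pc ρ s) μ w
  sound {w = w} {s = s} (relax w≤ s≤ wp) r q μ~ k =
    sound wp r q μ~ (λ r′ x p p′ → k r′ x (≤-trans p (+-monoʳ-≤ w w≤)) (≤-trans p′ (+-monoʳ-≤ s s≤)))
  sound {A} {W} {K = K} {pc = pc} {μ = μ} {μ₀} {w = w} {s = s} {ρ = ρ}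
        (op eq wp) r q μ~ k = running-safe safe
    where
    safe : ∀ {μ′} → μ′ ≋[ A ] μ → Executes A W K (fetch P pc) pc ρ s w μ′
    safe {μ′} μ′~ with alu-sound (fetch P pc) {pc = pc} {s = s} {μ = μ′} eq r q
    ... | ρ′ , eq′ , r′ , q′ rewrite eq′ =
      ≋-refl , sound wp r′ q′ (≋-trans μ′~ μ~) (λ r″ x p p′ → k r″ x (tick w p) (tick′ s p′))
  sound {A} {W} {K = K} {pc = pc} {μ = μ} {μ₀} {w = w} {s = s} {ρ = ρ}
        (load {x = x} {v = v} eq a i∈A refl wp) r q μ~ k = running-safe λ μ′~ → lemma (≋-trans μ′~ μ~)
    where
    lemma : ∀ {μ′} → μ′ ≋[ A ] μ₀ → Executes A W K (fetch P pc) pc ρ s w μ′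
    lemma μ″~ rewrite eq | ∼-lookup r a =
      ≋-refl , sound wp (subst (λ v → _ ∼ update x v _) (onWords μ″~ i∈A) (∼-update x _ r)) q μ″~
                 (λ r″ y p p′ → k r″ y (tick w p) (tick′ s p′))
  sound {A} {W} {K = K} {pc = pc} {μ = μ} {μ₀} {w = w} {s = s} {ρ = ρ}
        (fload {x = x} {v = v} eq a i∈A refl wp) r q μ~ k = running-safe λ μ′~ → lemma (≋-trans μ′~ μ~)
    where
    lemma : ∀ {μ′} → μ′ ≋[ A ] μ₀ → Executes A W K (fetch P pc) pc ρ s w μ′
    lemma μ″~ rewrite eq | ∼-lookup r a =
      ≋-refl , sound wp r (subst (λ v → _ ∼ update x v _) (onFreqs μ″~ i∈A) (∼-update x _ q)) μ″~
                 (λ r″ y p p′ → k r″ y (tick w p) (tick′ s p′))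
  sound {A} {W} {K = K} {pc = pc} {μ = μ} {μ₀} {w = w} {s = s} {ρ = ρ}
        (store {i = i} {v = v} eq a x i∈W wp) r q μ~ k = running-safe λ μ′~ → lemma (≋-trans μ′~ μ~)
    where
    lemma : ∀ {μ′} → μ′ ≋[ A ] μ₀ → Executes A W K (fetch P pc) pc ρ s w μ′
    lemma {μ′} μ″~ rewrite eq | ∼-lookup r a | ∼-lookup r x =
      store-word μ′ i v (λ i∉W → i∉W i∈W) ,
      sound wp r q (store-word-cong i v μ″~) (λ r″ y p p′ → k r″ y (tick w p) (tick′ s p′))
  sound {A} {W} {K = K} {pc = pc} {μ = μ} {μ₀} {w = w} {s = s} {ρ = ρ}
        (fstore {i = i} {v = v} eq a x i∈W wp) r q μ~ k = running-safe λ μ′~ → lemma (≋-trans μ′~ μ~)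
    where
    lemma : ∀ {μ′} → μ′ ≋[ A ] μ₀ → Executes A W K (fetch P pc) pc ρ s w μ′
    lemma {μ′} μ″~ rewrite eq | ∼-lookup r a | ∼-lookup q x =
      store-freq μ′ i v (λ i∉W → i∉W i∈W) ,
      sound wp r q (store-freq-cong i v μ″~) (λ r″ y p p′ → k r″ y (tick w p) (tick′ s p′))
  sound {A} {W} {K = K} {pc = pc} {μ = μ} {μ₀} {w = w} {s = s} {ρ = ρ}
        (jump eq wp) r q μ~ k = running-safe λ μ′~ → lemma (≋-trans μ′~ μ~)
    where
    lemma : ∀ {μ′} → μ′ ≋[ A ] μ₀ → Executes A W K (fetch P pc) pc ρ s w μ′
    lemma μ″~ rewrite eq = ≋-refl , sound wp r q μ″~ (λ r″ y p p′ → k r″ y (tick w p) (tick′ s p′))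
  sound {A} {W} {K = K} {pc = pc} {μ = μ} {μ₀} {w = w} {s = s} {ρ = ρ}
        (jle eq x y wp₁ wp₂) r q μ~ k = running-safe λ μ′~ → lemma (≋-trans μ′~ μ~)
    where
    lemma : ∀ {μ′} → μ′ ≋[ A ] μ₀ → Executes A W K (fetch P pc) pc ρ s w μ′
    lemma {μ′} μ″~ rewrite eq | ∼-lookup r x | ∼-lookup r y =
      ≋-refl , branch (λ l → Safe A W K (running l ρ (suc s)) μ′ (w + 1))
        (λ le → sound (wp₁ le) r q μ″~ (λ r″ y p p′ → k r″ y (tick w p) (tick′ s p′)))
        (λ le → sound (wp₂ le) r q μ″~ (λ r″ y p p′ → k r″ y (tick w p) (tick′ s p′)))
  sound {A} {W} {K = K} {pc = pc} {μ = μ} {μ₀} {w = w} {s = s} {ρ = ρ}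
        (fjle eq x y wp₁ wp₂) r q μ~ k = running-safe λ μ′~ → lemma (≋-trans μ′~ μ~)
    where
    lemma : ∀ {μ′} → μ′ ≋[ A ] μ₀ → Executes A W K (fetch P pc) pc ρ s w μ′
    lemma {μ′} μ″~ rewrite eq | ∼-lookup q x | ∼-lookup q y =
      ≋-refl , fbranch (λ l → Safe A W K (running l ρ (suc s)) μ′ (w + 1))
        (λ le → sound (wp₁ le) r q μ″~ (λ r″ y p p′ → k r″ y (tick w p) (tick′ s p′)))
        (λ le → sound (wp₂ le) r q μ″~ (λ r″ y p p′ → k r″ y (tick w p) (tick′ s p′)))
  sound {A} {W} {K = K} {pc = pc} {μ = μ} {μ₀} {w = w} {s = s} {ρ = ρ}
        (halt eq post) r q μ~ k = running-safe λ μ′~ → lemma (≋-trans μ′~ μ~)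
    where
    lemma : ∀ {μ′} → μ′ ≋[ A ] μ₀ → Executes A W K (fetch P pc) pc ρ s w μ′
    lemma μ″~ rewrite eq =
      ≋-refl , ended (λ μ‴~ → k r (post (≋-trans μ‴~ μ″~))
                 (≤-reflexive (+-assoc w 1 _)) (≤-reflexive (sym (+-suc s _))))
  sound {A} {W} {K = K} {pc = pc} {μ = μ} {μ₀} {w = w} {s = s} {ρ = ρ} 
        (fork {w = w₃} {w₁} {w₂} {s₃} {s₁} eq n A₁ W₁ A₂ W₂ Q₁ Q₂ A₁⊆ A₂⊆ W₁⊆ W₂⊆ A₁#W₂ A₂#W₁ wp₁ wp₂ wp₃)
        r q μ~ k = running-safe λ μ′~ → lemma (≋-trans μ′~ μ~)
    where
    K₁ K₂ : Store → Store → ℕ → ℕ → Set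
    K₁ _ μ′ w′ s′ = Q₁ μ′ × w′ ≤ w₁ × s′ ≤ suc s + s₁
    K₂ _ μ′ w′ s′ = Q₂ μ′ × w′ ≤ w₂ × s′ ≤ suc s + s₁

    lemma : ∀ {μ′} → μ′ ≋[ A ] μ₀ → Executes A W K (fetch P pc) pc ρ s w μ′
    lemma {μ′} μ″~ rewrite eq =
      ≋-refl ,
      parallel {K₁ = K₁} {K₂ = K₂} A₁⊆ A₂⊆ W₁⊆ W₂⊆ A₁#W₂ A₂#W₁ {w = w + 1}
        (λ { (q₁ , u₁≤ , t₁≤) (q₂ , u₂≤ , t₂≤) same →
             sound (wp₃ _ q₁ q₂ same) r q ≋-refl
               (λ r′ x p p′ → k r′ x
                 (fork-work w w₃ u₁≤ u₂≤ p)
                 (fork-span s s₁ s₃ (≤-trans p′ (+-monoˡ-≤ s₃ (⊔-lub t₁≤ t₂≤))))) })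
        -- The work of a child is counted from zero and added at the join, whereas its span
        -- continues from that of the parent.
        (sound {w = 0} wp₁ (∼-take n r) q (≋-⊆ A₁⊆ μ″~)
          (λ _ x p p′ → x , ≤-trans (m≤m+n _ _) p , ≤-trans (m≤m+n _ _) p′))
        (sound {w = 0} wp₂ (∼-take n r) q (≋-⊆ A₂⊆ μ″~)
          (λ _ x p p′ → x , ≤-trans (m≤m+n _ _) p , ≤-trans (m≤m+n _ _) p′))
        ≋-refl ≋-refl
        (≋-⊆ (proj₁ ∘ proj₁) μ″~) (sym (+-identityʳ (w + 1)))

  -- A subroutine is called by forking it next to a thread that halts at once:
  -- the registers of the caller survive, and results are returned in memory.
  call : ∀ {A W Q pc vs qs μ w w₁ s s₁ l l₂} → fetch P pc ≡ fork l l₂ → fetch P l₂ ≡ halt →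
         (k : ℕ) (A₁ W₁ : Region) (Q₁ : Store → Set) → A₁ ⊆ A → W₁ ⊆ W →
         WP A₁ W₁ (λ _ μ′ _ _ → Q₁ μ′) l (take k vs) qs μ w₁ s₁ →
         (∀ μ′ → Q₁ μ′ → μ′ ≋[ A ∖ W₁ ] μ → WP A W Q (suc pc) vs qs μ′ w s) →
         WP A W Q pc vs qs μ (2 + (w₁ + w)) (2 + (s₁ + s))
  call {w = w} {w₁} {s₁ = s₁} eq eq′ k A₁ W₁ Q₁ A₁⊆A W₁⊆W wp₁ wp =
    relax (≤-reflexive (cong (λ u → suc (u + w)) (+-comm w₁ 1))) ≤-refl
      (fork eq k A₁ W₁ ∅ ∅ Q₁ (λ _ → ⊤) A₁⊆A (λ ()) W₁⊆W (λ ()) (λ _ ()) (λ ())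
        (relax ≤-refl (n≤1+n s₁) wp₁)
        (relax (≤-refl {1}) (s≤s z≤n) (halt eq′ (λ _ → tt)))
        (λ μ′ q _ same → wp μ′ q (≋-⊆ (λ (a , b) → (a , b) , λ ()) same)))

  weaken-post : ∀ {A W Q Q′ pc vs qs μ w s} → (∀ {vs μ w s} → Q vs μ w s → Q′ vs μ w s) →
                WP A W Q pc vs qs μ w s → WP A W Q′ pc vs qs μ w s
  weaken-post h (relax w≤ s≤ wp)       = relax w≤ s≤ (weaken-post h wp)
  weaken-post h (op eq wp)             = op eq (weaken-post h wp)
  weaken-post h (load p q r v wp)      = load p q r v (weaken-post h wp)
  weaken-post h (fload p q r v wp)     = fload p q r v (weaken-post h wp)
  weaken-post h (store p q r v wp)     = store p q r v (weaken-post h wp)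
  weaken-post h (fstore p q r v wp)    = fstore p q r v (weaken-post h wp)
  weaken-post h (jump p wp)            = jump p (weaken-post h wp)
  weaken-post h (jle p q r wp wp′)     = jle p q r (weaken-post h ∘ wp) (weaken-post h ∘ wp′)
  weaken-post h (fjle p q r wp wp′)    = fjle p q r (weaken-post h ∘ wp) (weaken-post h ∘ wp′)
  weaken-post h (fork p k A₁ W₁ A₂ W₂ Q₁ Q₂ a b c d e f wp₁ wp₂ wp) =
    fork p k A₁ W₁ A₂ W₂ Q₁ Q₂ a b c d e f wp₁ wp₂ (λ μ′ q₁ q₂ same → weaken-post h (wp μ′ q₁ q₂ same))
  weaken-post h (halt p q)             = halt p (h ∘ q)

-- The program

%n %one %a %q %lo %hi %o %t %u %la %b %lb %z %s %e %blk %mode %dst %src : Register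
%n    = 0
%one  = 1
%a    = 2
%q    = 3
%lo   = 4
%hi   = 5
%o    = 6
%t    = 7
%u    = 8
%la   = 9
%b    = 10
%lb   = 11
%z    = 12
%s    = 13
%e    = 14
%blk  = 15
%mode = 16
%dst  = 17
%src  = 18

-- `%xa` and `%xe` share their numbers with `%dst` and `%src`: after the sort these hold n and 2n,
-- which are the two ends of the list of leaves.
%xa %xe %ya %ye %v %len : Register
%xa  = 17
%xe  = 18
%ya  = 19
%ye  = 20
%v   = 21
%len = 22

LOG READY ROUND SCAN FINISH LASTLEAF STOP SORT SORTL SORTR BASE TREE TREEL TREER LEAF EMIT : Label
LOG      = 3
READY    = 8
ROUND    = 19
SCAN     = 41
FINISH   = 67
LASTLEAF = 70
STOP     = 71
SORT     = 72
SORTL    = 89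
SORTR    = 91
BASE     = 93
TREE     = 96
TREEL    = 102
TREER    = 104
LEAF     = 106
EMIT     = 116

TAKEB TAKEA WRITE PATH CLIPPED SEARCH RIGHT FOUND PAIR : Label
TAKEB   = 124
TAKEA   = 127
WRITE   = 129
PATH    = 132
CLIPPED = 136
SEARCH  = 138
RIGHT   = 150
FOUND   = 152
PAIR    = 154

-- Memory layout in units of n: the sorted leaves start at n, the queue of
-- internal nodes at 2n, the output of merges at 3n, and the nodes at 4n.
-- Word 0 is scratch.  SEARCH compares entry p of the array at %a with the word
-- at address %q ∸ p; with %q = 0 this is word 0 for every p, so that the same
-- code also finds the leaves that do not exceed the threshold of a round.
mainCode : List Instr
mainCode =
    const %one 1
  ∷ move %t %n
  ∷ const %len 0
  -- LOG
  ∷ jle %t %one READY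
  ∷ add %t %one %t
  ∷ half %t %t
  ∷ add %len %one %len
  ∷ jump LOG
  -- READY
  ∷ move %blk %len
  ∷ move %dst %n
  ∷ add %src %n %n
  ∷ const %s 0
  ∷ move %e %n
  ∷ const %mode 0
  ∷ fork SORT STOP
  ∷ move %ya %src
  ∷ move %ye %src
  ∷ add %z %src %n
  ∷ add %v %z %n
  -- ROUND
  ∷ add %t %one %ye
  ∷ jle %z %t FINISH
  ∷ move %a %xa
  ∷ sub %la %xe %xa
  ∷ move %b %ya
  ∷ sub %lb %ye %ya
  ∷ const %s 0
  ∷ const %e 2
  ∷ fork TREE STOP
  ∷ load %t %z
  ∷ fload 0 %t
  ∷ add %t %one %z
  ∷ load %t %t
  ∷ fload 1 %t
  ∷ fadd 0 0 1
  ∷ fstore %v 0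
  ∷ const %o 0
  ∷ store %o %v
  ∷ const %q 0
  ∷ const %lo 0
  ∷ move %hi %la
  ∷ move %o %z
  -- SCAN
  ∷ fork SEARCH STOP
  ∷ load %la %z
  ∷ add %e %la %lb
  ∷ half %u %e
  ∷ add %e %u %u
  ∷ fork TREE STOP
  ∷ move %s %e
  ∷ const %o 0
  ∷ fork PATH STOP
  ∷ load %t %o
  ∷ add %xa %xa %t
  ∷ sub %t %e %t
  ∷ add %ya %ya %t
  ∷ move %a %v
  ∷ move %b %ye
  ∷ const %s 0
  ∷ move %e %u
  ∷ const %mode 1
  ∷ const %blk 1
  ∷ fork TREE STOP
  ∷ const %mode 0
  ∷ move %blk %len
  ∷ add %ye %ye %u
  ∷ add %v %v %u
  ∷ add %v %v %u
  ∷ jump ROUND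
  -- FINISH
  ∷ jle %ye %ya LASTLEAF
  ∷ load %n %ya
  ∷ halt
  -- LASTLEAF
  ∷ load %n %xa
  -- STOP
  ∷ halt
  ∷ []

-- Two buffers alternate: `%dst` and `%src` are exchanged before the fork, so the halves are sorted
-- into the one buffer and then merged into the other, and nothing is copied back.
sortCode : List Instr
sortCode =
  -- SORT
    add %t %one %s
  ∷ jle %e %t BASE
  ∷ add %t %s %e
  ∷ half %t %t
  ∷ move %u %dst
  ∷ move %dst %src
  ∷ move %src %u
  ∷ fork SORTL SORTR
  ∷ add %a %dst %s
  ∷ sub %la %t %s
  ∷ add %b %dst %t
  ∷ sub %lb %e %t
  ∷ add %z %src %s
  ∷ sub %e %e %s
  ∷ const %s 0
  ∷ fork TREE STOP
  ∷ halt
  -- SORTL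
  ∷ move %e %t
  ∷ jump SORT
  -- SORTR
  ∷ move %s %t
  ∷ jump SORT
  -- BASE
  ∷ add %t %dst %s
  ∷ store %t %s
  ∷ halt
  ∷ []

-- One fork tree serves both merging and pairing; `%mode` selects what happens at its leaves.
treeCode : List Instr
treeCode =
  -- TREE
    add %t %s %blk
  ∷ jle %e %t LEAF
  ∷ add %t %s %e
  ∷ half %t %t
  ∷ fork TREEL TREER
  ∷ halt
  -- TREEL
  ∷ move %e %t
  ∷ jump TREE
  -- TREER
  ∷ move %s %t
  ∷ jump TREE
  -- LEAF
  ∷ jle %one %mode PAIR
  ∷ add %o %z %s
  ∷ fork PATH STOP
  ∷ load %t %o
  ∷ sub %u %s %t
  ∷ add %la %a %la
  ∷ add %lb %b %lb
  ∷ add %a %a %t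
  ∷ add %b %b %u
  ∷ add %z %z %e
  -- EMIT
  ∷ jle %z %o STOP
  ∷ jle %lb %b TAKEA
  ∷ jle %la %a TAKEB
  ∷ load %t %a
  ∷ fload 0 %t
  ∷ load %t %b
  ∷ fload 1 %t
  ∷ fjle 0 1 TAKEA
  -- TAKEB
  ∷ load %t %b
  ∷ add %b %one %b
  ∷ jump WRITE
  -- TAKEA
  ∷ load %t %a
  ∷ add %a %one %a
  -- WRITE
  ∷ store %o %t
  ∷ add %o %one %o
  ∷ jump EMIT
  ∷ []

-- `%lo` and `%hi` clip the diagonal `%s` to the two arrays. `%q` is set so that `%q` ∸ p is the
-- address of the element of the second array that faces entry p of the first.
pathCode : List Instr
pathCode =
  -- PATH
    sub %lo %s %lb
  ∷ move %hi %s
  ∷ jle %s %la CLIPPED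
  ∷ move %hi %la
  -- CLIPPED
  ∷ add %q %b %s
  ∷ sub %q %q %one
  -- SEARCH
  ∷ jle %hi %lo FOUND
  ∷ add %t %lo %hi
  ∷ half %t %t
  ∷ add %u %a %t
  ∷ load %u %u
  ∷ fload 0 %u
  ∷ sub %u %q %t
  ∷ load %u %u
  ∷ fload 1 %u
  ∷ fjle 0 1 RIGHT
  ∷ move %hi %t
  ∷ jump SEARCH
  -- RIGHT
  ∷ add %lo %one %t
  ∷ jump SEARCH
  -- FOUND
  ∷ store %o %lo
  ∷ halt
  ∷ []

pairCode : List Instr
pairCode =
  -- PAIR
    add %t %s %s
  ∷ add %u %a %t
  ∷ add %o %b %s
  ∷ store %o %u
  ∷ add %t %z %t
  ∷ load %o %t
  ∷ store %u %o
  ∷ fload 0 %o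
  ∷ add %t %one %t
  ∷ load %o %t
  ∷ fload 1 %o
  ∷ fadd 0 0 1
  ∷ fstore %u 0
  ∷ add %u %one %u
  ∷ store %u %o
  ∷ halt
  ∷ []

program : Program
program = mainCode ++ sortCode ++ treeCode ++ pathCode ++ pairCode

open import Algebra.Structures using (IsCommutativeMonoid)
open import Data.List.Base using ([_])
open import Data.List.Membership.Propositional using (_∈_)
open import Data.List.Properties
  using (++-assoc; ++-identityʳ; length-++; length-take; length-drop; take++drop≡id; length-tabulate; map-tabulate)
open import Data.List.Relation.Binary.Permutation.Propositional
  using (_↭_; ↭-refl; ↭-sym; ↭-trans; ↭-reflexive; module PermutationReasoning)
open import Data.List.Relation.Binary.Permutation.Propositional.Properties
  using (merge-↭; ↭-length; All-resp-↭; ++⁺; ++⁺ˡ; ++⁺ʳ; ++-comm; shift; map⁺; ↭-singleton-inv)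
open import Data.List.Relation.Unary.All as All using (All; []; _∷_)
import Data.List.Relation.Unary.All.Properties as All
open import Data.List.Relation.Unary.AllPairs as AllPairs using (AllPairs; []; _∷_)
import Data.List.Relation.Unary.AllPairs.Properties as AllPairs
open import Data.List.Relation.Unary.Any using (here; there)
open import Relation.Binary.Construct.Closure.ReflexiveTransitive using (Star; ε; _◅_; _◅◅_)
open import Relation.Binary.Core using (Rel)
open import Relation.Binary.Definitions using (Decidable; Total; Transitive; Reflexive)
open import Relation.Binary.Structures using (IsDecTotalOrder)

-- Merging sorted lists

module _ {A : Set} where

  ‼-< : ∀ (xs : List A) {i} → i < length xs → ∃ λ x → xs ‼ i ≡ just x
  ‼-< (x ∷ xs) {zero}  _         = x , refl
  ‼-< (x ∷ xs) {suc i} (s≤s i<n) = ‼-< xs i<n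

  ‼-bound : ∀ (xs : List A) {i x} → xs ‼ i ≡ just x → i < length xs
  ‼-bound (x ∷ xs) {zero}  _  = s≤s z≤n
  ‼-bound (x ∷ xs) {suc i} eq = s≤s (‼-bound xs eq)

  ‼-drop : ∀ k (xs : List A) i → drop k xs ‼ i ≡ xs ‼ (k + i)
  ‼-drop zero    xs       i = refl
  ‼-drop (suc k) []       i = refl
  ‼-drop (suc k) (x ∷ xs) i = ‼-drop k xs i

  ‼-take : ∀ k (xs : List A) {i x} → take k xs ‼ i ≡ just x → i < k × xs ‼ i ≡ just x
  ‼-take (suc k) (x ∷ xs) {zero}  eq = s≤s z≤n , eq
  ‼-take (suc k) (x ∷ xs) {suc i} eq = let i<k , eq′ = ‼-take k xs eq in s≤s i<k , eq′

  ‼-++ˡ : ∀ (xs : List A) {ys i x} → xs ‼ i ≡ just x → (xs ++ ys) ‼ i ≡ just x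
  ‼-++ˡ (x ∷ xs) {i = zero}  eq = eq
  ‼-++ˡ (x ∷ xs) {i = suc i} eq = ‼-++ˡ xs eq

  ‼⇒∈ : ∀ (xs : List A) {i x} → xs ‼ i ≡ just x → x ∈ xs
  ‼⇒∈ (x ∷ xs) {zero}  refl = here refl
  ‼⇒∈ (x ∷ xs) {suc i} eq   = there (‼⇒∈ xs eq)

  ∈⇒‼ : ∀ {xs : List A} {x} → x ∈ xs → ∃ λ i → xs ‼ i ≡ just x
  ∈⇒‼ (here refl) = 0 , refl
  ∈⇒‼ (there x∈)  = let i , eq = ∈⇒‼ x∈ in suc i , eq

  drop-++ : ∀ (xs : List A) {ys} → drop (length xs) (xs ++ ys) ≡ ys
  drop-++ []       = refl
  drop-++ (x ∷ xs) = drop-++ xs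

  first-two : ∀ R {w p q : A} {T M} → R ++ w ∷ T ≡ p ∷ q ∷ M → length R ≤ 1 →
              p ≡ w ⊎ (R ≡ [ p ] × q ≡ w)
  first-two []          refl _ = inj₁ refl
  first-two (_ ∷ [])    refl _ = inj₂ (refl , refl)
  first-two (_ ∷ _ ∷ _) _    (s≤s ())

  pairs : List A → List (A × A)
  pairs (x ∷ y ∷ xs) = (x , y) ∷ pairs xs
  pairs _            = []

  unpaired : List A → List A
  unpaired (x ∷ y ∷ xs) = unpaired xs
  unpaired xs           = xs

  unpaired-length : ∀ xs → length (unpaired xs) ≤ 1
  unpaired-length []           = z≤n
  unpaired-length (x ∷ [])     = s≤s z≤n
  unpaired-length (x ∷ y ∷ xs) = unpaired-length xs

  pairs-length : ∀ xs → length (pairs xs) ≡ ⌊ length xs /2⌋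
  pairs-length []           = refl
  pairs-length (x ∷ [])     = refl
  pairs-length (x ∷ y ∷ xs) = cong suc (pairs-length xs)

  drop-pairs : ∀ xs → drop (length (pairs xs) + length (pairs xs)) xs ≡ unpaired xs
  drop-pairs []           = refl
  drop-pairs (x ∷ [])     = refl
  drop-pairs (x ∷ y ∷ xs) rewrite +-suc (length (pairs xs)) (length (pairs xs)) = drop-pairs xs

  length-pairs : ∀ xs → length (pairs xs) + length (pairs xs) + length (unpaired xs) ≡ length xs
  length-pairs []           = refl
  length-pairs (x ∷ [])     = refl
  length-pairs (x ∷ y ∷ xs) rewrite +-suc (length (pairs xs)) (length (pairs xs)) =
    cong (suc ∘ suc) (length-pairs xs)

  ‼-pairs : ∀ xs {i x y} → pairs xs ‼ i ≡ just (x , y) →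
            xs ‼ (i + i) ≡ just x × xs ‼ suc (i + i) ≡ just y
  ‼-pairs (x ∷ y ∷ xs) {zero}  refl = refl , refl
  ‼-pairs (x ∷ y ∷ xs) {suc i} eq rewrite +-suc i i = ‼-pairs xs eq

module Merging {A : Set} {_⊑_ : Rel A 0ℓ} (_⊑?_ : Decidable _⊑_)
               (⊑-refl : Reflexive _⊑_) (⊑-trans : Transitive _⊑_) (⊑-total : Total _⊑_) where

  Sorted : List A → Set
  Sorted = AllPairs _⊑_

  infixr 5 _⋎_
  _⋎_ : List A → List A → List A
  _⋎_ = List.merge _⊑?_

  ⋎-↭ : ∀ xs ys → xs ⋎ ys ↭ xs ++ ys
  ⋎-↭ = merge-↭ _⊑?_

  ⋎-[] : ∀ xs → xs ⋎ [] ≡ xs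
  ⋎-[] []       = refl
  ⋎-[] (x ∷ xs) = refl

  ⋎-left : ∀ {x y} xs ys → x ⊑ y → (x ∷ xs) ⋎ (y ∷ ys) ≡ x ∷ (xs ⋎ (y ∷ ys))
  ⋎-left {x} {y} xs ys x⊑y with x ⊑? y
  ... | yes _  = refl
  ... | no x⋢y = contradiction x⊑y x⋢y

  ⋎-right : ∀ {x y} xs ys → ¬ x ⊑ y → (x ∷ xs) ⋎ (y ∷ ys) ≡ y ∷ ((x ∷ xs) ⋎ ys)
  ⋎-right {x} {y} xs ys x⋢y with x ⊑? y
  ... | yes x⊑y = contradiction x⊑y x⋢y
  ... | no _    = refl

  ⋢⇒⊒ : ∀ {x y} → ¬ x ⊑ y → y ⊑ x
  ⋢⇒⊒ {x} {y} x⋢y with ⊑-total x y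
  ... | inj₁ x⊑y = contradiction x⊑y x⋢y
  ... | inj₂ y⊑x = y⊑x

  ⋎-length : ∀ xs ys → length (xs ⋎ ys) ≡ length xs + length ys
  ⋎-length xs ys = trans (↭-length (⋎-↭ xs ys)) (length-++ xs)

  All-⋎ : ∀ {P : A → Set} {xs ys} → All P xs → All P ys → All P (xs ⋎ ys)
  All-⋎ {xs = xs} {ys} ps qs = All-resp-↭ (↭-sym (⋎-↭ xs ys)) (All.++⁺ ps qs)

  ⋎-sorted : ∀ {xs ys} → Sorted xs → Sorted ys → Sorted (xs ⋎ ys)
  ⋎-sorted {[]}     {ys}     _ s = s
  ⋎-sorted {x ∷ xs} {[]}     s _ = s
  ⋎-sorted {x ∷ xs} {y ∷ ys} s@(x⊑ ∷ sx) s′@(y⊑ ∷ sy)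
    with x ⊑? y | ⋎-sorted sx s′ | ⋎-sorted s sy
  ... | yes x⊑y | rec | _   = All-⋎ x⊑ (x⊑y ∷ All.map (⊑-trans x⊑y) y⊑) ∷ rec
  ... | no x⋢y  | _   | rec =
    let y⊑x = ⋢⇒⊒ x⋢y in All-⋎ (y⊑x ∷ All.map (⊑-trans y⊑x) x⊑) y⊑ ∷ rec

  sorted-++⁻ : ∀ xs {ys} → Sorted (xs ++ ys) → Sorted xs × Sorted ys
  sorted-++⁻ []       s        = [] , s
  sorted-++⁻ (x ∷ xs) (x⊑ ∷ s) =
    let sx , sy = sorted-++⁻ xs s in All.++⁻ˡ xs x⊑ ∷ sx , sy

  sorted-‼ : ∀ {xs i j x y} → Sorted xs → i ≤ j → xs ‼ i ≡ just x → xs ‼ j ≡ just y → x ⊑ y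
  sorted-‼ {x ∷ xs} {zero}  {zero}  (x⊑ ∷ s) _         refl refl = ⊑-refl
  sorted-‼ {x ∷ xs} {zero}  {suc j} (x⊑ ∷ s) _         refl eq   = All.lookup x⊑ (‼⇒∈ xs eq)
  sorted-‼ {x ∷ xs} {suc i} {suc j} (x⊑ ∷ s) (s≤s i≤j) eq   eq′  = sorted-‼ s i≤j eq eq′

  -- A merge can be cut wherever everything before the cut is emitted before everything behind it.
  -- Ties go to the left list, which is why the second condition is strict.
  ⋎-++ : ∀ xs₁ xs₂ ys₁ ys₂ → (∀ {x y} → x ∈ xs₁ → y ∈ ys₂ → x ⊑ y) →
         (∀ {x y} → x ∈ xs₂ → y ∈ ys₁ → ¬ x ⊑ y) →
         (xs₁ ++ xs₂) ⋎ (ys₁ ++ ys₂) ≡ (xs₁ ⋎ ys₁) ++ (xs₂ ⋎ ys₂)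
  ⋎-++ []         xs₂ []         ys₂ _ _ = refl
  ⋎-++ (x ∷ xs₁)  xs₂ []         []        h h′ = cong (x ∷_) (sym (cong (xs₁ ++_) (⋎-[] xs₂)))
  ⋎-++ (x ∷ xs₁)  xs₂ []         (y ∷ ys₂) h h′ =
    trans (⋎-left (xs₁ ++ xs₂) ys₂ (h (here refl) (here refl)))
      (cong (x ∷_) (trans (⋎-++ xs₁ xs₂ [] (y ∷ ys₂) (h ∘ there) h′)
        (cong (_++ (xs₂ ⋎ (y ∷ ys₂))) (⋎-[] xs₁))))
  ⋎-++ []        []        (y ∷ ys₁) ys₂ h h′ = refl
  ⋎-++ []        (x ∷ xs₂) (y ∷ ys₁) ys₂ h h′ =
    trans (⋎-right xs₂ (ys₁ ++ ys₂) (h′ (here refl) (here refl)))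
      (cong (y ∷_) (⋎-++ [] (x ∷ xs₂) ys₁ ys₂ (λ ()) (λ p → h′ p ∘ there)))
  ⋎-++ (x ∷ xs₁) xs₂       (y ∷ ys₁) ys₂ h h′
    with x ⊑? y | ⋎-++ xs₁ xs₂ (y ∷ ys₁) ys₂ (h ∘ there) h′
                | ⋎-++ (x ∷ xs₁) xs₂ ys₁ ys₂ h (λ p → h′ p ∘ there)
  ... | yes _ | rec | _   = cong (x ∷_) rec
  ... | no _  | _   | rec = cong (y ∷_) rec

  -- The merge path: i elements of xs and j elements of ys are consumed by the
  -- first i + j steps of the merge.
  data Path (xs ys : List A) (i j : ℕ) : Set where
    path : i ≤ length xs → j ≤ length ys →
           (∀ {x y} → x ∈ take i xs → y ∈ drop j ys → x ⊑ y) →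
           (∀ {x y} → x ∈ drop i xs → y ∈ take j ys → ¬ x ⊑ y) → Path xs ys i j

  -- At a point of the path `⋎-++` applies. Hence a block can be produced from the two suffixes
  -- alone, independently of the blocks before it.
  drop-⋎ : ∀ {xs ys i j} → Path xs ys i j →
           drop (i + j) (xs ⋎ ys) ≡ drop i xs ⋎ drop j ys
  drop-⋎ {xs} {ys} {i} {j} (path i≤ j≤ h h′) = begin
    drop (i + j) (xs ⋎ ys)
      ≡⟨ cong₂ drop (sym len) eq ⟩
    drop (length (take i xs ⋎ take j ys))
      ((take i xs ⋎ take j ys) ++ (drop i xs ⋎ drop j ys))
      ≡⟨ drop-++ (take i xs ⋎ take j ys) ⟩
    drop i xs ⋎ drop j ys ∎
    where
    open ≡-Reasoning
    len : length (take i xs ⋎ take j ys) ≡ i + j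
    len = trans (⋎-length (take i xs) (take j ys))
            (cong₂ _+_ (trans (length-take i xs) (m≤n⇒m⊓n≡m i≤))
                       (trans (length-take j ys) (m≤n⇒m⊓n≡m j≤)))
    eq : xs ⋎ ys ≡ (take i xs ⋎ take j ys) ++ (drop i xs ⋎ drop j ys)
    eq = trans (sym (cong₂ _⋎_ (take++drop≡id i xs) (take++drop≡id j ys)))
           (⋎-++ (take i xs) (drop i xs) (take j ys) (drop j ys) h h′)

  -- A binary search on the diagonal d compares the elements xs ‼ p and
  -- ys ‼ (d ∸ suc p), which face each other across the path.
  diagonal-path : ∀ {xs ys i d} → Sorted xs → Sorted ys → i ≤ d →
    d ∸ length ys ≤ i → i ≤ length xs →
    (∀ {p x y} → d ∸ length ys ≤ p → p < i → xs ‼ p ≡ just x → ys ‼ (d ∸ suc p) ≡ just y → x ⊑ y) →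
    (∀ {p x y} → i ≤ p → p < d → xs ‼ p ≡ just x → ys ‼ (d ∸ suc p) ≡ just y → ¬ x ⊑ y) →
    Path xs ys i (d ∸ i)
  diagonal-path {xs} {ys} {i} {d} sx sy i≤d lo≤i i≤xs below above =
    path i≤xs j≤ys (λ x∈ y∈ → left-of i≤d i≤xs below (∈⇒‼ x∈) (∈⇒‼ y∈))
                   (λ x∈ y∈ → right-of (∈⇒‼ x∈) (∈⇒‼ y∈))
    where
    d≤ : d ≤ i + length ys
    d≤ = ≤-trans (m≤n+m∸n d (length ys))
           (≤-trans (+-monoʳ-≤ (length ys) lo≤i) (≤-reflexive (+-comm (length ys) i)))

    j≤ys : d ∸ i ≤ length ys
    j≤ys = m≤n+o⇒m∸n≤o d i d≤

    left-of : ∀ {i x y} → i ≤ d → i ≤ length xs →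
      (∀ {p x y} → d ∸ length ys ≤ p → p < i → xs ‼ p ≡ just x → ys ‼ (d ∸ suc p) ≡ just y → x ⊑ y) →
      (∃ λ p → take i xs ‼ p ≡ just x) → (∃ λ q → drop (d ∸ i) ys ‼ q ≡ just y) → x ⊑ y
    left-of {suc i} i<d i<xs below (p , eq) (q , eq′)
      with ‼-take (suc i) xs eq | trans (sym (‼-drop (d ∸ suc i) ys q)) eq′
    ... | s≤s p≤i , eq₁ | eq₂
      with ‼-< xs i<xs | ≤-<-trans (m≤m+n (d ∸ suc i) q) (‼-bound ys eq₂)
    ... | _ , eq₃ | j<ys with ‼-< ys j<ys
    ... | _ , eq₄ =
      -- Only the last consumed element `xs ‼ i` is compared with the element `ys ‼ (d ∸ suc i)`
      -- that it faces; sortedness extends the result to all pairs.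
      ⊑-trans (sorted-‼ sx p≤i eq₁ eq₃)
        (⊑-trans (below lo≤ ≤-refl eq₃ eq₄) (sorted-‼ sy (m≤m+n _ q) eq₄ eq₂))
      where
      lo≤ : d ∸ length ys ≤ i
      lo≤ = m≤n+o⇒m∸n≤o d (length ys)
              (subst (d ≤_) (+-comm i (length ys))
                (≤-trans (≤-reflexive (sym (m+[n∸m]≡n i<d)))
                  (≤-trans (≤-reflexive (sym (+-suc i _))) (+-monoʳ-≤ i j<ys))))

    right-of : ∀ {x y} → (∃ λ p → drop i xs ‼ p ≡ just x) →
               (∃ λ q → take (d ∸ i) ys ‼ q ≡ just y) → ¬ x ⊑ y
    right-of (p , eq) (q , eq′) x⊑y
      with ‼-take (d ∸ i) ys eq′ | trans (sym (‼-drop i xs p)) eq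
    ... | q<j , eq₁ | eq₂
      with m∸n≢0⇒n<m (λ d∸i≡0 → n≮0 (subst (q <_) d∸i≡0 q<j))
         | ‼-< xs (≤-<-trans (m≤m+n i p) (‼-bound xs eq₂))
    ... | i<d | _ , eq₃
      with ‼-< ys (<-≤-trans (∸-monoʳ-< (n<1+n i) i<d) j≤ys)
    ... | _ , eq₄ =
      above ≤-refl i<d eq₃ eq₄
        (⊑-trans (sorted-‼ sx (m≤m+n i p) eq₃ eq₂)
          (⊑-trans x⊑y (sorted-‼ sy (≤-pred (subst (q <_) (∸-suc i<d) q<j)) eq₁ eq₄)))
      where
      ∸-suc : ∀ {m n} → n < m → m ∸ n ≡ suc (m ∸ suc n)
      ∸-suc {suc m} {n} (s≤s n≤m) = +-∸-assoc 1 n≤m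

-- Rounds of Huffman's algorithm

NonNegative : (𝓕 : FrequencyDomain) → ∀ {n} → (Fin n → FrequencyDomain.Freq 𝓕) → Set
NonNegative 𝓕 f = ∀ i → 0ᶠ ≤ᶠ f i
  where open FrequencyDomain 𝓕

module HuffmanModel (𝓕 : FrequencyDomain) {n : ℕ} (f : Fin n → FrequencyDomain.Freq 𝓕)
  (f≥0 : NonNegative 𝓕 f) where
  open FrequencyDomain 𝓕
  open Huffman 𝓕 f
  open IsDecTotalOrder isDecTotalOrder public using ()
    renaming (refl to ≤ᶠ-refl; trans to ≤ᶠ-trans; total to ≤ᶠ-total; reflexive to ≤ᶠ-reflexive)
  open IsCommutativeMonoid isCommutativeMonoid using ()
    renaming (comm to +ᶠ-comm; identityˡ to +ᶠ-identityˡ; sym to ≈ᶠ-sym)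

  +ᶠ-monoʳ-≤ : ∀ x {y z} → y ≤ᶠ z → x +ᶠ y ≤ᶠ x +ᶠ z
  +ᶠ-monoʳ-≤ x {y} {z} y≤z =
    ≤ᶠ-trans (≤ᶠ-reflexive (+ᶠ-comm x y))
      (≤ᶠ-trans (+ᶠ-monoˡ-≤ x y≤z) (≤ᶠ-reflexive (+ᶠ-comm z x)))

  +ᶠ-mono-≤ : ∀ {x y z w} → x ≤ᶠ y → z ≤ᶠ w → x +ᶠ z ≤ᶠ y +ᶠ w
  +ᶠ-mono-≤ x≤y z≤w = ≤ᶠ-trans (+ᶠ-monoˡ-≤ _ x≤y) (+ᶠ-monoʳ-≤ _ z≤w)

  ≰ᶠ⇒≥ᶠ : ∀ {x y} → ¬ x ≤ᶠ y → y ≤ᶠ x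
  ≰ᶠ⇒≥ᶠ {x} {y} x≰y with ≤ᶠ-total x y
  ... | inj₁ x≤y = contradiction x≤y x≰y
  ... | inj₂ y≤x = y≤x

  y≤x+y : ∀ {x y} → 0ᶠ ≤ᶠ x → y ≤ᶠ x +ᶠ y
  y≤x+y {x} {y} 0≤x = ≤ᶠ-trans (≤ᶠ-reflexive (≈ᶠ-sym (+ᶠ-identityˡ y))) (+ᶠ-monoˡ-≤ y 0≤x)

  x≤x+y : ∀ {x y} → 0ᶠ ≤ᶠ y → x ≤ᶠ x +ᶠ y
  x≤x+y {x} {y} 0≤y = ≤ᶠ-trans (y≤x+y 0≤y) (≤ᶠ-reflexive (+ᶠ-comm y x))

  freq≥0 : ∀ t → 0ᶠ ≤ᶠ freq t
  freq≥0 (leaf i)   = f≥0 i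
  freq≥0 (node l r) = ≤ᶠ-trans (freq≥0 r) (y≤x+y (freq≥0 l))

  -- An object together with the pointer that represents it.
  Item : Set
  Item = ℕ × Tree n

  tree : Item → Tree n
  tree = proj₂

  key : Item → Freq
  key = freq ∘ tree

  infix 4 _⊑_ _⊑?_
  _⊑_ : Item → Item → Set
  x ⊑ y = key x ≤ᶠ key y

  _⊑?_ : ∀ x y → _
  x ⊑? y = key x ≤ᶠ? key y

  open Merging {_⊑_ = _⊑_} _⊑?_ ≤ᶠ-refl ≤ᶠ-trans (λ x y → ≤ᶠ-total (key x) (key y)) public

  nodes : ℕ → List (Item × Item) → List Item
  nodes v []             = []
  nodes v ((a , b) ∷ ps) = (v , node (tree a) (tree b)) ∷ nodes (2 + v) ps

  nodes-length : ∀ v ps → length (nodes v ps) ≡ length ps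
  nodes-length v []       = refl
  nodes-length v (_ ∷ ps) = cong suc (nodes-length (2 + v) ps)

  weight : Item × Item → Freq
  weight (a , b) = key a +ᶠ key b

  All-nodes : ∀ (P : Freq → Set) v {ps} → All (λ p → P (weight p)) ps →
              All (λ x → P (key x)) (nodes v ps)
  All-nodes P v []       = []
  All-nodes P v (p ∷ ps) = p ∷ All-nodes P (2 + v) ps

  All-pairs : ∀ {P : Item → Set} {xs} → All P xs → All (λ (a , b) → P a × P b) (pairs xs)
  All-pairs []           = []
  All-pairs (_ ∷ [])     = []
  All-pairs (p ∷ q ∷ ps) = (p , q) ∷ All-pairs ps

  All-unpaired : ∀ {P : Item → Set} {xs} → All P xs → All P (unpaired xs)
  All-unpaired []           = []
  All-unpaired (p ∷ [])     = p ∷ []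
  All-unpaired (_ ∷ _ ∷ ps) = All-unpaired ps

  -- Both components of a later pair dominate the corresponding components of the first pair.
  pairs-≥ : ∀ {a b xs} → Sorted (a ∷ b ∷ xs) →
            All (λ p → key a +ᶠ key b ≤ᶠ weight p) (pairs (a ∷ b ∷ xs))
  pairs-≥ {xs = []}         _ = ≤ᶠ-refl ∷ []
  pairs-≥ {xs = _ ∷ []}     _ = ≤ᶠ-refl ∷ []
  pairs-≥ {xs = c ∷ d ∷ xs} ((_ ∷ a⊑c ∷ _) ∷ (_ ∷ b⊑d ∷ _) ∷ s) =
    ≤ᶠ-refl ∷ All.map (≤ᶠ-trans (+ᶠ-mono-≤ a⊑c b⊑d)) (pairs-≥ s)

  nodes-sorted : ∀ v {xs} → Sorted xs → Sorted (nodes v (pairs xs))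
  nodes-sorted v {[]}         _ = []
  nodes-sorted v {_ ∷ []}     _ = []
  nodes-sorted v {a ∷ b ∷ xs} s@(_ ∷ _ ∷ s′) =
    All-nodes (key a +ᶠ key b ≤ᶠ_) (2 + v) (All.tail (pairs-≥ s)) ∷ nodes-sorted (2 + v) s′

  -- Serves the case of an odd frontier: the leftover is then one of the two smallest objects of the
  -- next round and bounds the smaller component of every new node.
  pairs-⊑-unpaired : ∀ {xs ℓ} → Sorted xs → ℓ ∈ unpaired xs → All (λ p → proj₁ p ⊑ ℓ) (pairs xs)
  pairs-⊑-unpaired {[]}         _              _  = []
  pairs-⊑-unpaired {_ ∷ []}     _              _  = []
  pairs-⊑-unpaired {a ∷ b ∷ xs} ((_ ∷ a⊑) ∷ _ ∷ s) ℓ∈ =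
    All.lookup (All-unpaired a⊑) ℓ∈ ∷ pairs-⊑-unpaired s ℓ∈

  -- Replays the pairing as sequential merges. A new node joins `rest`; since the weight of every
  -- pair dominates all of `F`, the next two elements of `F` are still the smallest objects.
  merge-pairs : ∀ v F {rest objects} → Sorted F → objects ↭ map tree (F ++ rest) →
    All (λ r → All (_⊑ r) F) rest →
    All (λ p → All (λ y → key y ≤ᶠ weight p) F) (pairs F) →
    ∃ λ objects′ → Star _⇝_ objects objects′ ×
                   objects′ ↭ map tree (nodes v (pairs F) ++ unpaired F ++ rest)
  merge-pairs v []       _ perm _ _ = _ , ε , perm
  merge-pairs v (a ∷ []) _ perm _ _ = _ , ε , perm
  merge-pairs v (a ∷ b ∷ F) {rest} ((_ ∷ a⊑F) ∷ b⊑F ∷ s) perm F⊑rest ((_ ∷ _ ∷ F≤ab) ∷ F≤) =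
    let objects′ , merges , perm′ = merge-pairs (2 + v) F s
          (map⁺ tree (↭-sym (shift new F rest)))
          (F≤ab ∷ All.map (λ { (_ ∷ _ ∷ F⊑r) → F⊑r }) F⊑rest)
          (All.map (λ { (_ ∷ _ ∷ q) → q }) F≤)
    in objects′ , merge perm smallest ◅ merges ,
       ↭-trans perm′ (map⁺ tree
         (↭-trans (++⁺ˡ (nodes (2 + v) (pairs F)) (shift new (unpaired F) rest))
                  (shift new (nodes (2 + v) (pairs F)) (unpaired F ++ rest))))
    where
    new : Item
    new = v , node (tree a) (tree b)

    smallest : All (λ t → key a ≤ᶠ freq t × key b ≤ᶠ freq t) (map tree (F ++ rest))
    smallest = All.map⁺ (All.++⁺ (All.zip (a⊑F , b⊑F))
                                 (All.map (λ { (a⊑r ∷ b⊑r ∷ _) → a⊑r , b⊑r }) F⊑rest))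

  record Invariant (r : ℕ) (xs ys : List Item) : Set where
    field
      xs-sorted : Sorted xs
      ys-sorted : Sorted ys
      bounded   : ∀ {p q M} → xs ⋎ ys ≡ p ∷ q ∷ M → All (λ y → key y ≤ᶠ key p +ᶠ key q) ys
      -- Bounds the number r of rounds by the height of the final tree: one of
      -- the two smallest objects has height at least r.
      deep      : Σ[ R ∈ List Item ] Σ[ v ∈ Item ] Σ[ M ∈ List Item ]
                    xs ⋎ ys ≡ R ++ v ∷ M × length R ≤ 1 × r ≤ height (tree v)
      reachable : Σ[ objects ∈ List (Tree n) ]
                    Star _⇝_ (map leaf (allFin n)) objects × objects ↭ map tree (xs ++ ys)

  ⋎-head : ∀ {xs w ys} → All (λ x → ¬ x ⊑ w) xs → xs ⋎ (w ∷ ys) ≡ w ∷ (xs ⋎ ys)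
  ⋎-head []        = refl
  ⋎-head {x ∷ xs} {ys = ys} (x⋢w ∷ _) = ⋎-right xs ys x⋢w

  module Round {r xs₁ xs₂ ys e₀ e₁ M} (inv : Invariant r (xs₁ ++ xs₂) ys)
               (M≡ : (xs₁ ++ xs₂) ⋎ ys ≡ e₀ ∷ e₁ ∷ M)
               (below : All (λ p → key p ≤ᶠ key e₀ +ᶠ key e₁) xs₁)
               (above : All (λ p → ¬ key p ≤ᶠ key e₀ +ᶠ key e₁) xs₂) where
    open Invariant inv

    threshold : Freq
    threshold = key e₀ +ᶠ key e₁

    frontier : List Item
    frontier = xs₁ ⋎ ys

    xs₁-sorted : Sorted xs₁
    xs₁-sorted = proj₁ (sorted-++⁻ xs₁ xs-sorted)

    xs₂-sorted : Sorted xs₂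
    xs₂-sorted = proj₂ (sorted-++⁻ xs₁ xs-sorted)

    frontier-sorted : Sorted frontier
    frontier-sorted = ⋎-sorted xs₁-sorted ys-sorted

    ys≤ : All (λ y → key y ≤ᶠ threshold) ys
    ys≤ = bounded M≡

    frontier≤ : All (λ y → key y ≤ᶠ threshold) frontier
    frontier≤ = All-⋎ below ys≤

    -- No element of `xs₂` can precede one of the queue, which stays within the threshold that `xs₂`
    -- exceeds.
    frontier-prefix : (xs₁ ++ xs₂) ⋎ ys ≡ frontier ++ xs₂
    frontier-prefix = begin
      (xs₁ ++ xs₂) ⋎ ys          ≡⟨ cong ((xs₁ ++ xs₂) ⋎_) (++-identityʳ ys) ⟨
      (xs₁ ++ xs₂) ⋎ (ys ++ [])  ≡⟨ ⋎-++ xs₁ xs₂ ys [] (λ _ ()) xs₂⋢ys ⟩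
      frontier ++ (xs₂ ⋎ [])     ≡⟨ cong (frontier ++_) (⋎-[] xs₂) ⟩
      frontier ++ xs₂            ∎
      where
      open ≡-Reasoning
      xs₂⋢ys : ∀ {x y} → x ∈ xs₂ → y ∈ ys → ¬ x ⊑ y
      xs₂⋢ys x∈ y∈ x⊑y = All.lookup above x∈ (≤ᶠ-trans x⊑y (All.lookup ys≤ y∈))

    -- Frequencies are nonnegative, so neither of the two smallest objects exceeds their sum and
    -- both lie in `frontier`. A round therefore always makes progress.
    frontier-head : ∃ λ F → frontier ≡ e₀ ∷ e₁ ∷ F
    frontier-head with frontier | trans (sym frontier-prefix) M≡
    ... | []        | refl = contradiction (x≤x+y (freq≥0 (tree e₁))) (All.head above)
    ... | _ ∷ []    | refl = contradiction (y≤x+y (freq≥0 (tree e₀))) (All.head above)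
    ... | _ ∷ _ ∷ F | refl = F , refl

    k : ℕ
    k = length (pairs frontier)

    k>0 : 1 ≤ k
    k>0 = subst (λ F → 1 ≤ length (pairs F)) (sym (proj₂ frontier-head)) (s≤s z≤n)

    weights≥ : All (λ p → threshold ≤ᶠ weight p) (pairs frontier)
    weights≥ = subst (λ F → Sorted F → All (λ p → threshold ≤ᶠ weight p) (pairs F))
                 (sym (proj₂ frontier-head)) pairs-≥ frontier-sorted

    module _ {i j} (xs₁-ys : Path xs₁ ys i j) (i+j≡2k : i + j ≡ k + k) (v : ℕ) where

      xs′ ys′ : List Item
      xs′ = drop i xs₁ ++ xs₂
      ys′ = drop j ys ++ nodes v (pairs frontier)

      rest≡ : drop i xs₁ ⋎ drop j ys ≡ unpaired frontier
      rest≡ = trans (sym (drop-⋎ xs₁-ys))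
                (trans (cong (λ d → drop d frontier) i+j≡2k) (drop-pairs frontier))

      new : Item
      new = v , node (tree e₀) (tree e₁)

      others : List Item
      others = nodes (2 + v) (pairs (proj₁ frontier-head))

      nodes≡ : nodes v (pairs frontier) ≡ new ∷ others
      nodes≡ = cong (λ F → nodes v (pairs F)) (proj₂ frontier-head)

      nodes≥ : All (λ y → threshold ≤ᶠ key y) (nodes v (pairs frontier))
      nodes≥ = All-nodes (threshold ≤ᶠ_) v weights≥

      -- The key of `new` is the threshold itself: it is at least every leftover key and strictly
      -- below all of `xs₂`, so only the leftover can come before it.
      next-merge : xs′ ⋎ ys′ ≡ unpaired frontier ++ new ∷ (xs₂ ⋎ others)
      next-merge = begin
        xs′ ⋎ ys′
          ≡⟨ ⋎-++ (drop i xs₁) xs₂ (drop j ys) (nodes v (pairs frontier)) old⊑new xs₂⋢old ⟩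
        (drop i xs₁ ⋎ drop j ys) ++ (xs₂ ⋎ nodes v (pairs frontier))
          ≡⟨ cong₂ (λ R N → R ++ (xs₂ ⋎ N)) rest≡ nodes≡ ⟩
        unpaired frontier ++ (xs₂ ⋎ (new ∷ others))
          ≡⟨ cong (unpaired frontier ++_) (⋎-head above) ⟩
        unpaired frontier ++ new ∷ (xs₂ ⋎ others) ∎
        where
        open ≡-Reasoning
        old⊑new : ∀ {x y} → x ∈ drop i xs₁ → y ∈ nodes v (pairs frontier) → x ⊑ y
        old⊑new x∈ y∈ = ≤ᶠ-trans (All.lookup (All.drop⁺ i below) x∈) (All.lookup nodes≥ y∈)
        xs₂⋢old : ∀ {x y} → x ∈ xs₂ → y ∈ drop j ys → ¬ x ⊑ y
        xs₂⋢old x∈ y∈ x⊑y =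
          All.lookup above x∈ (≤ᶠ-trans x⊑y (All.lookup (All.drop⁺ j ys≤) y∈))

      count : length xs′ + length ys′ + k ≡ length (xs₁ ++ xs₂) + length ys
      count = begin
        length xs′ + length ys′ + k
          ≡⟨ cong₂ (λ a b → a + b + k) (length-++ (drop i xs₁))
               (trans (length-++ (drop j ys))
                      (cong (length (drop j ys) +_) (nodes-length v (pairs frontier)))) ⟩
        a + x₂ + (b + k) + k
          ≡⟨ regroup a b x₂ k ⟩
        k + k + (a + b) + x₂
          ≡⟨ cong (λ u → k + k + u + x₂)
               (trans (sym (⋎-length (drop i xs₁) (drop j ys))) (cong length rest≡)) ⟩
        k + k + length (unpaired frontier) + x₂
          ≡⟨ cong (_+ x₂) (length-pairs frontier) ⟩
        length frontier + x₂
          ≡⟨ trans (sym (length-++ frontier)) (sym (cong length frontier-prefix)) ⟩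
        length ((xs₁ ++ xs₂) ⋎ ys)
          ≡⟨ ⋎-length (xs₁ ++ xs₂) ys ⟩
        length (xs₁ ++ xs₂) + length ys ∎
        where
        open ≡-Reasoning
        regroup : ∀ a b x k → a + x + (b + k) + k ≡ k + k + (a + b) + x
        regroup = solve-∀
        a b x₂ : ℕ
        a  = length (drop i xs₁)
        b  = length (drop j ys)
        x₂ = length xs₂

      xs′-sorted : Sorted xs′
      xs′-sorted = AllPairs.++⁺ (AllPairs.drop⁺ i xs₁-sorted) xs₂-sorted
        (All.map (λ p → All.map (λ q → ≤ᶠ-trans p (≰ᶠ⇒≥ᶠ q)) above) (All.drop⁺ i below))

      ys′-sorted : Sorted ys′
      ys′-sorted = AllPairs.++⁺ (AllPairs.drop⁺ j ys-sorted) (nodes-sorted v frontier-sorted)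
        (All.map (λ p → All.map (≤ᶠ-trans p) nodes≥) (All.drop⁺ j ys≤))

      -- A new node weighs a + b with both parts at most the threshold, which is the key of `new`.
      -- If `new` comes first, a is bounded by its key and b by the next key. If the leftover comes
      -- first, it bounds a, and the key of `new` bounds b.
      bounded′ : ∀ {p q M} → xs′ ⋎ ys′ ≡ p ∷ q ∷ M → All (λ y → key y ≤ᶠ key p +ᶠ key q) ys′
      bounded′ {p} {q} eq
        with first-two (unpaired frontier) (trans (sym next-merge) eq) (unpaired-length frontier)
      ... | inj₁ refl =
        All.++⁺ (All.map (λ y≤ → ≤ᶠ-trans y≤ (x≤x+y (freq≥0 (tree q)))) (All.drop⁺ j ys≤))
          (All-nodes (_≤ᶠ key p +ᶠ key q) v
            (All.map (λ (a≤ , b≤) → +ᶠ-mono-≤ a≤ (≤ᶠ-trans b≤ p⊑q)) (All-pairs frontier≤)))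
        where
        p⊑q : p ⊑ q
        p⊑q with (p⊑q ∷ _) ∷ _ ← subst Sorted eq (⋎-sorted xs′-sorted ys′-sorted) = p⊑q
      ... | inj₂ (R≡ , refl) =
        All.++⁺ (All.map (λ y≤ → ≤ᶠ-trans y≤ (y≤x+y (freq≥0 (tree p)))) (All.drop⁺ j ys≤))
          (All-nodes (_≤ᶠ key p +ᶠ threshold) v
            (All.zipWith (λ (a≤ , (_ , b≤)) → +ᶠ-mono-≤ a≤ b≤)
              (pairs-⊑-unpaired frontier-sorted (subst (p ∈_) (sym R≡) (here refl)) ,
               All-pairs frontier≤)))

      deep′ : suc r ≤ height (tree new)
      deep′ with deep
      ... | []        , _ , _ , eq , _ , r≤ with refl ← trans (sym M≡) eq = s≤s (m≤n⇒m≤n⊔o _ r≤)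
      ... | _ ∷ []    , _ , _ , eq , _ , r≤ with refl ← trans (sym M≡) eq = s≤s (m≤n⇒m≤o⊔n _ r≤)
      ... | _ ∷ _ ∷ _ , _ , _ , _ , s≤s () , _

      reachable′ : Σ[ objects ∈ List (Tree n) ]
                     Star _⇝_ (map leaf (allFin n)) objects × objects ↭ map tree (xs′ ++ ys′)
      reachable′ =
        let objects , merges , perm = reachable
            objects′ , merges′ , perm′ = merge-pairs v frontier frontier-sorted
              (↭-trans perm (map⁺ tree (↭-trans (↭-sym (⋎-↭ (xs₁ ++ xs₂) ys))
                                                (↭-reflexive frontier-prefix))))
              (All.map (λ x₂≰ → All.map (λ y≤ → ≤ᶠ-trans y≤ (≰ᶠ⇒≥ᶠ x₂≰)) frontier≤) above)
              (All.map (λ x≤ → All.map (λ y≤ → ≤ᶠ-trans y≤ x≤) frontier≤) weights≥)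
        in objects′ , merges ◅◅ merges′ , ↭-trans perm′ (map⁺ tree rearrange)
        where
        N : List Item
        N = nodes v (pairs frontier)
        open PermutationReasoning
        rearrange : N ++ unpaired frontier ++ xs₂ ↭ xs′ ++ ys′
        rearrange = begin
          N ++ unpaired frontier ++ xs₂
            ↭⟨ ++⁺ˡ N (++⁺ʳ xs₂ (↭-trans (↭-reflexive (sym rest≡)) (⋎-↭ (drop i xs₁) (drop j ys)))) ⟩
          N ++ (drop i xs₁ ++ drop j ys) ++ xs₂
            ↭⟨ ++-comm N _ ⟩
          ((drop i xs₁ ++ drop j ys) ++ xs₂) ++ N
            ↭⟨ ++⁺ʳ N (↭-reflexive (++-assoc (drop i xs₁) (drop j ys) xs₂)) ⟩
          (drop i xs₁ ++ (drop j ys ++ xs₂)) ++ N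
            ↭⟨ ++⁺ʳ N (++⁺ˡ (drop i xs₁) (++-comm (drop j ys) xs₂)) ⟩
          (drop i xs₁ ++ (xs₂ ++ drop j ys)) ++ N
            ↭⟨ ↭-reflexive (cong (_++ N) (sym (++-assoc (drop i xs₁) xs₂ (drop j ys)))) ⟩
          (xs′ ++ drop j ys) ++ N
            ↭⟨ ↭-reflexive (++-assoc xs′ (drop j ys) N) ⟩
          xs′ ++ ys′ ∎

      next : Invariant (suc r) xs′ ys′
      next = record
        { xs-sorted = xs′-sorted ; ys-sorted = ys′-sorted ; bounded = bounded′
        ; deep = unpaired frontier , new , _ , next-merge , unpaired-length frontier , deep′
        ; reachable = reachable′ }

  final : ∀ {r xs ys z} → Invariant r xs ys → xs ++ ys ≡ [ z ] →
          IsHuffmanTree (tree z) × r ≤ height (tree z)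
  final {r} {xs} {ys} {z} inv eq with reachable
    where open Invariant inv
  ... | objects , merges , perm
    with refl ← ↭-singleton-inv (↭-trans perm (map⁺ tree (↭-reflexive eq))) = merges , depth
    where
    open Invariant inv
    depth : r ≤ height (tree z)
    depth with deep | ↭-singleton-inv (↭-trans (⋎-↭ xs ys) (↭-reflexive eq))
    ... | []        , _ , _ , eq₁ , _ , r≤ | eq₂ with refl ← trans (sym eq₁) eq₂ = r≤
    ... | _ ∷ []    , _ , _ , eq₁ , _ , r≤ | eq₂ with () ← trans (sym eq₁) eq₂
    ... | _ ∷ _ ∷ _ , _ , _ , _ , s≤s () , _ | _

  -- Number of leaves and height

  size : Tree n → ℕ
  size (leaf _)   = 1
  size (node l r) = size l + size r

  size≤2^height : ∀ t → size t ≤ 2 ^ height t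
  size≤2^height (leaf _)   = ≤-refl
  size≤2^height (node l r) = ≤-trans
    (+-mono-≤ (≤-trans (size≤2^height l) (^-monoʳ-≤ 2 (m≤m⊔n (height l) (height r))))
              (≤-trans (size≤2^height r) (^-monoʳ-≤ 2 (m≤n⊔m (height l) (height r)))))
    (≤-reflexive (cong (2 ^ (height l ⊔ height r) +_) (sym (+-identityʳ _))))

  sizes-preserved : ∀ {ts us} → Star _⇝_ ts us → sum (map size ts) ≡ sum (map size us)
  sizes-preserved ε = refl
  sizes-preserved (merge {a = a} {b} perm _ ◅ merges) =
    trans (trans (sum-↭ (map⁺ size perm)) (sym (+-assoc (size a) (size b) _)))
          (sizes-preserved merges)

  -- Merging preserves the total number of leaves, and a binary tree of height h has at most `2 ^ h`
  -- of them. This is what hides the span of the sort in the final bound.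
  log≤height : ∀ {t} → IsHuffmanTree t → ⌈log₂ n ⌉ ≤ height t
  log≤height {t} huffman = subst (⌈log₂ n ⌉ ≤_) (⌈log₂2^n⌉≡n (height t))
    (⌈log₂⌉-mono-≤ (subst (_≤ 2 ^ height t) size≡n (size≤2^height t)))
    where
    ones : ∀ (is : List (Fin n)) → sum (map size (map leaf is)) ≡ length is
    ones []       = refl
    ones (_ ∷ is) = cong suc (ones is)
    size≡n : size t ≡ n
    size≡n = trans (sym (+-identityʳ (size t)))
      (trans (sym (sizes-preserved huffman)) (trans (ones (allFin n)) (length-tabulate (λ i → i))))

-- Verification of the program

module Memory (𝓕 : FrequencyDomain) {n : ℕ} (f : Fin n → FrequencyDomain.Freq 𝓕)
  (f≥0 : NonNegative 𝓕 f) where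
  open FrequencyDomain 𝓕
  open Machine 𝓕 public
  open ProgramLogic 𝓕 program public
  open HuffmanModel 𝓕 f f≥0 public

  -- A strengthening of m ⊨ p ↦ t that confines the nodes to R.
  data Built (R : Region) (m : Address → ℕ) : ℕ → Tree n → Set where
    leaf : ∀ i → Built R m (toℕ i) (leaf i)
    node : ∀ {p l r} → n ≤ p → R (wordAt p) → R (wordAt (suc p)) →
           Built R m (m p) l → Built R m (m (suc p)) r → Built R m p (node l r)

  built⇒⊨ : ∀ {R m p t} → Built R m p t → m ⊨ p ↦ t
  built⇒⊨ (leaf i)           = leaf i
  built⇒⊨ (node n≤p _ _ l r) = node n≤p (built⇒⊨ l) (built⇒⊨ r)

  built-resp : ∀ {R μ μ′ p t} → μ′ ≋[ R ] μ → Built R (words μ) p t → Built R (words μ′) p t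
  built-resp same (leaf i) = leaf i
  built-resp {R} {μ} {μ′} same (node {l = l} {r} n≤p p∈ p′∈ bl br) = node n≤p p∈ p′∈
    (subst (λ p → Built R (words μ′) p l) (sym (onWords same p∈)) (built-resp same bl))
    (subst (λ p → Built R (words μ′) p r) (sym (onWords same p′∈)) (built-resp same br))

  built-⊆ : ∀ {R R′ m p t} → R ⊆ R′ → Built R m p t → Built R′ m p t
  built-⊆ R⊆ (leaf i)             = leaf i
  built-⊆ R⊆ (node n≤p p∈ p′∈ l r) = node n≤p (R⊆ p∈) (R⊆ p′∈) (built-⊆ R⊆ l) (built-⊆ R⊆ r)

  record Object (R : Region) (μ : Store) (x : Item) : Set where
    constructor object
    field
      keyed  : R (freqAt (proj₁ x))
      key≡   : freqs μ (proj₁ x) ≡ key x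
      built  : Built R (words μ) (proj₁ x) (tree x)
  open Object public

  object-resp : ∀ {R μ μ′ x} → μ′ ≋[ R ] μ → Object R μ x → Object R μ′ x
  object-resp same (object k eq b) = object k (trans (onFreqs same k) eq) (built-resp same b)

  object-⊆ : ∀ {R R′ μ x} → R ⊆ R′ → Object R μ x → Object R′ μ x
  object-⊆ R⊆ (object k eq b) = object (R⊆ k) eq (built-⊆ R⊆ b)

  record Entry (R : Region) (μ : Store) (a : Address) (x : Item) : Set where
    constructor entry
    field
      readable : R (wordAt a)
      word≡    : words μ a ≡ proj₁ x
      isObject : Object R μ x
  open Entry public

  entry-⊆ : ∀ {R R′ μ a x} → R ⊆ R′ → Entry R μ a x → Entry R′ μ a x
  entry-⊆ R⊆ (entry a eq obj) = entry (R⊆ a) eq (object-⊆ R⊆ obj)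

  record Array (R : Region) (μ : Store) (a : Address) (xs : List Item) : Set where
    constructor array
    field
      at : ∀ {i x} → xs ‼ i ≡ just x → Entry R μ (a + i) x
  open Array public

  array-resp : ∀ {R μ μ′ a xs} → μ′ ≋[ R ] μ → Array R μ a xs → Array R μ′ a xs
  array-resp same xs∈ = array λ eq → let entry a∈ w obj = at xs∈ eq in
    entry a∈ (trans (onWords same a∈) w) (object-resp same obj)

  array-⊆ : ∀ {R R′ μ a xs} → R ⊆ R′ → Array R μ a xs → Array R′ μ a xs
  array-⊆ R⊆ xs∈ = array λ eq → entry-⊆ R⊆ (at xs∈ eq)

  array-head : ∀ {R μ a x xs} → Array R μ a (x ∷ xs) → Entry R μ a x
  array-head {R} {μ} {a} {x} xs∈ = subst (λ b → Entry R μ b x) (+-identityʳ a) (at xs∈ refl)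

  array-drop : ∀ {R μ a xs} i → Array R μ a xs → Array R μ (a + i) (drop i xs)
  array-drop {R} {μ} {a} {xs} i xs∈ = array λ {j} {x} eq →
    subst (λ b → Entry R μ b x) (sym (+-assoc a i j)) (at xs∈ (trans (sym (‼-drop i xs j)) eq))

  array-tail : ∀ {R μ a x xs} → Array R μ a (x ∷ xs) → Array R μ (suc a) xs
  array-tail {R} {μ} {a} xs∈ = array λ {i} {x} eq →
    subst (λ b → Entry R μ b x) (+-suc a i) (at xs∈ eq)

  array-prefix : ∀ {R μ a xs ys} → Array R μ a (xs ++ ys) → Array R μ a xs
  array-prefix {xs = xs} xs∈ = array λ eq → at xs∈ (‼-++ˡ xs eq)

  -- An `Entry` without its tree. A comparison needs no more, and the threshold of a round is
  -- compared before any node for it exists.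
  record KeyAt (R : Region) (μ : Store) (a : Address) (x : Item) : Set where
    constructor keyAt
    field
      pointer-readable : R (wordAt a)
      pointer≡         : words μ a ≡ proj₁ x
      key-readable     : R (freqAt (proj₁ x))
      stored-key≡      : freqs μ (proj₁ x) ≡ key x

  entry⇒keyAt : ∀ {R R′ μ a x} → R ⊆ R′ → Entry R μ a x → KeyAt R′ μ a x
  entry⇒keyAt R⊆ (entry a∈ w (object k∈ k≡ _)) = keyAt (R⊆ a∈) w (R⊆ k∈) k≡

  load-key : ∀ {A W Q pc vs qs μ w s r r′ g a x} → KeyAt A μ a x →
    fetch program pc ≡ load r r′ → fetch program (suc pc) ≡ fload g r →
    vs ‼ r′ ≡ just a → update r (proj₁ x) vs ‼ r ≡ just (proj₁ x) →
    WP A W Q (2 + pc) (update r (proj₁ x) vs) (update g (key x) qs) μ w s →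
    WP A W Q pc vs qs μ (2 + w) (2 + s)
  load-key (keyAt a∈ w k∈ key≡) p p′ q q′ wp = load p q a∈ w (fload p′ q′ k∈ key≡ wp)

-- Binary search

module Searching (𝓕 : FrequencyDomain) {n : ℕ} (f : Fin n → FrequencyDomain.Freq 𝓕)
  (f≥0 : NonNegative 𝓕 f) where
  open FrequencyDomain 𝓕
  open Memory 𝓕 f f≥0 public

  module _ (X Y : ℕ → Maybe Item) (lo₀ hi₀ : ℕ) where

    Below Above : ℕ → Set
    Below i = ∀ {p x y} → lo₀ ≤ p → p < i → X p ≡ just x → Y p ≡ just y → x ⊑ y
    Above i = ∀ {p x y} → i ≤ p → p < hi₀ → X p ≡ just x → Y p ≡ just y → ¬ x ⊑ y

    Boundary : Address → Store → Set
    Boundary o μ = Σ[ i ∈ ℕ ] words μ o ≡ i × lo₀ ≤ i × i ≤ hi₀ × Below i × Above i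

  module _ {A W : Region} {μ : Store} {a q o lo₀ hi₀ : ℕ} (X Y : ℕ → Maybe Item)
           (faces : ∀ {p} → lo₀ ≤ p → p < hi₀ →
              Σ[ x ∈ Item ] Σ[ y ∈ Item ] X p ≡ just x × Y p ≡ just y ×
                KeyAt A μ (a + p) x × KeyAt A μ (q ∸ p) y)
           (monotone : ∀ {p p′ x x′ y y′} → p ≤ p′ → X p ≡ just x → X p′ ≡ just x′ →
              Y p ≡ just y → Y p′ ≡ just y′ → x′ ⊑ y′ → x ⊑ y)
           (o∈A : A (wordAt o)) (o∈W : W (wordAt o)) where

    -- One proof serves both searches, because only the monotonicity of `X p ⊑ Y p` in `p` matters:
    -- `Y` runs backwards along a diagonal for a merge path and is constant for the threshold. Every
    -- iteration takes at most 12 instructions and halves the width, whose bound `2 ^ h` leaves no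
    -- room to iterate once `h` is zero.
    search-wp : ∀ h {c c₁ lo hi t u g₀ g₁} → lo₀ ≤ lo → lo ≤ hi → hi ≤ hi₀ → hi < lo + 2 ^ h →
      Below X Y lo₀ hi₀ lo → Above X Y lo₀ hi₀ hi →
      WP A W (λ _ μ′ _ _ → Boundary X Y lo₀ hi₀ o μ′) SEARCH (c ∷ 1 ∷ a ∷ q ∷ lo ∷ hi ∷ o ∷ t ∷ u ∷ c₁)
         (g₀ ∷ g₁ ∷ []) μ (3 + h * 12) (3 + h * 12)
    search-wp h {lo = lo} {hi} lo₀≤lo lo≤hi hi≤hi₀ width below above =
      jle refl refl refl
        (λ hi≤lo → store refl refl refl o∈W (halt refl λ same →
           lo , trans (onWords same o∈A) (≔-same (words μ) o) ,
           lo₀≤lo , ≤-trans lo≤hi hi≤hi₀ , below ,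
           λ lo≤p → above (≤-trans hi≤lo lo≤p)))
        (λ hi≰lo → body h width (≰⇒> hi≰lo))
      where
      m : ℕ
      m = ⌊ lo + hi /2⌋

      body : ∀ h {c c₁ t u g₀ g₁} → hi < lo + 2 ^ h → lo < hi →
        WP A W (λ _ μ′ _ _ → Boundary X Y lo₀ hi₀ o μ′) (suc SEARCH)
           (c ∷ 1 ∷ a ∷ q ∷ lo ∷ hi ∷ o ∷ t ∷ u ∷ c₁) (g₀ ∷ g₁ ∷ []) μ (2 + h * 12) (2 + h * 12)
      body zero width lo<hi = contradiction (subst (hi <_) (+-comm lo 1) width) (≤⇒≯ lo<hi)
      body (suc h) width lo<hi
        with faces (≤-trans lo₀≤lo (middle-≥ (half-lower (lo + hi)) (half-upper (lo + hi)) (<⇒≤ lo<hi)))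
                   (<-≤-trans (middle-< (half-lower (lo + hi)) (half-upper (lo + hi)) lo<hi) hi≤hi₀)
      ... | x , y , X≡ , Y≡ , x∈ , y∈ =
        ops 3 refl (load-key x∈ refl refl refl refl (ops 1 refl (load-key y∈ refl refl refl refl
          (fjle refl refl refl
            (λ x⊑y → ops 1 refl (jump refl (search-wp h
               (≤-trans lo₀≤lo (≤-trans lo≤m (n≤1+n m))) m<hi hi≤hi₀ (middle-upper lower upper {2 ^ h} width)
               (λ { _ (s≤s p≤m) X≡′ Y≡′ → monotone p≤m X≡′ X≡ Y≡′ Y≡ x⊑y })
               above)))
            (λ x⋢y → ops 1 refl (jump refl (search-wp h
               lo₀≤lo lo≤m (≤-trans (<⇒≤ m<hi) hi≤hi₀) (middle-lower lower upper {2 ^ h} width)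
               below
               (λ m≤p _ X≡′ Y≡′ x⊑y → x⋢y (monotone m≤p X≡ X≡′ Y≡ Y≡′ x⊑y)))))))))
        where
        lower : m + m ≤ lo + hi
        lower = half-lower (lo + hi)
        upper : lo + hi ≤ suc (m + m)
        upper = half-upper (lo + hi)
        lo≤m : lo ≤ m
        lo≤m  = middle-≥ lower upper (<⇒≤ lo<hi)
        m<hi : m < hi
        m<hi  = middle-< lower upper lo<hi

-- Producing one block of a merge

drop-suc : ∀ {A : Set} p (M : List A) {x xs} → drop p M ≡ x ∷ xs →
           M ‼ p ≡ just x × drop (suc p) M ≡ xs
drop-suc zero    (_ ∷ _) refl = refl , refl
drop-suc (suc p) (_ ∷ M) eq   = drop-suc p M eq

module Merges (𝓕 : FrequencyDomain) {n : ℕ} (f : Fin n → FrequencyDomain.Freq 𝓕)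
  (f≥0 : NonNegative 𝓕 f) where
  open FrequencyDomain 𝓕
  open Searching 𝓕 f f≥0 public

  Split : List Item → List Item → Address → ℕ → Store → Set
  Split xs ys o s μ = Σ[ i ∈ ℕ ] words μ o ≡ i × i ≤ s × Path xs ys i (s ∸ i)

  module _ {A W R : Region} {μ : Store} {a b o la lb s : ℕ} {xs ys : List Item}
           (R⊆A : R ⊆ A) (axs : Array R μ a xs) (bys : Array R μ b ys)
           (la≡ : la ≡ length xs) (lb≡ : lb ≡ length ys) (sx : Sorted xs) (sy : Sorted ys)
           (s≤ : s ≤ la + lb) (o∈A : A (wordAt o)) (o∈W : W (wordAt o)) where

    -- The number `h` of iterations is left to the caller: for a block at position 0 the interval is
    -- a single point, and the search must not be charged log n.
    path-wp : ∀ h → (∀ {hi} → hi ≤ s → hi ≤ la → hi < (s ∸ lb) + 2 ^ h) →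
      ∀ {c q lo hi t u z c₁ g₀ g₁} →
      WP A W (λ _ μ′ _ _ → Split xs ys o s μ′) PATH
         (c ∷ 1 ∷ a ∷ q ∷ lo ∷ hi ∷ o ∷ t ∷ u ∷ la ∷ b ∷ lb ∷ z ∷ s ∷ c₁)
         (g₀ ∷ g₁ ∷ []) μ (9 + h * 12) (9 + h * 12)
    path-wp h width {c} {t = t} {u} {z} {c₁} = ops 2 refl (jle refl refl refl
      (λ s≤la → relax (n≤1+n _) (n≤1+n _) (from ≤-refl s≤la (m∸n≤m s lb) (λ p<s _ → p<s)))
      (λ s≰la → ops 1 refl (from (<⇒≤ (≰⇒> s≰la)) ≤-refl lo≤la (λ _ p<la → p<la))))
      where
      lo≤la : s ∸ lb ≤ la
      lo≤la = m≤n+o⇒m∸n≤o s lb (≤-trans s≤ (≤-reflexive (+-comm la lb)))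

      from : ∀ {hi q g₀ g₁} → hi ≤ s → hi ≤ la → s ∸ lb ≤ hi → (∀ {p} → p < s → p < la → p < hi) →
        WP A W (λ _ μ′ _ _ → Split xs ys o s μ′) CLIPPED
           (c ∷ 1 ∷ a ∷ q ∷ s ∸ lb ∷ hi ∷ o ∷ t ∷ u ∷ la ∷ b ∷ lb ∷ z ∷ s ∷ c₁)
           (g₀ ∷ g₁ ∷ []) μ (5 + h * 12) (5 + h * 12)
      from {hi} hi≤s hi≤la lo≤hi hi-max = ops 2 refl (weaken-post (λ {_} {μ′} → split {μ′})
        (search-wp (xs ‼_) (λ p → ys ‼ (s ∸ suc p)) faces
           monotone
           o∈A o∈W h ≤-refl lo≤hi ≤-refl (width hi≤s hi≤la)
           (λ lo≤p p<lo → contradiction lo≤p (<⇒≱ p<lo))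
           (λ hi≤p p<hi → contradiction hi≤p (<⇒≱ p<hi))))
        where
        faces : ∀ {p} → s ∸ lb ≤ p → p < hi →
          Σ[ x ∈ Item ] Σ[ y ∈ Item ] xs ‼ p ≡ just x × ys ‼ (s ∸ suc p) ≡ just y ×
            KeyAt A μ (a + p) x × KeyAt A μ (b + s ∸ 1 ∸ p) y
        faces {p} lo≤p p<hi =
          let x , X≡ = ‼-< xs (subst (p <_) la≡ (<-≤-trans p<hi hi≤la))
              y , Y≡ = ‼-< ys (subst (s ∸ suc p <_) lb≡ in-ys)
          in x , y , X≡ , Y≡ , entry⇒keyAt R⊆A (at axs X≡) ,
             subst (λ d → KeyAt A μ d y) (sym address) (entry⇒keyAt R⊆A (at bys Y≡))
          where
          p<s : p < s
          p<s = <-≤-trans p<hi hi≤s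
          in-ys : s ∸ suc p < lb
          in-ys = +-cancelˡ-≤ p (suc (s ∸ suc p)) lb
            (≤-trans (≤-reflexive (trans (+-suc p (s ∸ suc p)) (m+[n∸m]≡n p<s)))
                     (≤-trans (m≤n+m∸n s lb) (≤-trans (+-monoʳ-≤ lb lo≤p) (≤-reflexive (+-comm lb p)))))
          address : b + s ∸ 1 ∸ p ≡ b + (s ∸ suc p)
          address = trans (∸-+-assoc (b + s) 1 p) (+-∸-assoc b p<s)

        monotone : ∀ {p p′ x x′ y y′} → p ≤ p′ → xs ‼ p ≡ just x → xs ‼ p′ ≡ just x′ →
          ys ‼ (s ∸ suc p) ≡ just y → ys ‼ (s ∸ suc p′) ≡ just y′ → x′ ⊑ y′ → x ⊑ y
        monotone p≤p′ X≡ X≡′ Y≡ Y≡′ x′⊑y′ = ≤ᶠ-trans (sorted-‼ sx p≤p′ X≡ X≡′)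
          (≤ᶠ-trans x′⊑y′ (sorted-‼ sy (∸-monoʳ-≤ s (s≤s p≤p′)) Y≡′ Y≡))
        split : ∀ {μ′} → Boundary (xs ‼_) (λ p → ys ‼ (s ∸ suc p)) (s ∸ lb) hi o μ′ → Split xs ys o s μ′
        split (i , w , lo≤i , i≤hi , below , above) = i , w , ≤-trans i≤hi hi≤s ,
          diagonal-path sx sy (≤-trans i≤hi hi≤s) (subst (λ l → s ∸ l ≤ i) lb≡ lo≤i)
            (≤-trans i≤hi (subst (hi ≤_) la≡ hi≤la))
            (λ {p} lo≤p → below (subst (λ l → s ∸ l ≤ p) (sym lb≡) lo≤p))
            (λ {p} i≤p p<s X≡ → above i≤p (hi-max p<s (subst (p <_) (sym la≡) (‼-bound xs X≡))) X≡)

  Outcome : List Item → Address → ℕ → ℕ → Store → Set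
  Outcome M z s e μ = ∀ {i x} → s ≤ i → i < e → M ‼ i ≡ just x → words μ (z + i) ≡ proj₁ x

  module _ {A W R : Region} {M : List Item} {z s e : ℕ} (R⊆A : R ⊆ A)
           (out∈A : ∀ {i} → s ≤ i → i < e → A (wordAt (z + i)))
           (out∈W : ∀ {i} → s ≤ i → i < e → W (wordAt (z + i)))
           (out∉R : ∀ {i} → s ≤ i → i < e → ¬ R (wordAt (z + i))) where

    outcome-resp : ∀ {μ μ′} → μ′ ≋[ A ] μ → Outcome M z s e μ → Outcome M z s e μ′
    outcome-resp same out s≤i i<e eq = trans (onWords same (out∈A s≤i i<e)) (out s≤i i<e eq)

    -- The loop invariant is `drop p M ≡ xs ⋎ ys`: what is still to be written begins the merge of
    -- the two unread suffixes. The bound on `k` ensures that they are not both empty before the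
    -- block is complete.
    emit-wp : ∀ k {p μ a b xs ys la lb o ez} → s ≤ p → e ≡ p + k → drop p M ≡ xs ⋎ ys →
      k ≤ length xs + length ys → Array R μ a xs → Array R μ b ys →
      la ≡ a + length xs → lb ≡ b + length ys → o ≡ z + p → ez ≡ z + e → Outcome M z s p μ →
      ∀ {c q lo hi t u c₁ g₀ g₁} →
      WP A W (λ _ μ′ _ _ → Outcome M z s e μ′) EMIT
         (c ∷ 1 ∷ a ∷ q ∷ lo ∷ hi ∷ o ∷ t ∷ u ∷ la ∷ b ∷ lb ∷ ez ∷ c₁)
         (g₀ ∷ g₁ ∷ []) μ (2 + k * 14) (2 + k * 14)

    -- The common tail of both branches, once the smallest element x is in %t.
    emitted-wp : ∀ k {p μ a b x xs ys la lb o ez} → s ≤ p → e ≡ p + suc k → drop p M ≡ x ∷ (xs ⋎ ys) →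
      k ≤ length xs + length ys → Array R μ a xs → Array R μ b ys →
      la ≡ a + length xs → lb ≡ b + length ys → o ≡ z + p → ez ≡ z + e → Outcome M z s p μ →
      ∀ {c q lo hi u c₁ g₀ g₁} →
      WP A W (λ _ μ′ _ _ → Outcome M z s e μ′) WRITE
         (c ∷ 1 ∷ a ∷ q ∷ lo ∷ hi ∷ o ∷ proj₁ x ∷ u ∷ la ∷ b ∷ lb ∷ ez ∷ c₁)
         (g₀ ∷ g₁ ∷ []) μ (5 + k * 14) (5 + k * 14)
    emitted-wp k {p} {μ} {x = x} s≤p refl M≡ k≤ axs bys la≡ lb≡ refl ez≡ out =
      store refl refl refl (out∈W s≤p p<e) (ops 1 refl (jump refl
        (emit-wp k (≤-trans s≤p (n≤1+n p)) (+-suc p k) (proj₂ (drop-suc p M M≡)) k≤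
          (array-resp same axs) (array-resp same bys) la≡ lb≡ (sym (+-suc z p)) ez≡ out′)))
      where
      p<e : p < p + suc k
      p<e = m<m+n p (s≤s z≤n)
      same : ⟨ words μ [ z + p ≔ proj₁ x ] , freqs μ ⟩ ≋[ R ] μ
      same = store-word μ (z + p) (proj₁ x) (out∉R s≤p p<e)
      out′ : Outcome M z s (suc p) ⟨ words μ [ z + p ≔ proj₁ x ] , freqs μ ⟩
      out′ {i} s≤i (s≤s i≤p) eq with m≤n⇒m<n∨m≡n i≤p
      ... | inj₁ i<p = trans (≔-other (words μ) (λ z+i≡z+p → <⇒≢ i<p (+-cancelˡ-≡ z i p z+i≡z+p)))
                             (out s≤i i<p eq)
      ... | inj₂ refl with refl ← trans (sym eq) (proj₁ (drop-suc p M M≡)) =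
        ≔-same (words μ) (z + p)

    emit-wp zero {p} s≤p refl _ _ _ _ _ _ refl refl out =
      jle refl refl refl
        (λ _ → halt refl λ same → outcome-resp same
           (λ {i} s≤i i<e → out s≤i (subst (i <_) (+-identityʳ p) i<e)))
        (λ ez≰o → contradiction (≤-reflexive (cong (z +_) (+-identityʳ p))) ez≰o)
    emit-wp (suc k) {p} {μ} {a} {b} {xs} {ys} s≤p refl M≡ k≤ axs bys refl refl refl refl out =
      jle refl refl refl
        (λ ez≤o → contradiction (+-cancelˡ-≤ z (p + suc k) p ez≤o) (m+1+n≰m p))
        (λ _ → choose xs ys M≡ k≤ axs bys)
      where
      choose : ∀ xs ys → drop p M ≡ xs ⋎ ys → suc k ≤ length xs + length ys →
        Array R μ a xs → Array R μ b ys → ∀ {c q lo hi t u c₁ g₀ g₁} →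
        WP A W (λ _ μ′ _ _ → Outcome M z s (p + suc k) μ′) (1 + EMIT)
         (c ∷ 1 ∷ a ∷ q ∷ lo ∷ hi ∷ z + p ∷ t ∷ u ∷ a + length xs ∷ b ∷ b + length ys ∷ z + (p + suc k) ∷ c₁)
         (g₀ ∷ g₁ ∷ []) μ (15 + k * 14) (15 + k * 14)

      take-a : ∀ {x} xs ys → drop p M ≡ x ∷ (xs ⋎ ys) → suc k ≤ suc (length xs + length ys) →
        Array R μ a (x ∷ xs) → Array R μ b ys → ∀ {c q lo hi t u c₁ g₀ g₁} →
        WP A W (λ _ μ′ _ _ → Outcome M z s (p + suc k) μ′) TAKEA
         (c ∷ 1 ∷ a ∷ q ∷ lo ∷ hi ∷ z + p ∷ t ∷ u ∷ a + suc (length xs) ∷ b ∷ b + length ys ∷ z + (p + suc k) ∷ c₁)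
         (g₀ ∷ g₁ ∷ []) μ (7 + k * 14) (7 + k * 14)
      take-a xs ys M≡ (s≤s k≤) axs bys =
        load refl refl (R⊆A (readable x∈)) (word≡ x∈) (ops 1 refl
          (emitted-wp k s≤p refl M≡ k≤ (array-tail axs) bys (+-suc a (length xs)) refl refl refl out))
        where x∈ = array-head axs

      take-b : ∀ {y} xs ys → drop p M ≡ y ∷ (xs ⋎ ys) → suc k ≤ suc (length xs + length ys) →
        Array R μ a xs → Array R μ b (y ∷ ys) → ∀ {c q lo hi t u c₁ g₀ g₁} →
        WP A W (λ _ μ′ _ _ → Outcome M z s (p + suc k) μ′) TAKEB
         (c ∷ 1 ∷ a ∷ q ∷ lo ∷ hi ∷ z + p ∷ t ∷ u ∷ a + length xs ∷ b ∷ b + suc (length ys) ∷ z + (p + suc k) ∷ c₁)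
         (g₀ ∷ g₁ ∷ []) μ (8 + k * 14) (8 + k * 14)
      take-b xs ys M≡ (s≤s k≤) axs bys =
        load refl refl (R⊆A (readable y∈)) (word≡ y∈) (ops 1 refl (jump refl
          (emitted-wp k s≤p refl M≡ k≤ axs (array-tail bys) refl (+-suc b (length ys)) refl refl out)))
        where y∈ = array-head bys

      choose []       []       M≡ ()
      choose (x ∷ xs) []       M≡ k≤ axs bys =
        jle refl refl refl
          (λ _ → relax (m≤n+m _ 7) (m≤n+m _ 7)
            (take-a xs [] (trans M≡ (cong (x ∷_) (sym (⋎-[] xs)))) k≤ axs bys))
          (λ lb≰b → contradiction (≤-reflexive (+-identityʳ b)) lb≰b)
      choose []       (y ∷ ys) M≡ k≤ axs bys =
        jle refl refl refl
          (λ lb≤b → contradiction lb≤b (m+1+n≰m b))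
          (λ _ → jle refl refl refl
            (λ _ → relax (m≤n+m _ 5) (m≤n+m _ 5) (take-b [] ys M≡ k≤ axs bys))
            (λ la≰a → contradiction (≤-reflexive (+-identityʳ a)) la≰a))
      choose (x ∷ xs) (y ∷ ys) M≡ k≤ axs bys =
        jle refl refl refl
          (λ lb≤b → contradiction lb≤b (m+1+n≰m b))
          (λ _ → jle refl refl refl
            (λ la≤a → contradiction la≤a (m+1+n≰m a))
            (λ _ → load-key (entry⇒keyAt R⊆A (array-head axs)) refl refl refl refl
              (load-key (entry⇒keyAt R⊆A (array-head bys)) refl refl refl refl
                (fjle refl refl refl
                  (λ x⊑y → relax (n≤1+n _) (n≤1+n _)
                    (take-a xs (y ∷ ys) (trans M≡ (⋎-left xs ys x⊑y)) k≤ axs bys))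
                  (λ x⋢y →
                    take-b (x ∷ xs) ys (trans M≡ (⋎-right xs ys x⋢y))
                      (≤-trans k≤ (≤-reflexive (cong suc (+-suc (length xs) (length ys))))) axs bys)))))

  module _ {A W R : Region} {μ : Store} {a b z la lb s e : ℕ} {xs ys : List Item} (R⊆A : R ⊆ A)
           (out∈A : ∀ {i} → s ≤ i → i < e → A (wordAt (z + i)))
           (out∈W : ∀ {i} → s ≤ i → i < e → W (wordAt (z + i)))
           (out∉R : ∀ {i} → s ≤ i → i < e → ¬ R (wordAt (z + i)))
           (axs : Array R μ a xs) (bys : Array R μ b ys)
           (la≡ : la ≡ length xs) (lb≡ : lb ≡ length ys) (sx : Sorted xs) (sy : Sorted ys)
           (e≤ : e ≤ la + lb) where

    -- The search returns its result in the first output cell of the block itself. That cell belongs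
    -- to this thread alone, and the block overwrites it afterwards.
    leaf-wp : ∀ h k → e ≡ s + suc k → (∀ {hi} → hi ≤ s → hi ≤ la → hi < (s ∸ lb) + 2 ^ h) →
      ∀ {c q lo hi o t u blk g₀ g₁} →
      WP A W (λ _ μ′ _ _ → Outcome (xs ⋎ ys) z s e μ′) LEAF
         (c ∷ 1 ∷ a ∷ q ∷ lo ∷ hi ∷ o ∷ t ∷ u ∷ la ∷ b ∷ lb ∷ z ∷ s ∷ e ∷ blk ∷ 0 ∷ [])
         (g₀ ∷ g₁ ∷ []) μ (22 + (h * 12 + suc k * 14)) (22 + (h * 12 + suc k * 14))
    leaf-wp h k e≡ width {blk = blk} =
      jle refl refl refl (λ ()) λ _ → ops 1 refl
        (relax cost cost (call refl refl 17 A W₁ (Split xs ys (z + s) s) (λ x → x)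
          (λ { refl → out∈W ≤-refl s<e })
          (path-wp R⊆A axs bys la≡ lb≡ sx sy (≤-trans (<⇒≤ s<e) e≤) (out∈A ≤-refl s<e) refl h width)
          (λ { μ′ (i , o≡ , i≤s , xs-ys) same →
            let same′ = ≋-⊆ (λ r → R⊆A r , λ { refl → out∉R ≤-refl s<e r }) same in
            load refl refl (out∈A ≤-refl s<e) o≡ (ops 6 refl
              (emit-wp R⊆A out∈A out∈W out∉R (suc k) ≤-refl e≡
                (trans (cong (λ d → drop d (xs ⋎ ys)) (sym (m+[n∸m]≡n i≤s))) (drop-⋎ xs-ys))
                (remaining xs-ys i≤s)
                (array-drop i (array-resp same′ axs)) (array-drop (s ∸ i) (array-resp same′ bys))
                (end a la≡ xs-ys) (end′ b lb≡ xs-ys)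
                refl refl (λ s≤i i<s → contradiction s≤i (<⇒≱ i<s)))) })))
      where
      W₁ : Region
      W₁ c = c ≡ wordAt (z + s)
      s<e : s < e
      s<e = subst (s <_) (sym e≡) (m<m+n s (s≤s z≤n))
      cost : 2 + (9 + h * 12 + (1 + (6 + (2 + suc k * 14)))) ≤ 20 + (h * 12 + suc k * 14)
      cost = ≤-reflexive (lemma (h * 12) (suc k * 14))
        where
        lemma : ∀ x y → 2 + (9 + x + (1 + (6 + (2 + y)))) ≡ 20 + (x + y)
        lemma = solve-∀
      end : ∀ a {la i xs ys j} → la ≡ length xs → Path xs ys i j → a + la ≡ a + i + length (drop i xs)
      end a {i = i} {xs} refl (path i≤ _ _ _) =
        trans (cong (a +_) (trans (sym (m+[n∸m]≡n i≤)) (cong (i +_) (sym (length-drop i xs)))))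
              (sym (+-assoc a i _))
      end′ : ∀ b {lb i xs ys j} → lb ≡ length ys → Path xs ys i j → b + lb ≡ b + j + length (drop j ys)
      end′ b {ys = ys} {j} refl (path _ j≤ _ _) =
        trans (cong (b +_) (trans (sym (m+[n∸m]≡n j≤)) (cong (j +_) (sym (length-drop j ys)))))
              (sym (+-assoc b j _))
      remaining : ∀ {i} → Path xs ys i (s ∸ i) → i ≤ s →
                  suc k ≤ length (drop i xs) + length (drop (s ∸ i) ys)
      remaining {i} xs-ys i≤s = +-cancelˡ-≤ s _ _ (begin
        s + suc k    ≡⟨ e≡ ⟨
        e            ≤⟨ e≤ ⟩
        la + lb      ≡⟨ cong₂ _+_ la≡ lb≡ ⟩
        length xs + length ys ≡⟨ ⋎-length xs ys ⟨
        length M              ≤⟨ m≤n+m∸n (length M) s ⟩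
        s + (length M ∸ s)    ≡⟨ cong (s +_) (length-drop s M) ⟨
        s + length (drop s M)
          ≡⟨ cong (λ d → s + length (drop d M)) (m+[n∸m]≡n i≤s) ⟨
        s + length (drop (i + (s ∸ i)) M)
          ≡⟨ cong (λ l → s + length l) (drop-⋎ xs-ys) ⟩
        s + length (drop i xs ⋎ drop (s ∸ i) ys)
          ≡⟨ cong (s +_) (⋎-length (drop i xs) (drop (s ∸ i) ys)) ⟩
        s + (length (drop i xs) + length (drop (s ∸ i) ys)) ∎)
        where
        open ≤-Reasoning
        M : List Item
        M = xs ⋎ ys

-- Fork trees for merging and pairing

module Forking (𝓕 : FrequencyDomain) {n : ℕ} (f : Fin n → FrequencyDomain.Freq 𝓕)
  (f≥0 : NonNegative 𝓕 f) where
  open FrequencyDomain 𝓕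
  open Merges 𝓕 f f≥0 public

  Range : (ℕ → Region) → ℕ → ℕ → Region
  Range Wr s e c = Σ[ i ∈ ℕ ] s ≤ i × i < e × Wr i c

  Posts : (ℕ → Store → Set) → ℕ → ℕ → Store → Set
  Posts Post s e μ = ∀ {i} → s ≤ i → i < e → Post i μ

  module _ {R : Region} {Wr : ℕ → Region} {Post : ℕ → Store → Set} {μ : Store} {E : ℕ}
           (Wr#R : ∀ {i c} → Wr i c → ¬ R c)
           (Wr-injective : ∀ {i j c} → Wr i c → Wr j c → i ≡ j)
           (Post-resp : ∀ {i μ μ′} → i < E → μ′ ≋[ R ∪ Wr i ] μ → Post i μ → Post i μ′)
           {c a q lo hi o u la b lb z blk mode : ℕ} {g₀ g₁ : Freq} (1≤blk : 1 ≤ blk)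
    where

    TreeWP : Label → ℕ → ℕ → ℕ → ℕ → ℕ → Set₁
    TreeWP l t s e = WP (R ∪ Range Wr s e) (Range Wr s e) (λ _ μ′ _ _ → Posts Post s e μ′) l
      (c ∷ 1 ∷ a ∷ q ∷ lo ∷ hi ∷ o ∷ t ∷ u ∷ la ∷ b ∷ lb ∷ z ∷ s ∷ e ∷ blk ∷ mode ∷ [])
      (g₀ ∷ g₁ ∷ []) μ

    -- Blocks other than the first are at least half full: this pays for the
    -- search that starts them.
    Full : ℕ → ℕ → Set
    Full s l = s ≡ 0 ⊎ blk ≤ suc l + suc l

    module _ (K sl : ℕ) (leaf : ∀ {s e l t} → e ≡ s + suc l → e ≤ E → suc l ≤ blk → Full s l →
                                TreeWP LEAF t s e (suc l * K) sl) where

      -- Siblings do not interfere: both only read the common region `R`, and they write for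
      -- disjoint sets of indices, hence by `Wr-injective` to disjoint sets of cells. Lengths at
      -- most `2 ^ h` bound the depth of the tree.
      tree-wp : ∀ h {s e l t} → e ≡ s + suc l → e ≤ E → suc l ≤ 2 ^ h → Full s l →
                TreeWP TREE t s e (suc l * (2 + K) + l * 10) (2 + sl + h * 8)

      node-wp : ∀ h {s l} → s + suc l ≤ E → suc l ≤ 2 ^ h → blk < suc l → ∀ {t} →
                TreeWP (2 + TREE) t s (s + suc l) (K + l * (2 + K) + l * 10) (sl + h * 8)
      node-wp zero    _ small blk< = contradiction (≤-trans (s≤s 1≤blk) (≤-trans blk< small)) (n≮n 1)
      node-wp (suc h) {s} {l} e≤E small blk< {t} =
        subst (λ l → TreeWP (2 + TREE) t s (s + suc l) (K + l * (2 + K) + l * 10) (sl + suc h * 8))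
          (sym split)
          (relax (tree-node-work l₁ l₂ K) (tree-node-span sl h)
            (subst (λ e → TreeWP (2 + TREE) t s e work span) (cong (λ l → s + suc l) split)
            (ops 2 refl (fork refl 17
              (R ∪ Range Wr s m) (Range Wr s m) (R ∪ Range Wr m (s + suc l)) (Range Wr m (s + suc l))
              (Posts Post s m) (Posts Post m (s + suc l))
              (λ { (inj₁ r) → inj₁ r ; (inj₂ w) → inj₂ (left⊆ w) })
              (λ { (inj₁ r) → inj₁ r ; (inj₂ w) → inj₂ (right⊆ w) })
              left⊆ right⊆
              (λ { (inj₁ r) (_ , _ , _ , w) → Wr#R w r
                 ; (inj₂ (_ , _ , i<m , w)) (_ , m≤j , _ , w′) →
                     contradiction m≤j (<⇒≱ (subst (_< m) (Wr-injective w w′) i<m)) })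
              (λ { (inj₁ r) (_ , _ , _ , w) → Wr#R w r
                 ; (inj₂ (_ , m≤i , _ , w)) (_ , _ , j<m , w′) →
                     contradiction m≤i (<⇒≱ (subst (_< m) (Wr-injective w′ w) j<m)) })
              (ops 1 refl (jump refl (tree-wp h middle (≤-trans m≤e e≤E) (small₁ h small) (inj₂ big₁))))
              (ops 1 refl (jump refl (tree-wp h e≡ e≤E (small₂ h small) (inj₂ big₂))))
              (λ μ′ p₁ p₂ _ → halt refl λ same {i} s≤i i<e → Post-resp (<-≤-trans i<e e≤E)
                (≋-⊆ (λ { (inj₁ r) → inj₁ r ; (inj₂ w) → inj₂ (i , s≤i , i<e , w) }) same)
                (case i <? m of λ { (yes i<m) → p₁ s≤i i<m ; (no i≮m) → p₂ (≮⇒≥ i≮m) i<e }))))))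
        where
        open Halves (halves s l 1≤blk blk<)
        work span : ℕ
        work = 5 + ((suc l₁ * (2 + K) + l₁ * 10) + (2 + (suc l₂ * (2 + K) + l₂ * 10)) + 1)
        span = 5 + (2 + sl + h * 8 + 1)
        m : ℕ
        m = ⌊ s + (s + suc l) /2⌋
        e≡ : s + suc l ≡ m + suc l₂
        e≡ = trans (cong (λ l → s + suc l) split)
          (trans (cong (s +_) (cong suc (sym (+-suc l₁ l₂))))
            (trans (sym (+-assoc s (suc l₁) (suc l₂))) (cong (_+ suc l₂) (sym middle))))
        m≤e : m ≤ s + suc l
        m≤e = subst (m ≤_) (sym e≡) (m≤m+n m (suc l₂))
        left⊆ : Range Wr s m ⊆ Range Wr s (s + suc l)
        left⊆ (i , s≤i , i<m , w) = i , s≤i , <-≤-trans i<m m≤e , w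
        right⊆ : Range Wr m (s + suc l) ⊆ Range Wr s (s + suc l)
        right⊆ (i , m≤i , i<e , w) =
          i , ≤-trans (subst (s ≤_) (sym middle) (m≤m+n s (suc l₁))) m≤i , i<e , w

      tree-wp h {s} {e} {l} refl e≤E small full = ops 1 refl (jle refl refl refl
        (λ e≤s+blk → relax (tree-leaf-work l K) (m≤m+n sl (h * 8))
          (leaf refl e≤E (+-cancelˡ-≤ s (suc l) blk e≤s+blk) full))
        (λ e≰s+blk → node-wp h e≤E small (+-cancelˡ-< s blk (suc l) (≰⇒> e≰s+blk))))

  -- The bound on `i` is part of the region because `tree-wp` asks for disjointness from `R` at
  -- every index, not only at those of its interval.
  Slot : Address → ℕ → ℕ → Region
  Slot z E i c = i < E × c ≡ wordAt (z + i)

  module _ {R : Region} {μ : Store} {a b z la lb l L : ℕ} {xs ys : List Item}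
           (axs : Array R μ a xs) (bys : Array R μ b ys)
           (la≡ : la ≡ length xs) (lb≡ : lb ≡ length ys) (sx : Sorted xs) (sy : Sorted ys)
           (l< : suc l ≤ la + lb) (la≤ : la ≤ 2 ^ L) (l≤ : suc l ≤ 2 ^ L) (1≤L : 1 ≤ L)
           (out∉R : ∀ {i} → i < suc l → ¬ R (wordAt (z + i))) where

    private
      Zone : ℕ → Region
      Zone = Slot z (suc l)

    -- The output may end before the merge does: a round requests just the two smallest objects, and
    -- later an even prefix of its frontier.
    merge-wp : ∀ {c q lo hi o t u e g₀ g₁} → e ≡ suc l →
      WP (R ∪ Range Zone 0 (suc l)) (Range Zone 0 (suc l))
         (λ _ μ′ _ _ → Outcome (xs ⋎ ys) z 0 (suc l) μ′) TREE
         (c ∷ 1 ∷ a ∷ q ∷ lo ∷ hi ∷ o ∷ t ∷ u ∷ la ∷ b ∷ lb ∷ z ∷ 0 ∷ e ∷ L ∷ 0 ∷ [])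
         (g₀ ∷ g₁ ∷ []) μ (suc l * 84) (L * 70)
    merge-wp refl = relax (merge-work l) (merge-span 1≤L) (weaken-post (λ p {i} s≤i i<e → p s≤i i<e)
      (tree-wp {Post = λ i μ → ∀ {x} → (xs ⋎ ys) ‼ i ≡ just x → words μ (z + i) ≡ proj₁ x}
         (λ { (i<E , refl) → out∉R i<E })
         (λ { (_ , refl) (_ , eq) → +-cancelˡ-≡ z _ _ (wordAt-injective eq) })
         (λ i<E same p eq → trans (onWords same (inj₂ (i<E , refl))) (p eq))
         1≤L 72 (L * 60) block-leaf L refl ≤-refl l≤ (inj₁ refl)))
      where
      block : ∀ {s e k t q lo hi o c u g₀ g₁} h → e ≡ s + suc k → e ≤ suc l →
        (∀ {hi} → hi ≤ s → hi ≤ la → hi < (s ∸ lb) + 2 ^ h) →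
        WP (R ∪ Range Zone s e) (Range Zone s e)
           (λ _ μ′ _ _ → Posts (λ i μ → ∀ {x} → (xs ⋎ ys) ‼ i ≡ just x → words μ (z + i) ≡ proj₁ x) s e μ′) LEAF
           (c ∷ 1 ∷ a ∷ q ∷ lo ∷ hi ∷ o ∷ t ∷ u ∷ la ∷ b ∷ lb ∷ z ∷ s ∷ e ∷ L ∷ 0 ∷ [])
           (g₀ ∷ g₁ ∷ []) μ (22 + (h * 12 + suc k * 14)) (22 + (h * 12 + suc k * 14))
      block {k = k} h e≡ e≤ width = weaken-post (λ p {i} s≤i i<e → p s≤i i<e)
        (leaf-wp inj₁
          (λ s≤i i<e → inj₂ (_ , s≤i , i<e , <-≤-trans i<e e≤ , refl))
          (λ s≤i i<e → _ , s≤i , i<e , <-≤-trans i<e e≤ , refl)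
          (λ _ i<e → out∉R (<-≤-trans i<e e≤))
          axs bys la≡ lb≡ sx sy (≤-trans e≤ l<) h k e≡ width)

      block-leaf : ∀ {s e k t q lo hi o c u g₀ g₁} → e ≡ s + suc k → e ≤ suc l → suc k ≤ L →
        s ≡ 0 ⊎ L ≤ suc k + suc k →
        WP (R ∪ Range Zone s e) (Range Zone s e)
           (λ _ μ′ _ _ → Posts (λ i μ → ∀ {x} → (xs ⋎ ys) ‼ i ≡ just x → words μ (z + i) ≡ proj₁ x) s e μ′) LEAF
           (c ∷ 1 ∷ a ∷ q ∷ lo ∷ hi ∷ o ∷ t ∷ u ∷ la ∷ b ∷ lb ∷ z ∷ s ∷ e ∷ L ∷ 0 ∷ [])
           (g₀ ∷ g₁ ∷ []) μ (suc k * 72) (L * 60)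
      block-leaf {k = k} e≡ e≤ k<L (inj₁ refl) =
        relax (merge-leaf-first k)
              (≤-trans (+-monoʳ-≤ 22 (m≤n+m (suc k * 14) (suc L * 12))) (merge-leaf-span k k<L))
          (block {k = k} 0 e≡ e≤ (λ {hi} hi≤0 _ →
            ≤-trans (s≤s hi≤0) (m≤n+m 1 (0 ∸ lb))))
      block-leaf {s} {k = k} e≡ e≤ k<L (inj₂ L≤) =
        relax (merge-leaf-other k L≤) (merge-leaf-span k k<L)
          (block {k = k} (suc L) e≡ e≤ (λ _ hi≤la → n<2^[1+L]+m {m = s ∸ lb} L (≤-trans hi≤la la≤)))

  -- The first new node is at a, and the queue ends at b.
  NodeCells : Address → Address → ℕ → Region
  NodeCells a b i (wordAt x) = x ≡ b + i ⊎ x ≡ a + (i + i) ⊎ x ≡ suc (a + (i + i))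
  NodeCells a b i (freqAt x) = x ≡ a + (i + i)

  NewNode : List (Item × Item) → Address → Address → ℕ → Store → Set
  NewNode ps a b i μ = ∀ {x y} → ps ‼ i ≡ just (x , y) →
    words μ (b + i) ≡ a + (i + i) × words μ (a + (i + i)) ≡ proj₁ x ×
    words μ (suc (a + (i + i))) ≡ proj₁ y × freqs μ (a + (i + i)) ≡ weight (x , y)

  module _ {R : Region} {μ : Store} {a b z l L : ℕ} {ps : List (Item × Item)}
           (inputs : ∀ {i x y} → ps ‼ i ≡ just (x , y) →
                     Entry R μ (z + (i + i)) x × Entry R μ (suc (z + (i + i))) y)
           (l≡ : length ps ≡ suc l) (l≤ : suc l ≤ 2 ^ L) (1≤L : 1 ≤ L) (apart : b + suc l ≤ a)
           (out∉R : ∀ {i c} → i < suc l → NodeCells a b i c → ¬ R c) where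

    private
      Zone : ℕ → Region
      Zone i c = i < suc l × NodeCells a b i c

      slot<node : ∀ {i j} → i < suc l → b + i < a + j
      slot<node {i} {j} i< = <-≤-trans (+-monoʳ-< b i<) (≤-trans apart (m≤m+n a j))

      double-injective : ∀ {i j} → i + i ≡ j + j → i ≡ j
      double-injective {i} {j} eq = ≤-antisym
        (double-cancel-≤ (≤-trans (≤-reflexive eq) (n≤1+n _)))
        (double-cancel-≤ (≤-trans (≤-reflexive (sym eq)) (n≤1+n _)))

      double≢1+double : ∀ i j → i + i ≢ suc (j + j)
      double≢1+double i j eq = even≢odd i j
        (trans (cong (i +_) (+-identityʳ i))
          (trans eq (cong (λ k → suc (j + k)) (sym (+-identityʳ j)))))

      -- Queue slots lie below the nodes by `apart`, and the two words of a node have offsets of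
      -- different parity.
      injective : ∀ {i j c} → Zone i c → Zone j c → i ≡ j
      injective {c = wordAt _} (_ , inj₁ refl)        (_ , inj₁ eq)         = +-cancelˡ-≡ b _ _ eq
      injective {c = wordAt _} (i< , inj₁ refl)       (_ , inj₂ (inj₁ eq))  =
        contradiction eq (<⇒≢ (slot<node i<))
      injective {c = wordAt _} (i< , inj₁ refl)       (_ , inj₂ (inj₂ eq))  =
        contradiction eq (<⇒≢ (m<n⇒m<1+n (slot<node i<)))
      injective {c = wordAt _} (_ , inj₂ (inj₁ refl)) (j< , inj₁ eq)        =
        contradiction (sym eq) (<⇒≢ (slot<node j<))
      injective {c = wordAt _} (_ , inj₂ (inj₁ refl)) (_ , inj₂ (inj₁ eq))  =
        double-injective (+-cancelˡ-≡ a _ _ eq)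
      injective {i} {j} {wordAt _} (_ , inj₂ (inj₁ refl)) (_ , inj₂ (inj₂ eq)) =
        contradiction (+-cancelˡ-≡ a _ _ (trans eq (sym (+-suc a (j + j))))) (double≢1+double i j)
      injective {c = wordAt _} (_ , inj₂ (inj₂ refl)) (j< , inj₁ eq)        =
        contradiction (sym eq) (<⇒≢ (m<n⇒m<1+n (slot<node j<)))
      injective {i} {j} {wordAt _} (_ , inj₂ (inj₂ refl)) (_ , inj₂ (inj₁ eq)) =
        contradiction (+-cancelˡ-≡ a _ _ (trans (sym eq) (sym (+-suc a (i + i))))) (double≢1+double j i)
      injective {c = wordAt _} (_ , inj₂ (inj₂ refl)) (_ , inj₂ (inj₂ eq))  =
        double-injective (+-cancelˡ-≡ a _ _ (suc-injective eq))
      injective {c = freqAt _} (_ , refl)             (_ , eq)              =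
        double-injective (+-cancelˡ-≡ a _ _ eq)

    pair-wp : ∀ {c q lo hi o t u la lb e g₀ g₁} → e ≡ suc l →
      WP (R ∪ Range Zone 0 (suc l)) (Range Zone 0 (suc l))
         (λ _ μ′ _ _ → Posts (NewNode ps a b) 0 (suc l) μ′) TREE
         (c ∷ 1 ∷ a ∷ q ∷ lo ∷ hi ∷ o ∷ t ∷ u ∷ la ∷ b ∷ lb ∷ z ∷ 0 ∷ e ∷ 1 ∷ 1 ∷ [])
         (g₀ ∷ g₁ ∷ []) μ (suc l * 29) (L * 27)
    pair-wp refl = relax (pair-work l) (pair-span 1≤L)
      (tree-wp {Wr = Zone} {Post = NewNode ps a b} (λ { (i< , w) → out∉R i< w }) injective new-node-resp
         (s≤s z≤n) 17 17 pair-leaf L refl ≤-refl l≤ (inj₁ refl))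
      where
      new-node-resp : ∀ {i μ μ′} → i < suc l → μ′ ≋[ R ∪ Zone i ] μ → NewNode ps a b i μ → NewNode ps a b i μ′
      new-node-resp i< same p eq = let slot , child₁ , child₂ , sum = p eq in
        trans (onWords same (inj₂ (i< , inj₁ refl))) slot ,
        trans (onWords same (inj₂ (i< , inj₂ (inj₁ refl)))) child₁ ,
        trans (onWords same (inj₂ (i< , inj₂ (inj₂ refl)))) child₂ ,
        trans (onFreqs same (inj₂ (i< , refl))) sum

      pair-leaf : ∀ {s e k t q lo hi o c u la lb g₀ g₁} → e ≡ s + suc k → e ≤ suc l → suc k ≤ 1 →
        s ≡ 0 ⊎ 1 ≤ suc k + suc k →
        WP (R ∪ Range Zone s e) (Range Zone s e) (λ _ μ′ _ _ → Posts (NewNode ps a b) s e μ′) LEAF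
           (c ∷ 1 ∷ a ∷ q ∷ lo ∷ hi ∷ o ∷ t ∷ u ∷ la ∷ b ∷ lb ∷ z ∷ s ∷ e ∷ 1 ∷ 1 ∷ [])
           (g₀ ∷ g₁ ∷ []) μ (suc k * 17) 17
      pair-leaf {s} {k = suc k} _ _ (s≤s ())
      pair-leaf {s} {k = zero} refl e≤ _ _
        with ‼-< ps {s} (subst (s <_) (sym l≡) (subst (_≤ suc l) (+-comm s 1) e≤))
      ... | (x , y) , eq with inputs eq
      ... | x∈ , y∈ =
        jle refl refl refl
          (λ _ → ops 3 refl (store refl refl refl (mine (inj₁ refl))
            (ops 1 refl (load refl refl (inj₁ (readable x∈)) (trans (onWords same₁ (readable x∈)) (word≡ x∈))
            (store refl refl refl (mine (inj₂ (inj₁ refl)))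
            (fload refl refl (inj₁ (keyed (isObject x∈))) (key≡ (isObject x∈))
            (ops 1 refl (load refl refl (inj₁ (readable y∈)) (trans (onWords same₂ (readable y∈)) (word≡ y∈))
            (fload refl refl (inj₁ (keyed (isObject y∈))) (key≡ (isObject y∈))
            (ops 1 refl (fstore refl refl refl (mine refl)
            (ops 1 refl (store refl refl refl (mine (inj₂ (inj₂ refl)))
            (halt refl done))))))))))))))
          (λ 1≰1 → contradiction ≤-refl 1≰1)
        where
        s< : s < suc l
        s< = subst (_≤ suc l) (+-comm s 1) e≤
        mine : ∀ {c} → NodeCells a b s c → Range Zone s (s + 1) c
        mine w = s , ≤-refl , m<m+n s (s≤s z≤n) , s< , w
        u : ℕ
        u = a + (s + s)
        m₁ m₂ m₃ : Address → ℕ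
        m₁ = words μ [ b + s ≔ u ]
        m₂ = m₁ [ u ≔ proj₁ x ]
        m₃ = m₂ [ suc u ≔ proj₁ y ]
        same₁ : ⟨ m₁ , freqs μ ⟩ ≋[ R ] μ
        same₁ = store-word μ (b + s) u (out∉R s< (inj₁ refl))
        same₂ : ⟨ m₂ , freqs μ ⟩ ≋[ R ] μ
        same₂ = ≋-trans (store-word ⟨ m₁ , freqs μ ⟩ u (proj₁ x) (out∉R s< (inj₂ (inj₁ refl)))) same₁
        done : ∀ {μ′} → μ′ ≋[ R ∪ Range Zone s (s + 1) ] ⟨ m₃ , freqs μ [ u ≔ weight (x , y) ] ⟩ →
               Posts (NewNode ps a b) s (s + 1) μ′
        done same {i} s≤i i< eq′
          with refl ← ≤-antisym (≤-pred (subst (i <_) (+-comm s 1) i<)) s≤i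
          with refl ← trans (sym eq) eq′ =
          trans (onWords same (inj₂ (mine (inj₁ refl))))
            (trans (≔-other m₂ (<⇒≢ (m<n⇒m<1+n (slot<node s<))))
              (trans (≔-other m₁ (<⇒≢ (slot<node s<))) (≔-same (words μ) (b + s)))) ,
          trans (onWords same (inj₂ (mine (inj₂ (inj₁ refl)))))
            (trans (≔-other m₂ {j = u} (λ u≡ → 1+n≢n (sym u≡))) (≔-same m₁ u)) ,
          trans (onWords same (inj₂ (mine (inj₂ (inj₂ refl))))) (≔-same m₂ (suc u)) ,
          trans (onFreqs same (inj₂ (mine refl))) (≔-same (freqs μ) u)

-- Merge sort

module Sorting (𝓕 : FrequencyDomain) {n : ℕ} (f : Fin n → FrequencyDomain.Freq 𝓕)
  (f≥0 : NonNegative 𝓕 f) where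
  open FrequencyDomain 𝓕
  open Forking 𝓕 f f≥0 public

  Leaves : Region
  Leaves (wordAt _) = ⊥
  Leaves (freqAt x) = x < n

  Words : Address → Address → Region
  Words p q (wordAt x) = p ≤ x × x < q
  Words p q (freqAt _) = ⊥

  Block : Address → Address → ℕ → ℕ → Region
  Block dst src s e = Words (dst + s) (dst + e) ∪ Words (src + s) (src + e)

  Apart : Address → Address → Set
  Apart dst src = dst + n ≤ src ⊎ src + n ≤ dst

  words-split : ∀ {d s m m′ e} → m ≤ m′ → Disjoint (Words (d + s) (d + m)) (Words (d + m′) (d + e))
  words-split {d} m≤m′ {wordAt x} (_ , x<) (≤x , _) =
    <⇒≱ x< (≤-trans (+-monoʳ-≤ d m≤m′) ≤x)

  ordered-words-apart : ∀ {d d′ s e s′ e′} → d + n ≤ d′ → e ≤ n →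
                Disjoint (Words (d + s) (d + e)) (Words (d′ + s′) (d′ + e′))
  ordered-words-apart {d} {d′} {s′ = s′} d≤d′ e≤n {wordAt x} (_ , x<) (≤x , _) =
    <⇒≱ x< (≤-trans (+-monoʳ-≤ d e≤n) (≤-trans d≤d′ (≤-trans (m≤m+n d′ s′) ≤x)))

  words-apart : ∀ {d d′ s e s′ e′} → Apart d d′ → e ≤ n → e′ ≤ n →
                 Disjoint (Words (d + s) (d + e)) (Words (d′ + s′) (d′ + e′))
  words-apart (inj₁ d≤d′) e≤n e′≤n w w′ = ordered-words-apart d≤d′ e≤n w w′
  words-apart (inj₂ d′≤d) e≤n e′≤n w w′ = ordered-words-apart d′≤d e′≤n w′ w

  words-⊆ : ∀ {d s e s′ e′} → s′ ≤ s → e ≤ e′ → Words (d + s) (d + e) ⊆ Words (d + s′) (d + e′)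
  words-⊆ {d} s′≤s e≤e′ {wordAt x} (≤x , x<) =
    ≤-trans (+-monoʳ-≤ d s′≤s) ≤x , <-≤-trans x< (+-monoʳ-≤ d e≤e′)

  record SortedAt (zs : List Item) (p : Address) (μ : Store) : Set where
    constructor sortedAt
    field
      {sorted-list} : List Item
      permutation   : sorted-list ↭ zs
      is-sorted     : Sorted sorted-list
      contents      : ∀ {i x} → sorted-list ‼ i ≡ just x → words μ (p + i) ≡ proj₁ x

  make-array : ∀ {R μ p xs} → (∀ {i x} → xs ‼ i ≡ just x → words μ (p + i) ≡ proj₁ x) →
    (∀ {i} → i < length xs → R (wordAt (p + i))) → All (Object R μ) xs → Array R μ p xs
  make-array {xs = xs} contents readable objects = array λ eq →
    entry (readable (‼-bound xs eq)) (contents eq) (All.lookup objects (‼⇒∈ xs eq))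

  Numbered : ℕ → List Item → Set
  Numbered s zs = ∀ {i x} → zs ‼ i ≡ just x → proj₁ x ≡ s + i

  module _ {L : ℕ} (1≤L : 1 ≤ L) (n≤2^L : n ≤ 2 ^ L) where

    -- A thread owns the positions from `s` to `e` in both buffers, so siblings are disjoint even
    -- though their levels exchange the buffers. Only pointers move: the base case writes its index
    -- `s`, which is the pointer to that input object, and frequencies are only read.
    sort-wp : ∀ h {s l e dst src zs μ} → e ≡ s + suc l → e ≤ n → suc l ≤ 2 ^ h → Apart dst src →
      length zs ≡ suc l → Numbered s zs → All (Object Leaves μ) zs →
      ∀ {c a q lo hi o t u la b lb z g₀ g₁} →
      WP (Leaves ∪ Block dst src s e) (Block dst src s e) (λ _ μ′ _ _ → SortedAt zs (dst + s) μ′) SORT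
         (c ∷ 1 ∷ a ∷ q ∷ lo ∷ hi ∷ o ∷ t ∷ u ∷ la ∷ b ∷ lb ∷ z ∷ s ∷ e ∷ L ∷ 0 ∷ dst ∷ src ∷ [])
         (g₀ ∷ g₁ ∷ []) μ (suc h * (suc l * 106)) (suc h * (L * 90))
    sort-wp h {s} {zero} {dst = dst} {zs = x ∷ []} {μ} refl e≤n small apart refl numbered objects =
      relax (sort-base-work h) (sort-base-span h 1≤L) (ops 1 refl (jle refl refl refl
        (λ _ → ops 1 refl (store refl refl refl (inj₁ (≤-refl , +-monoʳ-< dst (m<m+n s (s≤s z≤n))))
          (halt refl λ {μ′} same → sortedAt ↭-refl ([] ∷ []) λ { {zero} refl →
            trans (cong (words μ′) (+-identityʳ (dst + s)))
              (trans (onWords same (inj₂ (inj₁ (≤-refl , +-monoʳ-< dst (m<m+n s (s≤s z≤n))))))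
                (trans (≔-same (words μ) (dst + s)) (sym (trans (numbered {0} refl) (+-identityʳ s))))) })))
        (λ e≰ → contradiction (≤-reflexive (+-comm s 1)) e≰)))
    sort-wp zero    {l = suc l} _ _ (s≤s ())
    sort-wp (suc h) {s} {suc l} {dst = dst} {src} {zs} {μ} refl e≤n small apart len numbered objects
      {c} {t = t} {u} {g₀ = g₀} {g₁} =
      relax (subst (λ k → 8 + (2 + suc h * (suc l₁ * 106) + (2 + suc h * (suc l₂ * 106)) +
                                (9 + (suc (suc (l₁ + l₂)) * 84 + 1))) ≤ suc (suc h) * (suc k * 106))
               (sym {x = suc l} {suc (l₁ + l₂)} split) (sort-node-work h l₁ l₂))
        (sort-node-span h 1≤L) (ops 1 refl (jle refl refl refl
        (λ e≤1+s → contradiction (subst (s + suc (suc l) ≤_) (+-comm 1 s) e≤1+s)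
          (λ p → n≮n 1 (≤-trans (s≤s (s≤s z≤n)) (+-cancelˡ-≤ s (suc (suc l)) 1 p))))
        (λ _ → ops 5 refl (fork refl 19
          (Leaves ∪ Block src dst s m) (Block src dst s m)
          (Leaves ∪ Block src dst m e) (Block src dst m e)
          (SortedAt zs₁ (src + s)) (SortedAt zs₂ (src + m))
          [ inj₁ , inj₂ ∘ left⊆ ]′ [ inj₁ , inj₂ ∘ right⊆ ]′ left⊆ right⊆
          (λ { {freqAt _} _ (inj₁ ()) ; {freqAt _} _ (inj₂ ())
             ; {wordAt _} (inj₂ p) q → left#right p q })
          (λ { {freqAt _} _ (inj₁ ()) ; {freqAt _} _ (inj₂ ())
             ; {wordAt _} (inj₂ q) p → left#right p q })
          (ops 1 refl (jump refl (sort-wp h middle (≤-trans m≤e e≤n) (small₁ h small) (swap apart)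
            len₁ numbered₁ (All.take⁺ (suc l₁) objects))))
          (ops 1 refl (jump refl (sort-wp h e≡ e≤n (small₂ h small) (swap apart)
            len₂ numbered₂ (All.drop⁺ (suc l₁) objects))))
          (λ μ′ p₁ p₂ same → merged μ′ p₁ p₂ same)))))
      where
      open Halves (halves s (suc l) {1} ≤-refl (s≤s (s≤s z≤n)))
      e m : ℕ
      e = s + suc (suc l)
      m = ⌊ s + e /2⌋
      e≡ : e ≡ m + suc l₂
      e≡ = trans (cong (λ l → s + suc l) split)
        (trans (cong (s +_) (cong suc (sym (+-suc l₁ l₂))))
          (trans (sym (+-assoc s (suc l₁) (suc l₂))) (cong (_+ suc l₂) (sym middle))))
      m≤e : m ≤ e
      m≤e = subst (m ≤_) (sym e≡) (m≤m+n m (suc l₂))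
      s≤m : s ≤ m
      s≤m = subst (s ≤_) (sym middle) (m≤m+n s (suc l₁))
      zs₁ zs₂ : List Item
      zs₁ = take (suc l₁) zs
      zs₂ = drop (suc l₁) zs
      len₁ : length zs₁ ≡ suc l₁
      len₁ = trans (length-take (suc l₁) zs) (m≤n⇒m⊓n≡m
        (≤-trans (s≤s (m≤m+n l₁ l₂)) (≤-trans (n≤1+n _) (≤-reflexive (sym (trans len (cong suc split)))))))
      len₂ : length zs₂ ≡ suc l₂
      len₂ = trans (length-drop (suc l₁) zs)
        (trans (cong (_∸ suc l₁) (trans len (cong suc (trans split (sym (+-suc l₁ l₂))))))
               (m+n∸m≡n (suc l₁) (suc l₂)))
      numbered₁ : Numbered s zs₁
      numbered₁ eq = numbered (proj₂ (‼-take (suc l₁) zs eq))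
      numbered₂ : Numbered m zs₂
      numbered₂ {i} eq = trans (numbered (trans (sym (‼-drop (suc l₁) zs i)) eq))
        (trans (sym (+-assoc s (suc l₁) i)) (cong (_+ i) (sym middle)))
      left⊆ : Block src dst s m ⊆ Block dst src s e
      left⊆ {wordAt _} = [ inj₂ ∘ words-⊆ ≤-refl m≤e , inj₁ ∘ words-⊆ ≤-refl m≤e ]′
      left⊆ {freqAt _} (inj₁ ())
      left⊆ {freqAt _} (inj₂ ())
      right⊆ : Block src dst m e ⊆ Block dst src s e
      right⊆ {wordAt _} = [ inj₂ ∘ words-⊆ s≤m ≤-refl , inj₁ ∘ words-⊆ s≤m ≤-refl ]′
      right⊆ {freqAt _} (inj₁ ())
      right⊆ {freqAt _} (inj₂ ())
      left#right : Disjoint (Block src dst s m) (Block src dst m e)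
      left#right (inj₁ p) (inj₁ q) = words-split {src} {s} {m} {m} {e} ≤-refl p q
      left#right (inj₁ p) (inj₂ q) = words-apart (swap apart) (≤-trans m≤e e≤n) e≤n p q
      left#right (inj₂ p) (inj₁ q) = words-apart apart (≤-trans m≤e e≤n) e≤n p q
      left#right (inj₂ p) (inj₂ q) = words-split {dst} {s} {m} {m} {e} ≤-refl p q

      merged : ∀ μ′ → SortedAt zs₁ (src + s) μ′ → SortedAt zs₂ (src + m) μ′ →
        μ′ ≋[ (Leaves ∪ Block dst src s e) ∖ Block src dst s m ∖ Block src dst m e ] μ →
        ∀ {a q lo hi o la b lb z} →
        WP (Leaves ∪ Block dst src s e) (Block dst src s e) (λ _ μ′ _ _ → SortedAt zs (dst + s) μ′)
           (8 + SORT)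
           (c ∷ 1 ∷ a ∷ q ∷ lo ∷ hi ∷ o ∷ m ∷ dst ∷ la ∷ b ∷ lb ∷ z ∷ s ∷ e ∷ L ∷ 0 ∷ src ∷ dst ∷ [])
           (g₀ ∷ g₁ ∷ []) μ′ (9 + (suc (suc (l₁ + l₂)) * 84 + 1)) (9 + (L * 70 + 1))
      merged μ′ (sortedAt {xs} xs↭ sx xs≡) (sortedAt {ys} ys↭ sy ys≡) same =
        -- Cutting the list of registers behind `%mode` hides `%dst` and `%src`, so that the sort
        -- and the main loop can share `merge-wp`.
        ops 7 refl (call refl refl 17 (R ∪ Range (Slot (dst + s) (suc l′)) 0 (suc l′))
          (Range (Slot (dst + s) (suc l′)) 0 (suc l′)) (Outcome (xs ⋎ ys) (dst + s) 0 (suc l′))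
          [ R⊆ , inj₂ ∘ zone⊆ ]′ zone⊆
          (merge-wp
            (make-array xs≡ (λ {i} i< → inj₂ (m≤m+n (src + s) i ,
                subst (_< src + e) (sym (+-assoc src s i))
                  (+-monoʳ-< src (<-≤-trans (+-monoʳ-< s (subst (i <_) length-xs i<))
                    (subst (_≤ e) middle m≤e)))))
              (All-resp-↭ (↭-sym xs↭) (All.take⁺ (suc l₁) objects′)))
            (make-array ys≡ (λ {i} i< → inj₂ (≤-trans (+-monoʳ-≤ src s≤m) (m≤m+n (src + m) i) ,
                subst (_< src + e) (sym (+-assoc src m i))
                  (+-monoʳ-< src (subst (m + i <_) (sym e≡) (+-monoʳ-< m (subst (i <_) length-ys i<))))))
              (All-resp-↭ (↭-sym ys↭) (All.drop⁺ (suc l₁) objects′)))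
            la≡ lb≡ sx sy
            (≤-reflexive (trans (cong suc (sym (+-suc l₁ l₂)))
               (sym (cong₂ _+_ (trans la≡ length-xs) (trans lb≡ length-ys)))))
            (≤-trans (m∸n≤m m s) (≤-trans m≤e (≤-trans e≤n n≤2^L))) (≤-trans l′≤n n≤2^L) 1≤L
            (λ i< → λ { (inj₂ p) → words-apart apart e≤n e≤n (slot i<) p })
            (trans (m+n∸m≡n s (suc (suc l))) (cong suc split)))
          (λ μ″ out _ → halt refl λ same″ → sortedAt
            (↭-trans (⋎-↭ xs ys) (↭-trans (++⁺ xs↭ ys↭) (↭-reflexive (take++drop≡id (suc l₁) zs))))
            (⋎-sorted sx sy)
            (λ {i} eq → trans (onWords same″ (inj₂ (inj₁ (slot (in-range eq))))) (out z≤n (in-range eq) eq))))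
        where
        l′ : ℕ
        l′ = suc (l₁ + l₂)
        R : Region
        R = Leaves ∪ Words (src + s) (src + e)
        e≡s+l′ : e ≡ s + suc l′
        e≡s+l′ = cong (λ l → s + suc l) split
        l′≤n : suc l′ ≤ n
        l′≤n = ≤-trans (m≤n+m (suc l′) s) (subst (_≤ n) e≡s+l′ e≤n)
        slot : ∀ {i} → i < suc l′ → Words (dst + s) (dst + e) (wordAt (dst + s + i))
        slot {i} i< = m≤m+n (dst + s) i , subst₂ _<_ (sym (+-assoc dst s i)) (cong (dst +_) (sym e≡s+l′))
                                            (+-monoʳ-< dst (+-monoʳ-< s i<))
        R⊆ : R ⊆ Leaves ∪ Block dst src s e
        R⊆ = [ inj₁ , inj₂ ∘ inj₂ ]′
        zone⊆ : Range (Slot (dst + s) (suc l′)) 0 (suc l′) ⊆ Block dst src s e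
        zone⊆ (i , _ , _ , i< , refl) = inj₁ (slot i<)
        objects′ : All (Object R μ′) zs
        objects′ = All.map (object-⊆ inj₁ ∘ object-resp (≋-⊆ (λ { {wordAt _} () ; {freqAt _} l →
          (inj₁ l , λ { (inj₁ ()) ; (inj₂ ()) }) , λ { (inj₁ ()) ; (inj₂ ()) } }) same)) objects
        length-xs : length xs ≡ suc l₁
        length-xs = trans (↭-length xs↭) len₁
        length-ys : length ys ≡ suc l₂
        length-ys = trans (↭-length ys↭) len₂
        la≡ : m ∸ s ≡ length xs
        la≡ = trans (cong (_∸ s) middle) (trans (m+n∸m≡n s (suc l₁)) (sym length-xs))
        lb≡ : e ∸ m ≡ length ys
        lb≡ = trans (cong (_∸ m) e≡) (trans (m+n∸m≡n m (suc l₂)) (sym length-ys))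
        in-range : ∀ {i x} → (xs ⋎ ys) ‼ i ≡ just x → i < suc l′
        in-range {i} eq = subst (i <_) (trans (⋎-length xs ys)
          (trans (cong₂ _+_ length-xs length-ys) (cong suc (+-suc l₁ l₂)))) (‼-bound (xs ⋎ ys) eq)

-- Rounds in memory

drop-++ˡ : ∀ {A : Set} i (xs : List A) {ys} → i ≤ length xs → drop i (xs ++ ys) ≡ drop i xs ++ ys
drop-++ˡ zero    xs       _         = refl
drop-++ˡ (suc i) (x ∷ xs) (s≤s i≤) = drop-++ˡ i xs i≤

‼-++ : ∀ {A : Set} (xs : List A) {ys i x} → (xs ++ ys) ‼ i ≡ just x →
       xs ‼ i ≡ just x ⊎ Σ[ j ∈ ℕ ] i ≡ length xs + j × ys ‼ j ≡ just x
‼-++ []       {i = i}     eq = inj₂ (i , refl , eq)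
‼-++ (x ∷ xs) {i = zero}  eq = inj₁ eq
‼-++ (x ∷ xs) {i = suc i} eq with ‼-++ xs eq
... | inj₁ eq′           = inj₁ eq′
... | inj₂ (j , eq′ , p) = inj₂ (j , cong suc eq′ , p)

module Rounds (𝓕 : FrequencyDomain) {n : ℕ} (f : Fin n → FrequencyDomain.Freq 𝓕)
  (f≥0 : NonNegative 𝓕 f) (2≤n : 2 ≤ n) where
  open FrequencyDomain 𝓕
  open Sorting 𝓕 f f≥0 public
  open Huffman 𝓕 f

  array-objects : ∀ {R μ a xs} → Array R μ a xs → All (Object R μ) xs
  array-objects xs∈ = All.tabulate λ x∈ → isObject (at xs∈ (proj₂ (∈⇒‼ x∈)))

  array-++ : ∀ {R μ a b xs ys} → a + length xs ≡ b → Array R μ a xs → Array R μ b ys →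
             Array R μ a (xs ++ ys)
  array-++ {R} {μ} {a} {xs = xs} refl xs∈ ys∈ = array λ {i} {x} eq → case ‼-++ xs eq of λ where
    (inj₁ eq′)              → at xs∈ eq′
    (inj₂ (j , refl , eq′)) → subst (λ b → Entry R μ b x) (+-assoc a (length xs) j) (at ys∈ eq′)

  ‼-nodes : ∀ v ps {i x} → nodes v ps ‼ i ≡ just x →
    Σ[ p ∈ Item ] Σ[ q ∈ Item ] ps ‼ i ≡ just (p , q) × x ≡ (v + (i + i) , node (tree p) (tree q))
  ‼-nodes v ((p , q) ∷ ps) {zero}  refl =
    p , q , refl , cong (_, node (tree p) (tree q)) (sym (+-identityʳ v))
  ‼-nodes v (_ ∷ ps)       {suc i} eq with ‼-nodes (2 + v) ps eq
  ... | p , q , eq′ , refl = p , q , eq′ , cong (_, node (tree p) (tree q)) (shift-index v i)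
    where
    shift-index : ∀ v i → 2 + v + (i + i) ≡ v + (suc i + suc i)
    shift-index = solve-∀

  output nodes-base : Address
  output     = n + n + n
  nodes-base = n + n + n + n

  -- The cells in use after t merges.
  Live : ℕ → Region
  Live t (wordAt x) = (n ≤ x × x < n + n + t) ⊎ (nodes-base ≤ x × x < nodes-base + (t + t))
  Live t (freqAt x) = x < n ⊎ (nodes-base ≤ x × x < nodes-base + (t + t))

  live-⊆ : ∀ {t t′} → t ≤ t′ → Live t ⊆ Live t′
  live-⊆ t≤ {wordAt x} (inj₁ (p , q)) = inj₁ (p , <-≤-trans q (+-monoʳ-≤ (n + n) t≤))
  live-⊆ t≤ {wordAt x} (inj₂ (p , q)) = inj₂ (p , <-≤-trans q (+-monoʳ-≤ nodes-base (t≤ ⊕ t≤)))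
  live-⊆ t≤ {freqAt x} (inj₁ p)       = inj₁ p
  live-⊆ t≤ {freqAt x} (inj₂ (p , q)) = inj₂ (p , <-≤-trans q (+-monoʳ-≤ nodes-base (t≤ ⊕ t≤)))

  module _ {t : ℕ} (t≤n : t ≤ n) where

    output∉live : ∀ {i} → i < n → ¬ Live t (wordAt (output + i))
    output∉live {i} i<n (inj₁ (_ , q)) =
      <⇒≱ q (≤-trans (+-monoʳ-≤ (n + n) t≤n) (m≤m+n output i))
    output∉live {i} i<n (inj₂ (p , _)) = <⇒≱ i<n (+-cancelˡ-≤ output n i p)

    scratch∉live : ¬ Live t (wordAt 0)
    scratch∉live (inj₁ (p , _)) = <⇒≱ (≤-trans (s≤s z≤n) 2≤n) p
    scratch∉live (inj₂ (p , _)) = <⇒≱ (≤-trans (s≤s z≤n) 2≤n) (≤-trans (m≤n+m n output) p)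

    output≢0 : ∀ {j} → wordAt (output + j) ≢ wordAt 0
    output≢0 {j} eq = <⇒≱ 2≤n (subst (_≤ 1) (sym n≡0) z≤n)
      where
      n≡0 : n ≡ 0
      n≡0 = m+n≡0⇒n≡0 (n + n) (m+n≡0⇒m≡0 output (wordAt-injective eq))

    slot<output : ∀ {i k} → t + k ≤ n → i < k → n + n + t + i < output
    slot<output {i} {k} t+k≤n i<k = <-≤-trans (+-monoʳ-< (n + n + t) i<k)
      (≤-trans (≤-reflexive (+-assoc (n + n) t k)) (+-monoʳ-≤ (n + n) t+k≤n))

    new∉live : ∀ {i k v ye} → v ≡ nodes-base + (t + t) → ye ≡ n + n + t → t + k ≤ n → i < k →
      ∀ {c} → NodeCells v ye i c → ¬ Live t c
    new∉live {i} refl refl _ _ {wordAt _} (inj₁ refl) (inj₁ (_ , q)) = <⇒≱ q (m≤m+n (n + n + t) i)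
    new∉live {i} refl refl t+k≤n i<k {wordAt _} (inj₁ refl) (inj₂ (p , _)) =
      <⇒≱ (slot<output t+k≤n i<k) (≤-trans (m≤m+n output n) p)
    new∉live {i} refl refl _ _ {wordAt _} (inj₂ w) (inj₁ (_ , q)) = <⇒≱ q
      (≤-trans (+-monoʳ-≤ (n + n) t≤n) (≤-trans (m≤m+n output n) (≤-trans (m≤m+n nodes-base (t + t)) (node≤ w))))
      where
      node≤ : ∀ {x} → x ≡ nodes-base + (t + t) + (i + i) ⊎ x ≡ suc (nodes-base + (t + t) + (i + i)) →
              nodes-base + (t + t) ≤ x
      node≤ (inj₁ refl) = m≤m+n _ (i + i)
      node≤ (inj₂ refl) = ≤-trans (m≤m+n _ (i + i)) (n≤1+n _)
    new∉live {i} refl refl _ _ {wordAt _} (inj₂ (inj₁ refl)) (inj₂ (_ , q)) = <⇒≱ q (m≤m+n _ (i + i))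
    new∉live {i} refl refl _ _ {wordAt _} (inj₂ (inj₂ refl)) (inj₂ (_ , q)) =
      <⇒≱ q (≤-trans (m≤m+n _ (i + i)) (n≤1+n _))
    new∉live {i} refl refl _ _ {freqAt _} refl (inj₁ q) =
      <⇒≱ q (≤-trans (m≤n+m n output) (≤-trans (m≤m+n nodes-base (t + t)) (m≤m+n _ (i + i))))
    new∉live {i} refl refl _ _ {freqAt _} refl (inj₂ (_ , q)) = <⇒≱ q (m≤m+n _ (i + i))

    new∉output : ∀ {i k v ye} → v ≡ nodes-base + (t + t) → ye ≡ n + n + t → t + k ≤ n → i < k →
      ∀ {c} → NodeCells v ye i c → ¬ Words output nodes-base c
    new∉output refl refl t+k≤n i<k {wordAt _} (inj₁ refl) (p , _) = <⇒≱ (slot<output t+k≤n i<k) p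
    new∉output {i} refl refl _ _ {wordAt _} (inj₂ (inj₁ refl)) (_ , q) =
      <⇒≱ q (≤-trans (m≤m+n nodes-base (t + t)) (m≤m+n _ (i + i)))
    new∉output {i} refl refl _ _ {wordAt _} (inj₂ (inj₂ refl)) (_ , q) =
      <⇒≱ q (≤-trans (m≤m+n nodes-base (t + t)) (≤-trans (m≤m+n _ (i + i)) (n≤1+n _)))

    queue+k≤nodes : ∀ {k v ye} → v ≡ nodes-base + (t + t) → ye ≡ n + n + t → t + k ≤ n → ye + k ≤ v
    queue+k≤nodes {k} refl refl t+k≤n = ≤-trans (≤-reflexive (+-assoc (n + n) t k))
      (≤-trans (+-monoʳ-≤ (n + n) t+k≤n) (≤-trans (m≤m+n output n) (m≤m+n nodes-base (t + t))))

  -- After `t` merges, `t` entries have been appended to the queue and `t` nodes have been made.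
  -- Neither space is reclaimed, so `t` alone determines where both end.
  record Loop (r t : ℕ) (xs ys : List Item) (μ : Store) (xa ya ye v : ℕ) : Set where
    field
      invariant : Invariant r xs ys
      xs∈       : Array (Live t) μ xa xs
      ys∈       : Array (Live t) μ ya ys
      xa≡       : xa + length xs ≡ n + n
      ya≡       : ya + length ys ≡ ye
      ye≡       : ye ≡ n + n + t
      v≡        : v ≡ nodes-base + (t + t)
      total     : t + (length xs + length ys) ≡ n

    t≤n : t ≤ n
    t≤n = subst (t ≤_) total (m≤m+n t _)

    xs≤n : length xs ≤ n
    xs≤n = ≤-trans (m≤m+n _ (length ys)) (subst (length xs + length ys ≤_) total (m≤n+m _ t))

    la≡ : n + n ∸ xa ≡ length xs
    la≡ = trans (cong (_∸ xa) (sym xa≡)) (m+n∸m≡n xa _)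

    lb≡ : ye ∸ ya ≡ length ys
    lb≡ = trans (cong (_∸ ya) (sym ya≡)) (m+n∸m≡n ya _)

    all-objects : All (Object (Live t) μ) (xs ⋎ ys)
    all-objects = All-⋎ (array-objects xs∈) (array-objects ys∈)

  loop-resp : ∀ {r t xs ys μ μ′ xa ya ye v} → μ′ ≋[ Live t ] μ →
              Loop r t xs ys μ xa ya ye v → Loop r t xs ys μ′ xa ya ye v
  loop-resp same loop = record
    { invariant = invariant ; xs∈ = array-resp same xs∈ ; ys∈ = array-resp same ys∈
    ; xa≡ = xa≡ ; ya≡ = ya≡ ; ye≡ = ye≡ ; v≡ = v≡ ; total = total }
    where open Loop loop

  module NextRound {r t xs₁ xs₂ ys e₀ e₁ M μ xa ya ye v}
           (loop : Loop r t (xs₁ ++ xs₂) ys μ xa ya ye v)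
           (M≡ : (xs₁ ++ xs₂) ⋎ ys ≡ e₀ ∷ e₁ ∷ M)
           (below : All (λ p → key p ≤ᶠ key e₀ +ᶠ key e₁) xs₁)
           (above : All (λ p → ¬ key p ≤ᶠ key e₀ +ᶠ key e₁) xs₂) where
    open Loop loop public
    open Round invariant M≡ below above public

    objects : All (Object (Live t) μ) frontier
    objects = All-⋎ (array-objects (array-prefix {xs = xs₁} {xs₂} xs∈)) (array-objects ys∈)

    next-loop : ∀ {i s μ′ κ} → κ ≡ k → μ′ ≋[ Live t ] μ →
      Posts (NewNode (pairs frontier) v ye) 0 k μ′ →
      (p : Path xs₁ ys i (s ∸ i)) (q : i + (s ∸ i) ≡ k + k) →
      Loop (suc r) (t + k) (xs′ p q v) (ys′ p q v) μ′ (xa + i) (ya + (s ∸ i)) (ye + κ) (v + κ + κ)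
    next-loop {i} {s} {μ′} refl same new p@(path i≤ j≤ _ _) q = record
      { invariant = next p q v
      ; xs∈ = subst (Array (Live (t + k)) μ′ (xa + i)) (drop-++ˡ i xs₁ i≤)
                (array-drop i (lift xs∈))
      ; ys∈ = array-++ ya′ (array-drop (s ∸ i) (lift ys∈)) (array λ eq → new-entry eq)
      ; xa≡ = trans (+-assoc xa i _) (trans (cong (xa +_) (trans (cong (λ l → i + length l) (sym (drop-++ˡ i xs₁ i≤)))
                (trans (cong (i +_) (length-drop i (xs₁ ++ xs₂)))
                  (m+[n∸m]≡n (≤-trans i≤ (subst (length xs₁ ≤_) (sym (length-++ xs₁)) (m≤m+n _ _))))))) xa≡)
      ; ya≡ = trans (cong (ya + (s ∸ i) +_) (length-++ (drop (s ∸ i) ys)))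
                (trans (sym (+-assoc (ya + (s ∸ i)) _ _)) (cong₂ _+_ ya′ (nodes-length v (pairs frontier))))
      ; ye≡ = trans (cong (_+ k) ye≡) (+-assoc (n + n) t k)
      ; v≡ = trans (cong (λ v → v + k + k) v≡) (shuffle nodes-base t k)
      ; total = trans (shuffle′ t k (length (xs′ p q v) + length (ys′ p q v)))
                  (trans (cong (t +_) (count p q v)) total)
      }
      where
      shuffle : ∀ b t k → b + (t + t) + k + k ≡ b + (t + k + (t + k))
      shuffle = solve-∀
      shuffle′ : ∀ t k c → t + k + c ≡ t + (c + k)
      shuffle′ = solve-∀
      lift : ∀ {a zs} → Array (Live t) μ a zs → Array (Live (t + k)) μ′ a zs
      lift zs∈ = array-⊆ (live-⊆ (m≤m+n t k)) (array-resp same zs∈)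
      ya′ : ya + (s ∸ i) + length (drop (s ∸ i) ys) ≡ ye
      ya′ = trans (+-assoc ya (s ∸ i) _)
              (trans (cong (ya +_) (trans (cong (s ∸ i +_) (length-drop (s ∸ i) ys)) (m+[n∸m]≡n j≤))) ya≡)
      new-entry : ∀ {c x} → nodes v (pairs frontier) ‼ c ≡ just x → Entry (Live (t + k)) μ′ (ye + c) x
      new-entry {c} eq with ‼-nodes v (pairs frontier) eq
      ... | a , b , eq′ , refl with ‼-bound (pairs frontier) eq′
      ... | c<k with new z≤n c<k eq′
      ... | slot≡ , left≡ , right≡ , key′≡ =
        entry (inj₁ (subst (λ y → n ≤ y + c × y + c < n + n + (t + k)) (sym ye≡)
                 (≤-trans (m≤m+n n n) (≤-trans (m≤m+n (n + n) t) (m≤m+n (n + n + t) c)) ,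
                  subst (n + n + t + c <_) (+-assoc (n + n) t k) (+-monoʳ-< (n + n + t) c<k))))
              slot≡
              (object (inj₂ (v≤ , <-trans (n<1+n _) <end)) key′≡
                (node (≤-trans (m≤n+m n output) v≤)
                  (inj₂ (v≤ , <-trans (n<1+n _) <end)) (inj₂ (≤-trans v≤ (n≤1+n _) , <end))
                  (child left≡ (proj₁ (‼-pairs frontier eq′))) (child right≡ (proj₂ (‼-pairs frontier eq′)))))
        where
        v≤ : nodes-base ≤ v + (c + c)
        v≤ = ≤-trans (m≤m+n nodes-base (t + t)) (subst (λ v → nodes-base + (t + t) ≤ v + (c + c)) (sym v≡) (m≤m+n _ (c + c)))
        <end : suc (v + (c + c)) < nodes-base + (t + k + (t + k))
        <end = subst (λ v → suc (v + (c + c)) < nodes-base + (t + k + (t + k))) (sym v≡)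
                 (lin 0 (c<k ⊕ c<k) (bound nodes-base t k c))
          where
          bound : ∀ b t k c → b + (t + k + (t + k)) + (suc c + suc c) ≡ suc (suc (b + (t + t) + (c + c))) + (k + k) + 0
          bound = solve-∀
        child : ∀ {w x j} → w ≡ proj₁ x → frontier ‼ j ≡ just x → Built (Live (t + k)) (words μ′) w (tree x)
        child refl eq″ = built-⊆ (live-⊆ (m≤m+n t k))
          (built-resp same (built (All.lookup objects (‼⇒∈ frontier eq″))))

  module _ {L : ℕ} (1≤L : 1 ≤ L) (n≤2^L : n ≤ 2 ^ L) where

    -- The credit of L * 280 for each round not executed is still available.
    Finished : List ℕ → Store → ℕ → ℕ → Set
    Finished vs μ _ s = Σ[ T ∈ Tree n ] Σ[ p ∈ ℕ ] vs ‼ 0 ≡ just p × IsHuffmanTree T ×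
      words μ ⊨ p ↦ T × n * (L * 280) ≤ s + height T * (L * 280)

    -- `m` is the number of objects and `d` the number of merges so far beyond the first one of each
    -- round. A round that makes `suc k′` nodes spends one share of span and moves `k′` from `m` to
    -- `d`, so r + (m + d) = n is preserved.
    RoundWP : ℕ → ℕ → Store → ℕ → ℕ → ℕ → ℕ → Set₁
    RoundWP m d μ xa ya ye v = ∀ {a q lo hi o t u la b lb s e g₀ g₁} →
      WP everything everything Finished ROUND
        (n ∷ 1 ∷ a ∷ q ∷ lo ∷ hi ∷ o ∷ t ∷ u ∷ la ∷ b ∷ lb ∷ output ∷ s ∷ e ∷ L ∷ 0 ∷
         xa ∷ n + n ∷ ya ∷ ye ∷ v ∷ L ∷ [])
        (g₀ ∷ g₁ ∷ []) μ (5 + m * (L * 480)) (5 + (m + d) * (L * 280))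

    finish-wp : ∀ {r t xs ys μ xa ya ye v m d} → Loop r t xs ys μ xa ya ye v →
      length xs + length ys ≡ m → r + (m + d) ≡ n → m ≤ 1 → RoundWP m d μ xa ya ye v
    finish-wp {r} {t} {xs} {ys} {μ} {xa} {ya} {ye} {v} {m} {d} loop len credit m≤1 =
      relax (m≤m+n 5 _) ≤-refl (ops 1 refl (jle refl refl refl
        (λ _ → pick xs ys xs∈ ys∈ invariant ya≡ (subst (_≤ 1) (sym len) m≤1))
        (λ z≰ → contradiction
          (subst₂ (λ ye n′ → n + n + n′ ≤ suc ye) (sym ye≡) total
            (≤-trans (+-monoʳ-≤ (n + n) (≤-trans (+-monoʳ-≤ t (subst (_≤ 1) (sym len) m≤1)) (≤-reflexive (+-comm t 1))))
              (≤-reflexive (+-suc (n + n) t))))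
          z≰)))
      where
      open Loop loop
      open Invariant using (deep)

      paid : ∀ {h} → r ≤ h → n * (L * 280) ≤ (m + d) * (L * 280) + h * (L * 280)
      paid {h} r≤h = begin
        n * C                 ≡⟨ cong (_* C) credit ⟨
        (r + (m + d)) * C     ≡⟨ *-distribʳ-+ C r (m + d) ⟩
        r * C + (m + d) * C   ≡⟨ +-comm (r * C) ((m + d) * C) ⟩
        (m + d) * C + r * C   ≤⟨ +-monoʳ-≤ ((m + d) * C) (*-monoˡ-≤ C r≤h) ⟩
        (m + d) * C + h * C   ∎
        where
        open ≤-Reasoning
        C : ℕ
        C = L * 280

      pick : ∀ xs ys → Array (Live t) μ xa xs → Array (Live t) μ ya ys → Invariant r xs ys →
        ya + length ys ≡ ye → length xs + length ys ≤ 1 → ∀ {a q lo hi o t u la b lb s e g₀ g₁} →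
        WP everything everything Finished FINISH
          (n ∷ 1 ∷ a ∷ q ∷ lo ∷ hi ∷ o ∷ t ∷ u ∷ la ∷ b ∷ lb ∷ output ∷ s ∷ e ∷ L ∷ 0 ∷
           xa ∷ n + n ∷ ya ∷ ye ∷ v ∷ L ∷ [])
          (g₀ ∷ g₁ ∷ []) μ 3 (3 + (m + d) * (L * 280))
      pick [] [] _ _ inv _ _ with deep inv
      ... | []    , _ , _ , () , _
      ... | _ ∷ _ , _ , _ , () , _
      pick (x ∷ []) [] xs∈ _ inv refl _ = jle refl refl refl
        (λ _ → load refl refl tt (word≡ x∈) (halt refl λ same →
           let huffman , r≤ = final inv refl in
           tree x , _ , refl , huffman , built⇒⊨ (built-resp (≋-⊆ (λ _ → tt) same) (built (isObject x∈))) , paid r≤))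
        (λ ye≰ya → contradiction (≤-reflexive (+-identityʳ ya)) ye≰ya)
        where
        x∈ : Entry (Live t) μ xa x
        x∈ = array-head xs∈
      pick [] (y ∷ []) _ ys∈ inv refl _ = jle refl refl refl
        (λ ye≤ya → contradiction ye≤ya (m+1+n≰m ya))
        (λ _ → load refl refl tt (word≡ y∈) (halt refl λ same →
           let huffman , r≤ = final inv refl in
           tree y , _ , refl , huffman , built⇒⊨ (built-resp (≋-⊆ (λ _ → tt) same) (built (isObject y∈))) , paid r≤))
        where
        y∈ : Entry (Live t) μ ya y
        y∈ = array-head ys∈
      pick (_ ∷ _ ∷ _) _ _ _ _ _ (s≤s ())
      pick (_ ∷ []) (_ ∷ _) _ _ _ _ (s≤s ())
      pick [] (_ ∷ _ ∷ _) _ _ _ _ (s≤s ())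

    module _ {r t m d xs₁ xs₂ ys e₀ e₁ M μ xa ya ye v lb}
             (loop : Loop r t (xs₁ ++ xs₂) ys μ xa ya ye v)
             (M≡ : (xs₁ ++ xs₂) ⋎ ys ≡ e₀ ∷ e₁ ∷ M)
             (below : All (λ p → key p ≤ᶠ key e₀ +ᶠ key e₁) xs₁)
             (above : All (λ p → ¬ key p ≤ᶠ key e₀ +ᶠ key e₁) xs₂)
             (len : length (xs₁ ++ xs₂) + length ys ≡ suc m) (credit : r + (suc m + d) ≡ n)
             (lb≡ys : lb ≡ length ys) (found : words μ output ≡ length xs₁)
             (again : ∀ {t xs ys μ xa ya ye v m′ d} → m′ ≤ m → Loop (suc r) t xs ys μ xa ya ye v →
                      length xs + length ys ≡ m′ → suc r + (m′ + d) ≡ n → RoundWP m′ d μ xa ya ye v)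
      where
      open NextRound loop M≡ below above

      private
        2k≤ : k + k ≤ length xs₁ + length ys
        2k≤ = subst (k + k ≤_) (trans (length-pairs frontier) (⋎-length xs₁ ys)) (m≤m+n (k + k) _)

        xs₁≤xs : length xs₁ ≤ length (xs₁ ++ xs₂)
        xs₁≤xs = subst (length xs₁ ≤_) (sym (length-++ xs₁)) (m≤m+n _ (length xs₂))

        2k≤m : k + k ≤ suc m
        2k≤m = ≤-trans 2k≤ (subst (length xs₁ + length ys ≤_) len (+-monoˡ-≤ (length ys) xs₁≤xs))

        t+m≡n : t + suc m ≡ n
        t+m≡n = trans (cong (t +_) (sym len)) total

        m<n : suc m ≤ n
        m<n = subst (suc m ≤_) t+m≡n (m≤n+m (suc m) t)

        t+k≤n : t + k ≤ n
        t+k≤n = subst (t + k ≤_) t+m≡n (+-monoʳ-≤ t (≤-trans (m≤m+n k k) 2k≤m))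

        xs₁≤n : length xs₁ ≤ n
        xs₁≤n = ≤-trans xs₁≤xs xs≤n

        half≡k : ⌊ length xs₁ + lb /2⌋ ≡ k
        half≡k = trans (cong (λ l → ⌊ length xs₁ + l /2⌋) lb≡ys)
          (trans (cong ⌊_/2⌋ (sym (⋎-length xs₁ ys))) (sym (pairs-length frontier)))

      -- The predecessor of `k` comes with an equation because `k` is a computed length, whereas
      -- `merge-wp` and `pair-wp` expect lengths of the form `suc`.
      round-wp₂ : ∀ k′ → k ≡ suc k′ → ∀ {q lo hi t u la e g₀ g₁} →
        WP everything everything Finished (suc SCAN)
          (n ∷ 1 ∷ xa ∷ q ∷ lo ∷ hi ∷ output ∷ t ∷ u ∷ la ∷ ya ∷ lb ∷ output ∷ 0 ∷ e ∷ L ∷ 0 ∷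
           xa ∷ n + n ∷ ya ∷ ye ∷ v ∷ L ∷ [])
          (g₀ ∷ g₁ ∷ []) μ (L * 260 + (5 + m * (L * 480))) (L * 158 + (5 + (m + d) * (L * 280)))
      round-wp₂ k′ k≡ =
        relax (subst (λ m → 4 + (2 + (suc (k′ + suc k′) * 84 + (2 + (2 + (9 + suc L * 12 + (10 + (2 +
                       (suc k′ * 29 + (6 + (5 + m′ * (L * 480))))))))))) ≤ L * 260 + (5 + m * (L * 480)))
                     m≡ (round-work₂ k′ m′ {L} 1≤L))
              (subst (λ m → 4 + (2 + (L * 70 + (2 + (2 + (9 + suc L * 12 + (10 + (2 +
                       (L * 27 + (6 + (5 + (m′ + (d + k′)) * (L * 280))))))))))) ≤ L * 158 + (5 + m * (L * 280)))
                     credit≡ (round-span₂ (m′ + (d + k′)) {L} 1≤L))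
          (load refl refl tt found (ops 3 refl
          (call refl refl 17 (Live t ∪ Range (Slot output s) 0 s) (Range (Slot output s) 0 s)
            (Outcome frontier output 0 s) (λ _ → tt) (λ _ → tt)
            (merge-wp (array-prefix {xs = xs₁} {xs₂} xs∈) ys∈ refl lb≡ys xs₁-sorted (Invariant.ys-sorted invariant)
              (subst (λ l → s ≤ length xs₁ + l) (sym lb≡ys) (subst (_≤ length xs₁ + length ys) 2k≡s 2k≤))
              (≤-trans xs₁≤n n≤2^L) (≤-trans s≤n n≤2^L) 1≤L
              (λ i< → output∉live t≤n (<-≤-trans i< s≤n)) (trans half²≡2k 2k≡s))
            (λ μ₁ out₁ same₁ → ops 2 refl
              -- The result goes to the scratch word 0, since the output buffer now holds the
              -- elements to be paired.
              (call refl refl 17 everything (_≡ wordAt 0) (Split xs₁ ys 0 s₀) (λ _ → tt) (λ _ → tt)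
                (path-wp (λ _ → tt)
                  (array-resp (live₁ same₁) (array-prefix {xs = xs₁} {xs₂} xs∈)) (array-resp (live₁ same₁) ys∈)
                  refl lb≡ys xs₁-sorted (Invariant.ys-sorted invariant)
                  (subst₂ (λ s l → s ≤ length xs₁ + l) (sym half²≡2k) (sym lb≡ys) 2k≤) tt refl (suc L)
                  (λ _ hi≤ → n<2^[1+L]+m {m = s₀ ∸ lb} L (≤-trans hi≤ (≤-trans xs₁≤n n≤2^L))))
                (λ μ₂ (i , i≡ , i≤ , p) same₂ → load refl refl tt i≡ (ops 9 refl
                  (call refl refl 17
                    ((Live t ∪ Words output nodes-base) ∪ Range new-cells 0 (suc k′)) (Range new-cells 0 (suc k′))
                    (Posts (NewNode (pairs frontier) v ye) 0 (suc k′)) (λ _ → tt) (λ _ → tt)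
                    (pair-wp {ps = pairs frontier}
                      (λ {i′} {x} {y} eq → let eq₁ , eq₂ = ‼-pairs frontier eq in
                         stored out₁ same₁ same₂ (<-trans (n<1+n (i′ + i′)) (odd<s (‼-bound (pairs frontier) eq))) eq₁ ,
                         subst (λ a → Entry (Live t ∪ Words output nodes-base) μ₂ a y) (+-suc output (i′ + i′))
                           (stored out₁ same₁ same₂ (odd<s (‼-bound (pairs frontier) eq)) eq₂))
                      k≡ (≤-trans (subst (_≤ n) k≡ (≤-trans (m≤n+m k t) t+k≤n)) n≤2^L) 1≤L
                      (queue+k≤nodes t≤n v≡ ye≡ t+k′≤n)
                      (λ i< w → [ new∉live t≤n v≡ ye≡ t+k′≤n i< w , new∉output t≤n v≡ ye≡ t+k′≤n i< w ]′)
                      (trans half≡k k≡))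
                    (λ μ₃ new same₃ → ops 5 refl (jump refl
                      (again (m∸n≤m m k′)
                        (next-loop half≡k (live₃ same₁ same₂ same₃) (subst (λ k → Posts (NewNode (pairs frontier) v ye) 0 k μ₃) (sym k≡) new)
                          p (trans (m+[n∸m]≡n i≤) half²≡2k))
                        (count′ (count p (trans (m+[n∸m]≡n i≤) half²≡2k) v)) credit′)))))))))))
        where
        s s₀ m′ : ℕ
        s  = suc (k′ + suc k′)
        s₀ = ⌊ length xs₁ + lb /2⌋ + ⌊ length xs₁ + lb /2⌋
        m′ = m ∸ k′
        half²≡2k : s₀ ≡ k + k
        half²≡2k = cong₂ _+_ half≡k half≡k
        2k≡s : k + k ≡ s
        2k≡s = cong₂ _+_ k≡ k≡
        odd<s : ∀ {i} → i < k → suc (i + i) < s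
        odd<s {i} i<k = subst₂ _≤_ (cong suc (+-suc i i)) 2k≡s (i<k ⊕ i<k)
        s≤n : s ≤ n
        s≤n = subst (_≤ n) 2k≡s (≤-trans 2k≤m m<n)
        m≡ : m′ + k′ ≡ m
        m≡ = m∸n+n≡m (≤-pred (subst (_≤ suc m) k≡ (≤-trans (m≤m+n k k) 2k≤m)))
        credit≡ : m′ + (d + k′) ≡ m + d
        credit≡ = trans (rotate m′ d k′) (cong (_+ d) m≡)
          where
          rotate : ∀ m d k → m + (d + k) ≡ m + k + d
          rotate = solve-∀
        credit′ : suc r + (m′ + (d + k′)) ≡ n
        credit′ = trans (cong (suc r +_) credit≡) (trans (sym (+-suc r (m + d))) credit)
        count′ : ∀ {c} → c + k ≡ length (xs₁ ++ xs₂) + length ys → c ≡ m′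
        count′ {c} eq = trans (sym (m+n∸n≡m c k′)) (cong (_∸ k′) (suc-injective
          (trans (sym (+-suc c k′)) (trans (cong (c +_) (sym k≡)) (trans eq len)))))
        t+k′≤n : t + suc k′ ≤ n
        t+k′≤n = subst (λ k → t + k ≤ n) k≡ t+k≤n
        new-cells : ℕ → Region
        new-cells i c = i < suc k′ × NodeCells v ye i c
        live₁ : ∀ {μ₁} → μ₁ ≋[ everything ∖ Range (Slot output s) 0 s ] μ → μ₁ ≋[ Live t ] μ
        live₁ = ≋-⊆ λ l → tt , λ { (_ , _ , _ , i< , refl) → output∉live t≤n (<-≤-trans i< s≤n) l }
        live₂ : ∀ {μ₁ μ₂} → μ₂ ≋[ everything ∖ (_≡ wordAt 0) ] μ₁ → μ₂ ≋[ Live t ] μ₁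
        live₂ = ≋-⊆ λ l → tt , λ { refl → scratch∉live t≤n l }
        live₃ : ∀ {μ₁ μ₂ μ₃} → μ₁ ≋[ everything ∖ Range (Slot output s) 0 s ] μ →
          μ₂ ≋[ everything ∖ (_≡ wordAt 0) ] μ₁ → μ₃ ≋[ everything ∖ Range new-cells 0 (suc k′) ] μ₂ →
          μ₃ ≋[ Live t ] μ
        live₃ same₁ same₂ same₃ = ≋-trans
          (≋-⊆ (λ l → tt , λ (_ , _ , _ , i< , w) → new∉live t≤n v≡ ye≡ t+k′≤n i< w l) same₃)
          (≋-trans (live₂ same₂) (live₁ same₁))
        stored : ∀ {μ₁ μ₂ j x} → Outcome frontier output 0 s μ₁ →
          μ₁ ≋[ everything ∖ Range (Slot output s) 0 s ] μ → μ₂ ≋[ everything ∖ (_≡ wordAt 0) ] μ₁ →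
          j < s → frontier ‼ j ≡ just x → Entry (Live t ∪ Words output nodes-base) μ₂ (output + j) x
        stored {j = j} out₁ same₁ same₂ j<s eq = entry
          (inj₂ (m≤m+n output j , +-monoʳ-< output (<-≤-trans j<s s≤n)))
          (trans (onWords same₂ (tt , output≢0 t≤n)) (out₁ z≤n j<s eq))
          (object-⊆ inj₁ (object-resp (≋-trans (live₂ same₂) (live₁ same₁)) (All.lookup objects (‼⇒∈ frontier eq))))

      round-wp₂′ : ∀ {q lo hi t u la e g₀ g₁} →
        WP everything everything Finished (suc SCAN)
          (n ∷ 1 ∷ xa ∷ q ∷ lo ∷ hi ∷ output ∷ t ∷ u ∷ la ∷ ya ∷ lb ∷ output ∷ 0 ∷ e ∷ L ∷ 0 ∷
           xa ∷ n + n ∷ ya ∷ ye ∷ v ∷ L ∷ [])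
          (g₀ ∷ g₁ ∷ []) μ (L * 260 + (5 + m * (L * 480))) (L * 158 + (5 + (m + d) * (L * 280)))
      round-wp₂′ = round-wp₂ (pred k) (sym (suc-pred k ⦃ >-nonZero k>0 ⦄))

    module _ {r t m d xs ys e₀ e₁ M μ xa ya ye v} (loop : Loop r t xs ys μ xa ya ye v)
             (M≡ : xs ⋎ ys ≡ e₀ ∷ e₁ ∷ M)
             (len : length xs + length ys ≡ suc m) (credit : r + (suc m + d) ≡ n)
             (again : ∀ {t xs ys μ xa ya ye v m′ d} → m′ ≤ m → Loop (suc r) t xs ys μ xa ya ye v →
                      length xs + length ys ≡ m′ → suc r + (m′ + d) ≡ n → RoundWP m′ d μ xa ya ye v)
      where
      open Loop loop
      open Invariant invariant using (xs-sorted; ys-sorted)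

      private
        two : 2 ≤ length xs + length ys
        two = subst (2 ≤_) (trans (sym (cong length M≡)) (⋎-length xs ys)) (s≤s (s≤s z≤n))

        t+2≤n : t + 2 ≤ n
        t+2≤n = subst (t + 2 ≤_) total (+-monoʳ-≤ t two)

        -- Only its key, the threshold of the round, is in memory at this point.
        w : Item
        w = v , node (tree e₀) (tree e₁)

        object₀ : Object (Live t) μ e₀
        object₀ = All.head (subst (All (Object (Live t) μ)) M≡ all-objects)

        object₁ : Object (Live t) μ e₁
        object₁ = All.head (All.tail (subst (All (Object (Live t) μ)) M≡ all-objects))

        live₁ : ∀ {μ₁} → μ₁ ≋[ everything ∖ Range (Slot output 2) 0 2 ] μ → μ₁ ≋[ Live t ] μ
        live₁ = ≋-⊆ λ l → tt , λ { (_ , _ , _ , i< , refl) → output∉live t≤n (<-≤-trans i< 2≤n) l }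

      round-wp₁ : RoundWP (suc m) d μ xa ya ye v
      round-wp₁ = relax (round-work₁ m {L} 1≤L) (round-span₁ (m + d) {L} 1≤L) (ops 1 refl (jle refl refl refl
        (λ z≤ → contradiction (subst (λ ye → output ≤ suc ye) ye≡ z≤)
          (<⇒≱ (subst (_≤ output) (trans (sym (+-assoc (n + n) t 2)) (trans (+-suc _ 1) (cong suc (+-comm _ 1))))
            (+-monoʳ-≤ (n + n) t+2≤n))))
        (λ _ → ops 6 refl (call refl refl 17 (Live t ∪ Range (Slot output 2) 0 2) (Range (Slot output 2) 0 2)
          (Outcome (xs ⋎ ys) output 0 2) (λ _ → tt) (λ _ → tt)
          (merge-wp xs∈ ys∈ la≡ lb≡ xs-sorted ys-sorted
            (subst (2 ≤_) (sym (cong₂ _+_ la≡ lb≡)) two) la≤ (≤-trans 2≤n n≤2^L) 1≤L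
            (λ i< → output∉live t≤n (<-≤-trans i< 2≤n)) refl)
          (λ μ₁ out₁ same₁ →
            load-key {x = e₀} (keyAt tt (trans (cong (words μ₁) (sym (+-identityʳ output)))
                                  (out₁ z≤n (s≤s z≤n) (cong (_‼ 0) M≡)))
                            tt (key≡ (object-resp (live₁ same₁) object₀)))
              refl refl refl refl
            (ops 1 refl (load-key {x = e₁} (keyAt tt (trans (cong (words μ₁) (+-comm 1 output))
                                               (out₁ z≤n (s≤s (s≤s z≤n)) (cong (_‼ 1) M≡)))
                            tt (key≡ (object-resp (live₁ same₁) object₁)))
              refl refl refl refl
            -- The threshold is stored at `v`, which is not yet live: it is the address of the first
            -- new node of this round, whose frequency is this very sum.
            (ops 1 refl (fstore refl refl refl tt (ops 1 refl (store refl refl refl tt (ops 4 refl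
              (search-phase μ₁ (live₁ same₁))))))))))))))
        where
        la≤ : n + n ∸ xa ≤ 2 ^ L
        la≤ = ≤-trans (≤-reflexive la≡) (≤-trans xs≤n n≤2^L)

        search-phase : ∀ μ₁ → μ₁ ≋[ Live t ] μ → ∀ {t′ u e g₀ g₁} →
          WP everything everything Finished SCAN
            (n ∷ 1 ∷ xa ∷ 0 ∷ 0 ∷ n + n ∸ xa ∷ output ∷ t′ ∷ u ∷ n + n ∸ xa ∷ ya ∷ ye ∸ ya ∷ output ∷ 0 ∷ e ∷
             L ∷ 0 ∷ xa ∷ n + n ∷ ya ∷ ye ∷ v ∷ L ∷ [])
            (g₀ ∷ g₁ ∷ []) ⟨ words μ₁ [ 0 ≔ v ] , freqs μ₁ [ v ≔ key w ] ⟩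
            (2 + (3 + suc L * 12 + (L * 260 + (5 + m * (L * 480)))))
            (2 + (3 + suc L * 12 + (L * 158 + (5 + (m + d) * (L * 280)))))
        search-phase μ₁ same₁ =
          call refl refl 17 everything (_≡ wordAt output)
            (Boundary (xs ‼_) (λ _ → just w) 0 (n + n ∸ xa) output) (λ _ → tt) (λ _ → tt)
            (search-wp (xs ‼_) (λ _ → just w) faces
              (λ { p≤p′ X≡ X≡′ refl refl x′⊑w → ≤ᶠ-trans (sorted-‼ xs-sorted p≤p′ X≡ X≡′) x′⊑w })
              tt refl (suc L) z≤n z≤n ≤-refl (n<2^[1+L]+m {m = 0} L la≤)
              (λ _ ()) (λ hi≤p p<hi → contradiction hi≤p (<⇒≱ p<hi)))
            (λ μ₄ (i , i≡ , _ , i≤ , below , above) same₄ →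
              round-wp₂′ {xs₁ = take i xs} {drop i xs}
                (subst (λ xs → Loop r t xs ys μ₄ xa ya ye v) (sym (take++drop≡id i xs))
                  (loop-resp (≋-trans (live₄ same₄) same₃) loop))
                (trans (cong (_⋎ ys) (take++drop≡id i xs)) M≡)
                (All.tabulate λ p∈ → let _ , eq = ∈⇒‼ p∈ ; j<i , eq′ = ‼-take i xs eq in
                  below z≤n j<i eq′ refl)
                (All.tabulate λ p∈ → let j , eq = ∈⇒‼ p∈ ; eq′ = trans (sym (‼-drop i xs j)) eq in
                  above (m≤m+n i j) (subst (i + j <_) (sym la≡) (‼-bound xs eq′)) eq′ refl)
                (trans (cong (λ xs → length xs + length ys) (take++drop≡id i xs)) len)
                credit lb≡
                (trans i≡ (sym (trans (length-take i xs) (m≤n⇒m⊓n≡m (≤-trans i≤ (≤-reflexive la≡))))))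
                again)
          where
          μ₃ : Store
          μ₃ = ⟨ words μ₁ [ 0 ≔ v ] , freqs μ₁ [ v ≔ key w ] ⟩
          v∉live : ¬ Live t (freqAt v)
          v∉live l = new∉live t≤n {0} {1} refl refl (≤-trans (+-monoʳ-≤ t (s≤s z≤n)) t+2≤n) (s≤s z≤n)
            {freqAt v} (trans v≡ (sym (+-identityʳ _))) l
          same₃ : μ₃ ≋[ Live t ] μ
          same₃ = ≋-trans (store-word ⟨ words μ₁ , freqs μ₁ [ v ≔ key w ] ⟩ 0 v (scratch∉live t≤n))
                    (≋-trans (store-freq μ₁ v (key w) v∉live) same₁)
          live₄ : ∀ {μ₄} → μ₄ ≋[ everything ∖ (_≡ wordAt output) ] μ₃ → μ₄ ≋[ Live t ] μ₃
          live₄ = ≋-⊆ λ l → tt , λ { refl → output∉live {t} t≤n {0} (≤-trans (s≤s z≤n) 2≤n)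
            (subst (λ a → Live t (wordAt a)) (sym (+-identityʳ output)) l) }
          faces : ∀ {p} → 0 ≤ p → p < n + n ∸ xa →
            Σ[ x ∈ Item ] Σ[ y ∈ Item ] xs ‼ p ≡ just x × just w ≡ just y ×
              KeyAt everything μ₃ (xa + p) x × KeyAt everything μ₃ (0 ∸ p) y
          faces {p} _ p< =
            let x , X≡ = ‼-< xs (subst (p <_) la≡ p<)
            in x , w , X≡ , refl , entry⇒keyAt (λ _ → tt) (at (array-resp same₃ xs∈) X≡) ,
               keyAt tt (trans (cong (words μ₃) (0∸n≡0 p)) (≔-same (words μ₁) 0)) tt (≔-same (freqs μ₁) v)

    two-elements : ∀ (xs : List Item) → 2 ≤ length xs →
                   Σ[ x ∈ Item ] Σ[ y ∈ Item ] Σ[ M ∈ List Item ] xs ≡ x ∷ y ∷ M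
    two-elements (x ∷ y ∷ M) _        = x , y , M , refl
    two-elements (_ ∷ [])    (s≤s ())

    -- The number of objects that a round removes depends on the input, so the recursion is on a
    -- bound of `m` and not on `m` itself.
    loop-wp : ∀ fuel {r t xs ys μ xa ya ye v m d} → m ≤ fuel → Loop r t xs ys μ xa ya ye v →
      length xs + length ys ≡ m → r + (m + d) ≡ n → RoundWP m d μ xa ya ye v
    loop-wp fuel {m = zero}        _ loop len credit = finish-wp loop len credit z≤n
    loop-wp fuel {m = suc zero}    _ loop len credit = finish-wp loop len credit ≤-refl
    loop-wp (suc fuel) {xs = xs} {ys} {m = suc (suc m)} (s≤s m≤) loop len credit =
      let _ , _ , _ , M≡ = two-elements (xs ⋎ ys)
            (subst (2 ≤_) (sym (trans (⋎-length xs ys) len)) (s≤s (s≤s z≤n)))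
      in round-wp₁ loop M≡ len credit (λ m′≤ → loop-wp fuel (≤-trans m′≤ m≤))

-- The whole program

‼-tabulate : ∀ {A : Set} {m} (g : Fin m → A) {i x} → tabulate g ‼ i ≡ just x →
             Σ[ j ∈ Fin m ] toℕ j ≡ i × x ≡ g j
‼-tabulate {m = suc m} g {zero}  refl = Fin.zero , refl , refl
‼-tabulate {m = suc m} g {suc i} eq with ‼-tabulate (g ∘ Fin.suc) eq
... | j , refl , x≡ = Fin.suc j , refl , x≡

zeros-∼ : ∀ {V : Set} {z : V} k → (λ _ → z) ∼ replicate k z
zeros-∼ zero    = []
zeros-∼ (suc k) = refl ∷ zeros-∼ k

module Main (𝓕 : FrequencyDomain) {n : ℕ} (f : Fin n → FrequencyDomain.Freq 𝓕)
  (f≥0 : NonNegative 𝓕 f) (2≤n : 2 ≤ n) where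
  open FrequencyDomain 𝓕
  open Rounds 𝓕 f f≥0 2≤n
  open Huffman 𝓕 f

  L : ℕ
  L = ⌈log₂ n ⌉

  1≤L : 1 ≤ L
  1≤L = log₂≥1 2≤n

  n≤2^L : n ≤ 2 ^ L
  n≤2^L = n≤2^log₂n L {n} refl

  1≤n : 1 ≤ n
  1≤n = ≤-trans (s≤s z≤n) 2≤n

  leaves : List Item
  leaves = tabulate (λ i → toℕ i , leaf i)

  μ₀ : Store
  μ₀ = proj₂ (initial f)

  input≡ : ∀ i → freqs μ₀ (toℕ i) ≡ f i
  input≡ i with toℕ i <? n
  ... | yes i<n = cong f (fromℕ<-toℕ i i<n)
  ... | no i≮n  = contradiction (toℕ<n i) i≮n

  leaf-objects : All (Object Leaves μ₀) leaves
  leaf-objects = All.tabulate⁺ λ i → object (toℕ<n i) (input≡ i) (leaf i)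

  leaves-numbered : Numbered 0 leaves
  leaves-numbered eq with ‼-tabulate (λ i → toℕ i , leaf i) eq
  ... | _ , refl , refl = refl

  Q : List ℕ → Store → ℕ → ℕ → Set
  Q = Finished 1≤L n≤2^L

  -- Adding one before halving computes `⌈ x /2⌉`; with this rounding each iteration lowers
  -- `⌈log₂ x ⌉` by exactly one.
  log-wp : ∀ j {x l μ w s g₀ g₁} → ⌈log₂ x ⌉ ≡ j → l + j ≡ L →
    (∀ {x} → WP everything everything Q READY
      (n ∷ 1 ∷ 0 ∷ 0 ∷ 0 ∷ 0 ∷ 0 ∷ x ∷ 0 ∷ 0 ∷ 0 ∷ 0 ∷ 0 ∷ 0 ∷ 0 ∷ 0 ∷ 0 ∷ 0 ∷ 0 ∷ 0 ∷ 0 ∷ 0 ∷ L ∷ [])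
      (g₀ ∷ g₁ ∷ []) μ w s) →
    WP everything everything Q LOG
      (n ∷ 1 ∷ 0 ∷ 0 ∷ 0 ∷ 0 ∷ 0 ∷ x ∷ 0 ∷ 0 ∷ 0 ∷ 0 ∷ 0 ∷ 0 ∷ 0 ∷ 0 ∷ 0 ∷ 0 ∷ 0 ∷ 0 ∷ 0 ∷ 0 ∷ l ∷ [])
      (g₀ ∷ g₁ ∷ []) μ (1 + j * 5 + w) (1 + j * 5 + s)
  log-wp zero {x} {l} log≡ l≡ continue with refl ← trans (sym (+-identityʳ l)) l≡ = jle refl refl refl
    (λ _ → continue)
    (λ x≰1 → contradiction (subst (1 ≤_) log≡ (log₂≥1 (≰⇒> x≰1))) (n≮n 0))
  log-wp (suc j) {x} {l} log≡ l≡ continue = jle refl refl refl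
    (λ x≤1 → case trans (sym (log₂≡0 x≤1)) log≡ of λ ())
    (λ _ → ops 3 refl (jump refl (log-wp j (log₂-half {x} log≡) (trans (sym (+-suc l j)) l≡) continue)))

  start : ∀ {μ} → SortedAt leaves (n + 0) μ → μ ≋[ everything ∖ Block n (n + n) 0 n ] μ₀ →
    Σ[ xs ∈ List Item ] length xs ≡ n × Loop 0 0 xs [] μ n (n + n) (n + n) nodes-base
  start {μ} (sortedAt {xs} xs↭ sorted xs≡) same = xs , xs-length , record
    { invariant = record
      { xs-sorted = sorted ; ys-sorted = [] ; bounded = λ _ → [] ; deep = first xs xs-length
      ; reachable = _ , ε , ↭-trans (↭-reflexive (trans (map-tabulate (λ i → i) leaf)
                      (sym (map-tabulate (λ i → toℕ i , leaf i) tree))))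
                      (map⁺ tree (↭-trans (↭-sym xs↭) (↭-reflexive (sym (++-identityʳ xs))))) }
    ; xs∈ = make-array (λ {i} eq → trans (cong (λ a → words μ (a + i)) (sym (+-identityʳ n))) (xs≡ eq))
              (λ {i} i< → inj₁ (m≤m+n n i , subst (n + i <_) (sym (+-identityʳ (n + n)))
                 (+-monoʳ-< n (subst (i <_) xs-length i<))))
              (All-resp-↭ (↭-sym xs↭) (All.map (object-⊆ leaves⊆ ∘ object-resp (≋-⊆ unsorted same)) leaf-objects))
    ; ys∈ = array λ ()
    ; xa≡ = cong (n +_) xs-length
    ; ya≡ = +-identityʳ (n + n)
    ; ye≡ = sym (+-identityʳ (n + n))
    ; v≡ = sym (+-identityʳ nodes-base)
    ; total = trans (+-identityʳ (length xs)) xs-length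
    }
    where
    xs-length : length xs ≡ n
    xs-length = trans (↭-length xs↭) (length-tabulate _)
    first : ∀ xs → length xs ≡ n →
      Σ[ R ∈ List Item ] Σ[ v ∈ Item ] Σ[ M ∈ List Item ]
        xs ⋎ [] ≡ R ++ v ∷ M × length R ≤ 1 × 0 ≤ height (tree v)
    first []       refl = contradiction 1≤n (n≮n 0)
    first (x ∷ xs) _    = [] , x , xs , refl , z≤n , z≤n
    leaves⊆ : Leaves ⊆ Live 0
    leaves⊆ {freqAt _} l = inj₁ l
    unsorted : Leaves ⊆ everything ∖ Block n (n + n) 0 n
    unsorted {freqAt _} _ = tt , λ { (inj₁ ()) ; (inj₂ ()) }

  main-wp : WP everything everything Q 0 (n ∷ replicate 22 0) (0ᶠ ∷ 0ᶠ ∷ []) μ₀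
    (3 + (1 + L * 5 + (6 + (2 + (suc L * (n * 106) + (4 + (5 + n * (L * 480))))))))
    (3 + (1 + L * 5 + (6 + (2 + (suc L * (L * 90) + (4 + (5 + n * (L * 280))))))))
  main-wp = ops 3 refl (log-wp L {n} {0} refl refl (ops 6 refl
    (call refl refl 19 (Leaves ∪ Block n (n + n) 0 n) (Block n (n + n) 0 n) (SortedAt leaves (n + 0))
      (λ _ → tt) (λ _ → tt)
      (relax (≤-reflexive (cong (λ m → suc L * (m * 106)) n≡)) ≤-refl
        (sort-wp 1≤L n≤2^L L (sym n≡) ≤-refl (subst (_≤ 2 ^ L) (sym n≡) n≤2^L) (inj₁ ≤-refl)
          (trans (length-tabulate _) (sym n≡)) leaves-numbered leaf-objects))
      (λ μ sorted same → let xs , xs-length , loop = start sorted same in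
        ops 4 refl (relax ≤-refl (≤-reflexive (cong (λ m → 5 + m * (L * 280)) (+-identityʳ n)))
          (loop-wp 1≤L n≤2^L n {d = 0} ≤-refl loop (trans (+-identityʳ _) xs-length) (+-identityʳ n)))))))
    where
    n≡ : suc (pred n) ≡ n
    n≡ = suc-pred n ⦃ >-nonZero 1≤n ⦄

theorem4p7 : Σ[ P ∈ Program ] Σ[ c ∈ ℕ ]
    ((𝓕 : FrequencyDomain) (let open FrequencyDomain 𝓕) →
    ∀ n → 2 ≤ n →
    (f : Fin n → Freq) → (∀ i → 0ᶠ <ᶠ f i) →
    ConstructsHuffmanTree 𝓕 P f
    (c * (n * ⌈log₂ n ⌉))
    (λ H → c * (H * ⌈log₂ n ⌉)))
theorem4p7 = program , 718 , λ 𝓕 n 2≤n f f>0 →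
  let open FrequencyDomain 𝓕
      f≥0 : ∀ i → 0ᶠ ≤ᶠ f i
      f≥0 i = proj₁ (f>0 i)
      open Main 𝓕 f f≥0 2≤n
      open Rounds 𝓕 f f≥0 2≤n
  -- The program mentions the word registers 0 to 22 and the frequency registers 0 and 1, so 23 and
  -- 2 entries record all that matters.
  in safe⇒allRuns {W = everything} (sound main-wp (∼-update 0 n (zeros-∼ 23)) (zeros-∼ 2) ≋-refl
       λ { r∼ (T , p , eq , huffman , p↦T , credit) w≤ s≤ →
           T , huffman , subst (λ q → _ ⊨ q ↦ T) (sym (∼-lookup r∼ eq)) p↦T ,
           ≤-trans (m≤m+n _ _) (≤-trans w≤ (total-work (≤-trans (s≤s z≤n) 2≤n) 1≤L)) ,
           total-span {n} 1≤L (log≤height huffman) s≤ credit })
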